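{- Let $A\subset\mathbb{Z}^2$ be a minimal set. The following are equivalent: (1) $A$ is dead; (2) $A$ is a box that is not efficient; (3) $A$ is a box that is not congruent to $B(m,m)$ or $B(m,m+1)$ for any $m\in\mathbb{N}$, nor to $B(m-1,m+1)$ for any odd $m\in\mathbb{N}$.
   Context: $X$ is the graph with vertex set $\mathbb{Z}^2$ in which $(x,y)$ and $(x',y')$ are adjacent iff $|x-x'|+|y-y'|=1$. For $A\subset\mathbb{Z}^2$, $\partial A=\{u\in\mathbb{Z}^2\setminus A:\ u \text{ adjacent to some } v\in A\}$. A finite nonempty set $A$ is minimal if $|\partial A|\le|\partial C|$ for all $C$ with $|C|=|A|$. A finite set $A$ is efficient if $|\partial C|=|\partial A|$ implies $|A|\ge|C|$ for every finite $C$. Two sets are congruent if some graph automorphism of $X$ maps one onto the other. For integers $a,b,c,d$, $B(a,b,c,d)=\{(x,y): a\le y-x\le b,\ c\le y+x\le d\}$; a box is a nonempty set of this form; $B(\alpha,\beta)=B(0,\alpha,0,\beta)$. The life expectancy of a minimal set $A$ is the supremum (in $\mathbb{N}\cup\{\infty\}$) of all $n$ such that there is a nested sequence $A=A_0\subset A_1\subset\dots\subset A_n$ of minimal sets with $|A_i|=|A|+i$; $A$ is dead if its life expectancy is $0$. -}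

module Defs where

open import Data.Unit using (⊤)
open import Data.Nat as ℕ using (ℕ; zero; suc)
open import Data.Integer as ℤ using (ℤ; +_; _-_; _≤_; ∣_∣)
open import Data.Integer.Properties using () renaming (_≟_ to _≟ℤ_)
open import Data.Product using (Σ; ∃; ∃-syntax; _×_; _,_; proj₁)
open import Data.Product.Properties using (≡-dec)
open import Data.List using (List; []; _∷_; length; filter; concatMap; deduplicate)
open import Data.List.Relation.Unary.Unique.Propositional using (Unique)
open import Data.List.Membership.Propositional using (_∈_; _∉_)
import Data.List.Membership.DecPropositional as DecMem
open import Relation.Nullary using (¬_; ¬?)
open import Relation.Binary.Definitions using (DecidableEquality)
open import Relation.Binary.PropositionalEquality using (_≡_)
open import Function.Bundles using (_⇔_)

Pt : Set
Pt = ℤ × ℤ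

_≟ₚ_ : DecidableEquality Pt
_≟ₚ_ = ≡-dec _≟ℤ_ _≟ℤ_

open DecMem _≟ₚ_ using (_∈?_)

Adj : Pt → Pt → Set
Adj (x , y) (x' , y') = ∣ x - x' ∣ ℕ.+ ∣ y - y' ∣ ≡ 1

neighbours : Pt → List Pt
neighbours (x , y) =
  (x ℤ.+ ℤ.1ℤ , y) ∷ (x - ℤ.1ℤ , y) ∷ (x , y ℤ.+ ℤ.1ℤ) ∷ (x , y - ℤ.1ℤ) ∷ []

FinSet : Set
FinSet = Σ (List Pt) Unique

elems : FinSet → List Pt
elems = proj₁

size : FinSet → ℕ
size A = length (elems A)

_∈ₛ_ : Pt → FinSet → Set
p ∈ₛ A = p ∈ elems A

_⊆ₛ_ : FinSet → FinSet → Set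
A ⊆ₛ B = ∀ p → p ∈ₛ A → p ∈ₛ B

boundary : FinSet → List Pt
boundary A =
  deduplicate _≟ₚ_ (filter (λ u → ¬? (u ∈? elems A)) (concatMap neighbours (elems A)))

bsize : FinSet → ℕ
bsize A = length (boundary A)

Minimal : FinSet → Set
Minimal A = (∃[ p ] p ∈ₛ A) × (∀ (C : FinSet) → size C ≡ size A → bsize A ℕ.≤ bsize C)

Efficient : FinSet → Set
Efficient A = ∀ (C : FinSet) → bsize C ≡ bsize A → size C ℕ.≤ size A

-- Nested sequences A = A₀ ⊂ A₁ ⊂ … ⊂ Aₙ of minimal sets with |Aᵢ| = |A| + i
-- (A₀ = A itself is assumed minimal separately).
MinChain : FinSet → ℕ → Set
MinChain A zero = ⊤
MinChain A (suc n) =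
  ∃[ A' ] (A ⊆ₛ A' × size A' ≡ suc (size A) × Minimal A' × MinChain A' n)

-- Life expectancy 0: the supremum of all n admitting such a chain is 0,
-- i.e. every such n equals 0.
Dead : FinSet → Set
Dead A = ∀ n → MinChain A n → n ≡ 0

InBox : ℤ → ℤ → ℤ → ℤ → Pt → Set
InBox a b c d (x , y) = (a ≤ y - x × y - x ≤ b) × (c ≤ y ℤ.+ x × y ℤ.+ x ≤ d)

InB : ℤ → ℤ → Pt → Set
InB α β = InBox (+ 0) α (+ 0) β

IsBox : FinSet → Set
IsBox A = ∃[ a ] ∃[ b ] ∃[ c ] ∃[ d ]
  ((∃[ p ] InBox a b c d p) × (∀ p → (p ∈ₛ A) ⇔ InBox a b c d p))

record Automorphism : Set where
  field
    fun     : Pt → Pt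
    inv     : Pt → Pt
    inv-l   : ∀ p → inv (fun p) ≡ p
    inv-r   : ∀ p → fun (inv p) ≡ p
    adj     : ∀ p q → Adj p q ⇔ Adj (fun p) (fun q)

Congruent : (Pt → Set) → (Pt → Set) → Set
Congruent P Q = ∃[ f ] (∀ p → Q p ⇔ (∃[ q ] (P q × Automorphism.fun f q ≡ p)))

⟦_⟧ : FinSet → Pt → Set
⟦ A ⟧ p = p ∈ₛ A

Odd : ℕ → Set
Odd m = ∃[ k ] m ≡ suc (2 ℕ.* k)

{-# OPTIONS --safe #-}

-- In the coordinates u = y - x, v = y + x the neighbours of a point are (u ± 1, v ± 1), and a
-- box is a rectangle.  Boundaries are compared through closed neighbourhoods Cl A, of size
-- |A| + |∂A|.
--
-- Removing a topmost point never increases |∂A|, so the least boundary is monotone in the size.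
-- Hence a minimal set is not dead if some point outside it enlarges its closed neighbourhood by
-- at most one.  Suppose there is no such point.  A box inside A then swallows the whole side or
-- corner as soon as A contains a point next to it, so the box grown from a point with u maximal
-- is isolated from the rest R of A: the two closed neighbourhoods meet in at most two corners
-- on the left.  If R is nonempty, shifting the box by two to the left (when they meet) or
-- placing it to the right of R (when they do not) enlarges the overlap and so decreases |∂A|.
-- Thus dead minimal sets are boxes, and every finite set is dominated by a box that is at least
-- as large and has at most the same boundary.
--
-- A box with sides α, β has |∂| = α + β + 4 and (α + 1)(β + 1) / 2 points, up to rounding that
-- depends on whether its corners are lattice points; this decides which boxes are efficient.
-- Adding any point to a box increases the boundary, so an inefficient minimal box is dead; adding
-- a point along a side increases it by one only, so an efficient one is not.

module Submission where

open import Defs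
open import Data.Bool using (Bool; true; false; T; not)
open import Data.Empty using (⊥; ⊥-elim)
open import Data.Fin using (Fin; zero; suc)
open import Data.Integer as ℤ using (ℤ; +_; -[1+_]; _-_; _+_; _*_; -_; _≤_; 0ℤ; 1ℤ; +≤+; ∣_∣)
import Data.Integer.Properties as ℤₚ
open import Data.Integer.Tactic.RingSolver using (solve-∀)
open import Data.List using (List; []; _∷_; _++_; concatMap; map; length; filter; deduplicate; cartesianProduct; upTo)
import Data.List.Properties as Listₚ
open import Data.List.Extrema ℤₚ.≤-totalOrder using (argmax; argmax-sel; f[xs]≤f[argmax])
open import Data.List.Membership.Propositional using (_∈_; _∉_; find; lose)
import Data.List.Membership.DecPropositional as DecMembership
open import Data.List.Membership.Propositional.Properties
open import Data.List.Relation.Binary.Subset.Propositional using (_⊆_)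
open import Data.List.Relation.Unary.All as All using (All; []; _∷_)
import Data.List.Relation.Unary.All.Properties as Allₚ
open import Data.List.Relation.Unary.AllPairs using ([]; _∷_)
open import Data.List.Relation.Unary.Any using (here; there; any?)
open import Data.List.Relation.Unary.Unique.Propositional using (Unique)
import Data.List.Relation.Unary.Unique.Propositional.Properties as Uniqueₚ
open import Data.List.Relation.Unary.Unique.DecPropositional.Properties _≟ₚ_ using (deduplicate-!)
open import Data.Nat as ℕ using (ℕ; zero; suc; z≤n; s≤s; ⌊_/2⌋; ⌈_/2⌉)
open import Data.Nat.Induction using (<-wellFounded)
import Data.Nat.Properties as ℕₚ
import Data.Nat.Tactic.RingSolver as ℕ-Solver
open import Data.Product using (Σ; ∃-syntax; _×_; _,_; proj₁; proj₂)
open import Data.Sum using (_⊎_; inj₁; inj₂; [_,_]′)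
open import Data.Unit using (tt)
open import Data.Vec as Vec using (Vec; []; _∷_; lookup; replicate; zipWith)
open import Data.Vec.N-ary using (N-ary; ∀ⁿ; _$ⁿ_; curryⁿ)
open import Function using (_∘_; case_of_)
open import Function.Bundles using (_⇔_; mk⇔; Equivalence)
open import Induction.WellFounded using (Acc; acc)
open import Relation.Binary.PropositionalEquality using (_≡_; _≢_; refl; sym; trans; cong; cong₂; subst; subst₂)
open import Relation.Nullary using (¬_; Dec; yes; no; ¬?)
open import Relation.Nullary.Decidable using (_×-dec_; _⊎-dec_; map′; decidable-stable)
open import Relation.Unary using (Decidable)
open DecMembership _≟ₚ_ using (_∈?_)

-- Inserting a point outside A changes the size of the boundary by the number of points that the
-- closed neighbourhood gains, minus one. A set is therefore stuck when every boundary point would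
-- gain at least two. This is what makes a box spread: if A contains a point beside a side of the
-- box, three of the four neighbours of the next position along that side are already in the closed
-- neighbourhood, so that position cannot be missing. Two things complicate the geometry. Only half
-- of the pairs (u, v) are lattice points, and boxes with a single row or column behave differently:
-- their lattice points are two apart, none lies directly beyond their ends, and their bounds may be
-- loose, which `Tight` forbids. The seed has u maximal so that nothing of A lies to the right of
-- the box. All contacts are then on the left, and a shift to the left loses none of them.
-- Domination by a box repeats extensions and improvements until a box is left. It ends because a
-- set with boundary k has at most k * k points. Optimality of a box then becomes a comparison of
-- areas, in which the parity of the corners is worth at most one.

module LinearArithmetic where

  -- Linear integer arithmetic by reflected Fourier-Motzkin elimination

  infixl 7 _:+_ _:-_
  infix 6 _:≤_ _:≡_
  infixr 5 _⇒_ ⊢_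
  infix 8 #_ :-_

  data Expr (n : ℕ) : Set where
    var       : Fin n → Expr n
    #_        : ℕ → Expr n
    _:+_ _:-_ : Expr n → Expr n → Expr n
    :-_       : Expr n → Expr n

  data Atom (n : ℕ) : Set where
    _:≤_ _:≡_ : Expr n → Expr n → Atom n

  data Sequent (n : ℕ) : Set where
    _⇒_ : Atom n → Sequent n → Sequent n
    ⊢_  : Atom n → Sequent n
    ⊢⊥  : Sequent n

  Env : ℕ → Set
  Env = Vec ℤ

  ⟦_⟧ᵉ : ∀ {n} → Expr n → Env n → ℤ
  ⟦ var i ⟧ᵉ ρ = lookup ρ i
  ⟦ # k ⟧ᵉ ρ = + k
  ⟦ e :+ f ⟧ᵉ ρ = ⟦ e ⟧ᵉ ρ + ⟦ f ⟧ᵉ ρ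
  ⟦ e :- f ⟧ᵉ ρ = ⟦ e ⟧ᵉ ρ - ⟦ f ⟧ᵉ ρ
  ⟦ :- e ⟧ᵉ ρ = - ⟦ e ⟧ᵉ ρ

  ⟦_⟧ᵃ : ∀ {n} → Atom n → Env n → Set
  ⟦ e :≤ f ⟧ᵃ ρ = ⟦ e ⟧ᵉ ρ ≤ ⟦ f ⟧ᵉ ρ
  ⟦ e :≡ f ⟧ᵃ ρ = ⟦ e ⟧ᵉ ρ ≡ ⟦ f ⟧ᵉ ρ

  ⟦_⟧ˢ : ∀ {n} → Sequent n → Env n → Set
  ⟦ a ⇒ s ⟧ˢ ρ = ⟦ a ⟧ᵃ ρ → ⟦ s ⟧ˢ ρ
  ⟦ ⊢ a ⟧ˢ ρ = ⟦ a ⟧ᵃ ρ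
  ⟦ ⊢⊥ ⟧ˢ ρ = ⊥

  -- An affine form Σ kᵢ xᵢ + k.
  Form : ℕ → Set
  Form n = Vec ℤ n × ℤ

  ⟦_⟧ᶠ : ∀ {n} → Form n → Env n → ℤ
  ⟦ [] , k ⟧ᶠ [] = k
  ⟦ c ∷ cs , k ⟧ᶠ (x ∷ ρ) = c * x + ⟦ cs , k ⟧ᶠ ρ

  scale : ∀ {n} → ℤ → Form n → Form n
  scale m (cs , k) = Vec.map (m *_) cs , m * k

  _⊕_ : ∀ {n} → Form n → Form n → Form n
  (cs , k) ⊕ (ds , l) = zipWith _+_ cs ds , k + l

  unit : ∀ {n} → Fin n → Vec ℤ n
  unit zero = 1ℤ ∷ replicate _ 0ℤ
  unit (suc i) = 0ℤ ∷ unit i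

  scale-correct : ∀ {n} m (f : Form n) ρ → ⟦ scale m f ⟧ᶠ ρ ≡ m * ⟦ f ⟧ᶠ ρ
  scale-correct m ([] , k) [] = refl
  scale-correct m (c ∷ cs , k) (x ∷ ρ) rewrite scale-correct m (cs , k) ρ = lemma m c x _
    where
    lemma : ∀ m c x r → (m * c) * x + m * r ≡ m * (c * x + r)
    lemma = solve-∀

  ⊕-correct : ∀ {n} (f g : Form n) ρ → ⟦ f ⊕ g ⟧ᶠ ρ ≡ ⟦ f ⟧ᶠ ρ + ⟦ g ⟧ᶠ ρ
  ⊕-correct ([] , k) ([] , l) [] = refl
  ⊕-correct (c ∷ cs , k) (d ∷ ds , l) (x ∷ ρ) rewrite ⊕-correct (cs , k) (ds , l) ρ =
    lemma c d x _ _
    where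
    lemma : ∀ c d x r s → (c + d) * x + (r + s) ≡ (c * x + r) + (d * x + s)
    lemma = solve-∀

  const-correct : ∀ {n} k (ρ : Env n) → ⟦ replicate n 0ℤ , k ⟧ᶠ ρ ≡ k
  const-correct k [] = refl
  const-correct k (x ∷ ρ) rewrite const-correct k ρ = lemma k x
    where
    lemma : ∀ k x → 0ℤ * x + k ≡ k
    lemma = solve-∀

  unit-correct : ∀ {n} i (ρ : Env n) → ⟦ unit i , 0ℤ ⟧ᶠ ρ ≡ lookup ρ i
  unit-correct zero (x ∷ ρ) rewrite const-correct 0ℤ ρ = lemma x
    where
    lemma : ∀ x → 1ℤ * x + 0ℤ ≡ x
    lemma = solve-∀
  unit-correct (suc i) (x ∷ ρ) rewrite unit-correct i ρ = lemma x _
    where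
    lemma : ∀ x y → 0ℤ * x + y ≡ y
    lemma = solve-∀

  affine : ∀ {n} → Expr n → Form n
  affine (var i) = unit i , 0ℤ
  affine (# k) = replicate _ 0ℤ , + k
  affine (e :+ f) = affine e ⊕ affine f
  affine (e :- f) = affine e ⊕ scale (- 1ℤ) (affine f)
  affine (:- e) = scale (- 1ℤ) (affine e)

  scale-neg : ∀ {n} (f : Form n) ρ → ⟦ scale (- 1ℤ) f ⟧ᶠ ρ ≡ - ⟦ f ⟧ᶠ ρ
  scale-neg f ρ = trans (scale-correct (- 1ℤ) f ρ) (ℤₚ.-1*i≡-i _)

  affine-correct : ∀ {n} (e : Expr n) ρ → ⟦ affine e ⟧ᶠ ρ ≡ ⟦ e ⟧ᵉ ρ
  affine-correct (var i) ρ = unit-correct i ρ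
  affine-correct (# k) ρ = const-correct (+ k) ρ
  affine-correct (e :+ f) ρ =
    trans (⊕-correct (affine e) (affine f) ρ)
          (cong₂ _+_ (affine-correct e ρ) (affine-correct f ρ))
  affine-correct (e :- f) ρ =
    trans (⊕-correct (affine e) (scale (- 1ℤ) (affine f)) ρ)
          (cong₂ _+_ (affine-correct e ρ) (trans (scale-neg (affine f) ρ) (cong -_ (affine-correct f ρ))))
  affine-correct (:- e) ρ =
    trans (scale-neg (affine e) ρ) (cong -_ (affine-correct e ρ))

  Holds : ∀ {n} → Env n → Form n → Set
  Holds ρ f = 0ℤ ≤ ⟦ f ⟧ᶠ ρ

  -- The positive multipliers `suc q` and `suc p` cancel the leading variable of a lower bound
  -- against that of an upper bound. Only this order of signs yields a form; `eliminate` runs over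
  -- all ordered pairs, so no opposite pair is lost.
  combine : ∀ {n} → Form (suc n) → Form (suc n) → List (Form n)
  combine (+ suc p ∷ cs , k) (-[1+ q ] ∷ ds , l) =
    (scale (+ suc q) (cs , k) ⊕ scale (+ suc p) (ds , l)) ∷ []
  combine _ _ = []

  free : ∀ {n} → Form (suc n) → List (Form n)
  free (+ 0 ∷ cs , k) = (cs , k) ∷ []
  free _ = []

  eliminate : ∀ {n} → List (Form (suc n)) → List (Form n)
  eliminate fs = concatMap free fs ++ concatMap (λ f → concatMap (combine f) fs) fs

  inconsistent : ∀ n → List (Form n) → Bool
  inconsistent zero [] = false
  inconsistent zero ((_ , + _) ∷ fs) = inconsistent zero fs
  inconsistent zero ((_ , -[1+ _ ]) ∷ fs) = true
  inconsistent (suc n) fs = inconsistent n (eliminate fs)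

  nonneg-* : ∀ p {i} → 0ℤ ≤ i → 0ℤ ≤ + suc p * i
  nonneg-* p {i} h = subst (_≤ + suc p * i) (ℤₚ.*-zeroʳ (+ suc p)) (ℤₚ.*-monoˡ-≤-nonNeg (+ suc p) h)

  combine-sound : ∀ {n} x ρ (f g : Form (suc n)) →
    Holds (x ∷ ρ) f → Holds (x ∷ ρ) g → All (Holds ρ) (combine f g)
  combine-sound x ρ (+ suc p ∷ cs , k) (-[1+ q ] ∷ ds , l) hf hg =
    subst (0ℤ ≤_) (sym eq) (ℤₚ.+-mono-≤ (nonneg-* q hf) (nonneg-* p hg)) ∷ []
    where
    lemma : ∀ p q x r s → q * r + p * s ≡ q * (p * x + r) + p * (- q * x + s)
    lemma = solve-∀
    eq : ⟦ scale (+ suc q) (cs , k) ⊕ scale (+ suc p) (ds , l) ⟧ᶠ ρ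
       ≡ + suc q * (+ suc p * x + ⟦ cs , k ⟧ᶠ ρ) + + suc p * (-[1+ q ] * x + ⟦ ds , l ⟧ᶠ ρ)
    eq = trans (⊕-correct (scale (+ suc q) (cs , k)) (scale (+ suc p) (ds , l)) ρ)
        (trans (cong₂ _+_ (scale-correct (+ suc q) (cs , k) ρ) (scale-correct (+ suc p) (ds , l) ρ))
               (lemma (+ suc p) (+ suc q) x (⟦ cs , k ⟧ᶠ ρ) (⟦ ds , l ⟧ᶠ ρ)))
  combine-sound x ρ (+ suc p ∷ cs , k) (+ q ∷ ds , l) hf hg = []
  combine-sound x ρ (+ zero ∷ cs , k) g hf hg = []
  combine-sound x ρ (-[1+ _ ] ∷ cs , k) g hf hg = []

  free-sound : ∀ {n} x ρ (f : Form (suc n)) → Holds (x ∷ ρ) f → All (Holds ρ) (free f)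
  free-sound x ρ (+ zero ∷ cs , k) h = subst (0ℤ ≤_) (lemma x _) h ∷ []
    where
    lemma : ∀ x y → 0ℤ * x + y ≡ y
    lemma = solve-∀
  free-sound x ρ (+ suc _ ∷ cs , k) h = []
  free-sound x ρ (-[1+ _ ] ∷ cs , k) h = []

  concatMap-All : ∀ {A B : Set} {P : A → Set} {Q : B → Set} (f : A → List B) →
    (∀ x → P x → All Q (f x)) → ∀ xs → All P xs → All Q (concatMap f xs)
  concatMap-All f h [] [] = []
  concatMap-All f h (x ∷ xs) (px ∷ pxs) = Allₚ.++⁺ (h x px) (concatMap-All f h xs pxs)

  inconsistent-sound : ∀ n (fs : List (Form n)) → T (inconsistent n fs) → ∀ ρ → ¬ All (Holds ρ) fs
  inconsistent-sound zero ((_ , + _) ∷ fs) t ρ (_ ∷ hs) = inconsistent-sound zero fs t ρ hs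
  inconsistent-sound zero (([] , -[1+ _ ]) ∷ fs) t [] (() ∷ hs)
  inconsistent-sound (suc n) fs t (x ∷ ρ) hs =
    inconsistent-sound n (eliminate fs) t ρ
      (Allₚ.++⁺ (concatMap-All free (free-sound x ρ) fs hs)
                (concatMap-All (λ f → concatMap (combine f) fs)
                  (λ f hf → concatMap-All (combine f) (λ g → combine-sound x ρ f g hf) fs hs) fs hs))

  forms : ∀ {n} → Atom n → List (Form n)
  forms (e :≤ f) = affine (f :- e) ∷ []
  forms (e :≡ f) = affine (f :- e) ∷ affine (e :- f) ∷ []

  forms-sound : ∀ {n} (a : Atom n) ρ → ⟦ a ⟧ᵃ ρ → All (Holds ρ) (forms a)
  forms-sound (e :≤ f) ρ h = subst (0ℤ ≤_) (sym (affine-correct (f :- e) ρ)) (ℤₚ.i≤j⇒0≤j-i h) ∷ []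
  forms-sound (e :≡ f) ρ h =
    subst (0ℤ ≤_) (sym (affine-correct (f :- e) ρ)) (ℤₚ.i≤j⇒0≤j-i (ℤₚ.≤-reflexive h)) ∷
    subst (0ℤ ≤_) (sym (affine-correct (e :- f) ρ)) (ℤₚ.i≤j⇒0≤j-i (ℤₚ.≤-reflexive (sym h))) ∷ []

  -- The negation of `e ≤ f` is entered as `f + 1 ≤ e`. This is the only use of integrality; the
  -- elimination reasons over the rationals and cannot see parity.
  valid : ∀ {n} → Sequent n → List (Form n) → Bool
  valid (a ⇒ s) fs = valid s (forms a ++ fs)
  valid (⊢ (e :≤ f)) fs = inconsistent _ (affine (e :- (f :+ # 1)) ∷ fs)
  valid (⊢ (e :≡ f)) fs = valid∧ (inconsistent _ (affine (e :- (f :+ # 1)) ∷ fs))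
                                 (inconsistent _ (affine (f :- (e :+ # 1)) ∷ fs))
    where
    valid∧ : Bool → Bool → Bool
    valid∧ true b = b
    valid∧ false _ = false
  valid ⊢⊥ fs = inconsistent _ fs

  refute-≤ : ∀ {n} (e f : Expr n) fs → T (inconsistent _ (affine (e :- (f :+ # 1)) ∷ fs)) →
    ∀ ρ → All (Holds ρ) fs → ⟦ e ⟧ᵉ ρ ≤ ⟦ f ⟧ᵉ ρ
  refute-≤ e f fs t ρ hs with ⟦ e ⟧ᵉ ρ ℤ.≤? ⟦ f ⟧ᵉ ρ
  ... | yes h = h
  ... | no h = ⊥-elim (inconsistent-sound _ _ t ρ (gap ∷ hs))
    where
    gap : Holds ρ (affine (e :- (f :+ # 1)))
    gap = subst (0ℤ ≤_) (sym (affine-correct (e :- (f :+ # 1)) ρ))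
      (ℤₚ.i≤j⇒0≤j-i (subst (_≤ ⟦ e ⟧ᵉ ρ) (ℤₚ.+-comm 1ℤ (⟦ f ⟧ᵉ ρ)) (ℤₚ.i<j⇒suc[i]≤j (ℤₚ.≰⇒> h))))

  valid-sound : ∀ {n} (s : Sequent n) fs → T (valid s fs) → ∀ ρ → All (Holds ρ) fs → ⟦ s ⟧ˢ ρ
  valid-sound (a ⇒ s) fs t ρ hs h = valid-sound s (forms a ++ fs) t ρ (Allₚ.++⁺ (forms-sound a ρ h) hs)
  valid-sound (⊢ (e :≤ f)) fs t ρ hs = refute-≤ e f fs t ρ hs
  valid-sound (⊢ (e :≡ f)) fs t ρ hs
    with inconsistent _ (affine (e :- (f :+ # 1)) ∷ fs) in eq
  ... | true = ℤₚ.≤-antisym (refute-≤ e f fs (subst T (sym eq) tt) ρ hs) (refute-≤ f e fs t ρ hs)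
  valid-sound ⊢⊥ fs t ρ hs = inconsistent-sound _ fs t ρ hs

  variables : ∀ n → Vec (Expr n) n
  variables n = Vec.map var (Vec.allFin n)

  -- lin n (λ x₁ … xₙ → h₁ ⇒ … ⇒ ⊢ g) x₁ … xₙ proves the linear consequence g of the hypotheses.
  lin : ∀ n (s : N-ary n (Expr n) (Sequent n)) →
    {T (valid (s $ⁿ variables n) [])} → ∀ⁿ n (curryⁿ ⟦ s $ⁿ variables n ⟧ˢ)
  lin n s {t} = go n (λ ρ → ⟦ s $ⁿ variables n ⟧ˢ ρ) (λ ρ → valid-sound (s $ⁿ variables n) [] t ρ [])
    where
    go : ∀ n (P : Env n → Set) → (∀ ρ → P ρ) → ∀ⁿ n (curryⁿ P)
    go zero P p = p []
    go (suc n) P p = λ x → go n (λ ρ → P (x ∷ ρ)) (λ ρ → p (x ∷ ρ))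

open LinearArithmetic using (_:+_; _:-_; :-_; #_; _:≤_; _:≡_; _⇒_; ⊢_; ⊢⊥; lin)

-- Cardinalities of duplicate-free lists

module _ {X : Set} where

  unique-⊆⇒length≤ : {xs ys : List X} → Unique xs → xs ⊆ ys → length xs ℕ.≤ length ys
  unique-⊆⇒length≤ {[]} [] sub = z≤n
  unique-⊆⇒length≤ {x ∷ xs} (x∉ ∷ uniq) sub with ∈-∃++ (sub (here refl))
  ... | as , bs , refl = subst (suc (length xs) ℕ.≤_) (sym eq) (s≤s (unique-⊆⇒length≤ uniq sub′))
    where
    eq : length (as ++ x ∷ bs) ≡ suc (length (as ++ bs))
    eq = trans (Listₚ.length-++ as)
           (trans (ℕₚ.+-suc (length as) (length bs)) (cong suc (sym (Listₚ.length-++ as))))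
    sub′ : xs ⊆ as ++ bs
    sub′ z∈ with ∈-++⁻ as (sub (there z∈))
    ... | inj₁ z∈as = ∈-++⁺ˡ z∈as
    ... | inj₂ (here refl) = ⊥-elim (All.lookup x∉ z∈ refl)
    ... | inj₂ (there z∈bs) = ∈-++⁺ʳ as z∈bs

  ∉⇒Unique-∷ : {x : X} {xs : List X} → x ∉ xs → Unique xs → Unique (x ∷ xs)
  ∉⇒Unique-∷ x∉ uniq = Allₚ.¬Any⇒All¬ _ x∉ ∷ uniq

  unique-⊂⇒length< : {xs ys : List X} {z : X} → Unique xs → xs ⊆ ys → z ∈ ys → z ∉ xs →
    length xs ℕ.< length ys
  unique-⊂⇒length< {xs} {ys} {z} uniq sub z∈ z∉ = unique-⊆⇒length≤ (∉⇒Unique-∷ z∉ uniq) sub′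
    where
    sub′ : z ∷ xs ⊆ ys
    sub′ (here refl) = z∈
    sub′ (there w∈) = sub w∈

  unique-≈⇒length≡ : {xs ys : List X} → Unique xs → Unique ys → xs ⊆ ys → ys ⊆ xs →
    length xs ≡ length ys
  unique-≈⇒length≡ uxs uys sub sup = ℕₚ.≤-antisym (unique-⊆⇒length≤ uxs sub) (unique-⊆⇒length≤ uys sup)

injection⇒length≤ : {X Y : Set} (f : X → Y) → (∀ {x x′} → f x ≡ f x′ → x ≡ x′) →
  {xs : List X} {ys : List Y} → Unique xs → (∀ {x} → x ∈ xs → f x ∈ ys) → length xs ℕ.≤ length ys
injection⇒length≤ f inj {xs} {ys} uniq into =
  subst (ℕ._≤ length ys) (Listₚ.length-map f xs) (unique-⊆⇒length≤ (Uniqueₚ.map⁺ inj uniq) sub)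
  where
  sub : map f xs ⊆ ys
  sub z∈ with ∈-map⁻ f z∈
  ... | x , x∈ , refl = into x∈

length-cartesianProduct : {X Y : Set} (xs : List X) (ys : List Y) →
  length (cartesianProduct xs ys) ≡ length xs ℕ.* length ys
length-cartesianProduct [] ys = refl
length-cartesianProduct (x ∷ xs) ys = trans (Listₚ.length-++ (map (x ,_) ys))
  (cong₂ ℕ._+_ (Listₚ.length-map (x ,_) ys) (length-cartesianProduct xs ys))

-- Closed neighbourhoods

Cl : List Pt → Pt → Set
Cl A p = p ∈ A ⊎ ∃[ q ] (q ∈ A × p ∈ neighbours q)

∈-neighbourhood⁻ : ∀ A {p} → p ∈ concatMap neighbours A → ∃[ q ] (q ∈ A × p ∈ neighbours q)
∈-neighbourhood⁻ A p∈ = find (∈-concatMap⁻ neighbours {xs = A} p∈)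

∈-neighbourhood⁺ : ∀ {A p q} → q ∈ A → p ∈ neighbours q → p ∈ concatMap neighbours A
∈-neighbourhood⁺ q∈ p∈ = ∈-concatMap⁺ neighbours (lose q∈ p∈)

abstract

  cl : List Pt → List Pt
  cl A = deduplicate _≟ₚ_ (A ++ concatMap neighbours A)

  ∈-cl⁺ : ∀ {A p} → Cl A p → p ∈ cl A
  ∈-cl⁺ (inj₁ p∈) = ∈-deduplicate⁺ _≟ₚ_ (∈-++⁺ˡ p∈)
  ∈-cl⁺ {A} (inj₂ (q , q∈ , p∈)) = ∈-deduplicate⁺ _≟ₚ_ (∈-++⁺ʳ A (∈-neighbourhood⁺ q∈ p∈))

  ∈-cl⁻ : ∀ {A p} → p ∈ cl A → Cl A p
  ∈-cl⁻ {A} p∈ with ∈-++⁻ A (∈-deduplicate⁻ _≟ₚ_ _ p∈)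
  ... | inj₁ p∈A = inj₁ p∈A
  ... | inj₂ p∈N = inj₂ (∈-neighbourhood⁻ A p∈N)

  cl-unique : ∀ A → Unique (cl A)
  cl-unique A = deduplicate-! (A ++ concatMap neighbours A)

Cl? : ∀ A p → Dec (Cl A p)
Cl? A p = map′ ∈-cl⁻ ∈-cl⁺ (p ∈? cl A)

Cl-mono : ∀ {A B p} → A ⊆ B → Cl A p → Cl B p
Cl-mono sub (inj₁ p∈) = inj₁ (sub p∈)
Cl-mono sub (inj₂ (q , q∈ , p∈)) = inj₂ (q , sub q∈ , p∈)

∈-boundary⁻ : ∀ A {p} → p ∈ boundary A → p ∉ elems A × ∃[ q ] (q ∈ elems A × p ∈ neighbours q)
∈-boundary⁻ A p∈ with ∈-filter⁻ (λ u → ¬? (u ∈? elems A)) {xs = concatMap neighbours (elems A)}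
                        (∈-deduplicate⁻ _≟ₚ_ _ p∈)
... | p∈N , p∉ = p∉ , ∈-neighbourhood⁻ (elems A) p∈N

∈-boundary⁺ : ∀ A {p q} → p ∉ elems A → q ∈ elems A → p ∈ neighbours q → p ∈ boundary A
∈-boundary⁺ A p∉ q∈ p∈ =
  ∈-deduplicate⁺ _≟ₚ_ (∈-filter⁺ (λ u → ¬? (u ∈? elems A)) (∈-neighbourhood⁺ q∈ p∈) p∉)

boundary-unique : ∀ A → Unique (boundary A)
boundary-unique A = deduplicate-! _

cl-length : ∀ A → length (cl (elems A)) ≡ size A ℕ.+ bsize A
cl-length A = trans (unique-≈⇒length≡ (cl-unique (elems A)) uniq sub sup) (Listₚ.length-++ (elems A))
  where
  uniq : Unique (elems A ++ boundary A)
  uniq = Uniqueₚ.++⁺ (proj₂ A) (boundary-unique A) λ (p∈ , p∈∂) → proj₁ (∈-boundary⁻ A p∈∂) p∈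
  sub : cl (elems A) ⊆ elems A ++ boundary A
  sub {p} p∈ with ∈-cl⁻ p∈
  ... | inj₁ p∈A = ∈-++⁺ˡ p∈A
  ... | inj₂ (q , q∈ , p∈N) with p ∈? elems A
  ...   | yes p∈A = ∈-++⁺ˡ p∈A
  ...   | no p∉A = ∈-++⁺ʳ (elems A) (∈-boundary⁺ A p∉A q∈ p∈N)
  sup : elems A ++ boundary A ⊆ cl (elems A)
  sup p∈ with ∈-++⁻ (elems A) p∈
  ... | inj₁ p∈A = ∈-cl⁺ (inj₁ p∈A)
  ... | inj₂ p∈∂ = ∈-cl⁺ (inj₂ (proj₂ (∈-boundary⁻ A p∈∂)))

insert : ∀ A {p} → p ∉ elems A → FinSet
insert A {p} p∉ = p ∷ elems A , ∉⇒Unique-∷ p∉ (proj₂ A)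

Near : Pt → Pt → Set
Near p r = r ≡ p ⊎ r ∈ neighbours p

Cl-insert⁻ : ∀ {A p r} → Cl (p ∷ A) r → Near p r ⊎ Cl A r
Cl-insert⁻ (inj₁ (here eq)) = inj₁ (inj₁ eq)
Cl-insert⁻ (inj₁ (there r∈)) = inj₂ (inj₁ r∈)
Cl-insert⁻ (inj₂ (_ , here refl , r∈)) = inj₁ (inj₂ r∈)
Cl-insert⁻ (inj₂ (q , there q∈ , r∈)) = inj₂ (inj₂ (q , q∈ , r∈))

-- The closed neighbourhood grows by at most the points of `qs` while the set grows by one, so the
-- boundary grows by at most one less than the length of `qs`; the `suc` on the left avoids the
-- subtraction.
bsize-insert-≤ : ∀ A {p} (p∉ : p ∉ elems A) qs →
  (∀ r → Near p r → Cl (elems A) r ⊎ r ∈ qs) →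
  suc (bsize (insert A p∉)) ℕ.≤ length qs ℕ.+ bsize A
bsize-insert-≤ A {p} p∉ qs near = ℕₚ.+-cancelˡ-≤ (size A) _ _ (begin
  size A ℕ.+ suc (bsize A′)       ≡⟨ ℕₚ.+-suc (size A) _ ⟩
  suc (size A) ℕ.+ bsize A′       ≡⟨ cl-length A′ ⟨
  length (cl (elems A′))          ≤⟨ unique-⊆⇒length≤ (cl-unique (elems A′)) sub ⟩
  length (qs ++ cl (elems A))     ≡⟨ Listₚ.length-++ qs ⟩
  length qs ℕ.+ length (cl (elems A)) ≡⟨ cong (length qs ℕ.+_) (cl-length A) ⟩
  length qs ℕ.+ (size A ℕ.+ bsize A)  ≡⟨ swap (length qs) (size A) (bsize A) ⟩
  size A ℕ.+ (length qs ℕ.+ bsize A)  ∎)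
  where
  open ℕₚ.≤-Reasoning
  A′ = insert A p∉
  swap : ∀ a b c → a ℕ.+ (b ℕ.+ c) ≡ b ℕ.+ (a ℕ.+ c)
  swap = ℕ-Solver.solve-∀
  sub : cl (elems A′) ⊆ qs ++ cl (elems A)
  sub {r} r∈ with Cl-insert⁻ (∈-cl⁻ r∈)
  ... | inj₂ c = ∈-++⁺ʳ qs (∈-cl⁺ c)
  ... | inj₁ n with near r n
  ...   | inj₁ c = ∈-++⁺ʳ qs (∈-cl⁺ c)
  ...   | inj₂ r∈qs = ∈-++⁺ˡ r∈qs

-- Two new points in the closed neighbourhood outweigh one new point in the set. `A′` is any
-- superset with one more point, since this is what a chain of minimal sets provides.
bsize-superset-> : ∀ A A′ {p q q′} → A ⊆ₛ A′ → size A′ ≡ suc (size A) → p ∈ₛ A′ →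
  Near p q → Near p q′ → q ≢ q′ → ¬ Cl (elems A) q → ¬ Cl (elems A) q′ → bsize A ℕ.< bsize A′
bsize-superset-> A A′ {p} {q} {q′} A⊆A′ sz p∈ nq nq′ q≢q′ ¬q ¬q′ =
  ℕₚ.+-cancelˡ-≤ (suc (size A)) _ _ (begin
    suc (size A) ℕ.+ suc (bsize A)    ≡⟨ cong suc (ℕₚ.+-suc (size A) (bsize A)) ⟩
    2 ℕ.+ (size A ℕ.+ bsize A)        ≡⟨ cong (2 ℕ.+_) (cl-length A) ⟨
    length (q ∷ q′ ∷ cl (elems A))    ≤⟨ unique-⊆⇒length≤ uniq sub ⟩
    length (cl (elems A′))            ≡⟨ cl-length A′ ⟩
    size A′ ℕ.+ bsize A′              ≡⟨ cong (ℕ._+ bsize A′) sz ⟩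
    suc (size A) ℕ.+ bsize A′         ∎)
  where
  open ℕₚ.≤-Reasoning
  uniq : Unique (q ∷ q′ ∷ cl (elems A))
  uniq = ∉⇒Unique-∷ (λ { (here eq) → q≢q′ eq ; (there q∈) → ¬q (∈-cl⁻ q∈) })
           (∉⇒Unique-∷ (λ q∈ → ¬q′ (∈-cl⁻ q∈)) (cl-unique (elems A)))
  near : ∀ {r} → Near p r → Cl (elems A′) r
  near (inj₁ refl) = inj₁ p∈
  near (inj₂ r∈) = inj₂ (p , p∈ , r∈)
  sub : q ∷ q′ ∷ cl (elems A) ⊆ cl (elems A′)
  sub (here refl) = ∈-cl⁺ (near nq)
  sub (there (here refl)) = ∈-cl⁺ (near nq′)
  sub (there (there r∈)) = ∈-cl⁺ (Cl-mono (λ {x} → A⊆A′ x) (∈-cl⁻ r∈))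

-- Monotonicity of the least boundary

maximum : (f : Pt → ℤ) {A : List Pt} {p : Pt} → p ∈ A → ∃[ m ] (m ∈ A × ∀ {q} → q ∈ A → f q ≤ f m)
maximum f {A} {p} p∈ = argmax f p A , m∈ , All.lookup (f[xs]≤f[argmax] {f = f} p A)
  where
  m∈ : argmax f p A ∈ A
  m∈ with argmax-sel f p A
  ... | inj₁ eq = subst (_∈ A) (sym eq) p∈
  ... | inj₂ h = h

nonempty : ∀ {A : List Pt} {n} → length A ≡ suc n → ∃[ p ] p ∈ A
nonempty {p ∷ _} _ = p , here refl

-- The point above a topmost point p of C is adjacent to no other point of C, so removing p
-- loses it from the closed neighbourhood.
remove-topmost : ∀ C {n} → size C ≡ suc n → ∃[ C′ ] (size C′ ≡ n × bsize C′ ℕ.≤ bsize C)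
remove-topmost C {n} sz with maximum proj₂ (proj₂ (nonempty {elems C} sz))
... | p@(x , y) , p∈ , top = C′ , sz′ , ℕₚ.+-cancelˡ-≤ (suc n) _ _ (begin
    suc n ℕ.+ bsize C′             ≡⟨ cong (λ k → suc k ℕ.+ bsize C′) sz′ ⟨
    suc (size C′ ℕ.+ bsize C′)     ≡⟨ cong suc (cl-length C′) ⟨
    suc (length (cl (elems C′)))   ≤⟨ unique-⊂⇒length< (cl-unique (elems C′)) sub above∈ above∉ ⟩
    length (cl (elems C))          ≡⟨ cl-length C ⟩
    size C ℕ.+ bsize C             ≡⟨ cong (ℕ._+ bsize C) sz ⟩
    suc n ℕ.+ bsize C              ∎)
  where
  open ℕₚ.≤-Reasoning
  ≢p? = λ q → ¬? (q ≟ₚ p)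
  C′ : FinSet
  C′ = filter ≢p? (elems C) , Uniqueₚ.filter⁺ ≢p? (proj₂ C)
  p∉ : p ∉ elems C′
  p∉ h = proj₂ (∈-filter⁻ ≢p? {xs = elems C} h) refl
  sz′ : size C′ ≡ n
  sz′ = ℕₚ.suc-injective (trans (unique-≈⇒length≡ (∉⇒Unique-∷ p∉ (proj₂ C′)) (proj₂ C) ⊆₁ ⊆₂) sz)
    where
    ⊆₁ : p ∷ elems C′ ⊆ elems C
    ⊆₁ (here refl) = p∈
    ⊆₁ (there q∈) = proj₁ (∈-filter⁻ ≢p? q∈)
    ⊆₂ : elems C ⊆ p ∷ elems C′
    ⊆₂ {q} q∈ with q ≟ₚ p
    ... | yes refl = here refl
    ... | no q≢p = there (∈-filter⁺ ≢p? q∈ q≢p)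
  sub : cl (elems C′) ⊆ cl (elems C)
  sub r∈ = ∈-cl⁺ (Cl-mono (λ q∈ → proj₁ (∈-filter⁻ ≢p? {xs = elems C} q∈)) (∈-cl⁻ r∈))
  above : Pt
  above = x , y + 1ℤ
  above∈ : above ∈ cl (elems C)
  above∈ = ∈-cl⁺ (inj₂ (p , p∈ , there (there (here refl))))
  top-C′ : ∀ {q} → q ∈ elems C′ → proj₂ q ≤ y × q ≢ p
  top-C′ q∈ with ∈-filter⁻ ≢p? {xs = elems C} q∈
  ... | q∈C , q≢p = top q∈C , q≢p
  too-high : ∀ {y′} → y′ ≤ y → y + 1ℤ ≡ y′ → ⊥
  too-high {y′} = lin 2 (λ y′ y → y′ :≤ y ⇒ y :+ # 1 :≡ y′ ⇒ ⊢⊥) y′ y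
  above∉ : above ∉ cl (elems C′)
  above∉ h with ∈-cl⁻ {elems C′} h
  ... | inj₁ q∈ = too-high (proj₁ (top-C′ q∈)) refl
  ... | inj₂ (q , q∈ , here eq) = too-high (proj₁ (top-C′ q∈)) (cong proj₂ eq)
  ... | inj₂ (q , q∈ , there (here eq)) = too-high (proj₁ (top-C′ q∈)) (cong proj₂ eq)
  ... | inj₂ (q@(x′ , y′) , q∈ , there (there (here eq))) =
    proj₂ (top-C′ q∈) (cong₂ _,_ (sym (cong proj₁ eq)) (y≡ (cong proj₂ eq)))
    where
    y≡ : y + 1ℤ ≡ y′ + 1ℤ → y′ ≡ y
    y≡ = lin 2 (λ y y′ → y :+ # 1 :≡ y′ :+ # 1 ⇒ ⊢ y′ :≡ y) y y′
  ... | inj₂ (q@(x′ , y′) , q∈ , there (there (there (here eq)))) =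
    lin 2 (λ y y′ → y′ :≤ y ⇒ y :+ # 1 :≡ y′ :- # 1 ⇒ ⊢⊥) y y′ (proj₁ (top-C′ q∈)) (cong proj₂ eq)

shrink : ∀ {m} C → m ℕ.≤ size C → ∃[ C′ ] (size C′ ≡ m × bsize C′ ℕ.≤ bsize C)
shrink {m} C m≤ = go (size C ℕ.∸ m) C (sym (ℕₚ.m∸n+n≡m m≤))
  where
  go : ∀ k C → size C ≡ k ℕ.+ m → ∃[ C′ ] (size C′ ≡ m × bsize C′ ℕ.≤ bsize C)
  go zero C sz = C , sz , ℕₚ.≤-refl
  go (suc k) C sz with remove-topmost C sz
  ... | C₁ , sz₁ , le₁ with go k C₁ sz₁
  ...   | C₂ , sz₂ , le₂ = C₂ , sz₂ , ℕₚ.≤-trans le₂ le₁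

-- Minimality compares sets of equal size only; `shrink` first cuts a larger set down without
-- enlarging its boundary.
Minimal-bsize≤ : ∀ {A} → Minimal A → ∀ C → size A ℕ.≤ size C → bsize A ℕ.≤ bsize C
Minimal-bsize≤ (_ , minimal) C le with shrink C le
... | C′ , sz , le′ = ℕₚ.≤-trans (minimal C′ sz) le′

-- A bound on the size in terms of the boundary

module _ (C : FinSet) {step : Pt → Pt} {height level : Pt → ℤ}
  (step-height : ∀ p → height (step p) ≡ height p + 1ℤ) (step-level : ∀ p → level (step p) ≡ level p)
  (step-neighbour : ∀ p → step p ∈ neighbours p) where

  -- Walking from a point of `C` in a fixed direction must leave `C`, and the first point outside is
  -- a boundary point on the same line. The height left up to the highest point of `C` serves as
  -- fuel.
  leave-along-line : ∀ {p} → p ∈ₛ C → ∃[ q ] (q ∈ boundary C × level q ≡ level p)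
  leave-along-line {p} p∈ with maximum height p∈
  ... | m , m∈ , top = go ∣ height m - height p ∣ p∈ (gap (top p∈))
    where
    gap : ∀ {i j} → i ≤ j → j ≤ i + + ∣ j - i ∣
    gap {i} {j} i≤j rewrite ℤₚ.0≤i⇒+∣i∣≡i (ℤₚ.i≤j⇒0≤j-i i≤j) = lin 2 (λ i j → ⊢ j :≤ i :+ (j :- i)) i j
    go : ∀ n {p} → p ∈ₛ C → height m ≤ height p + + n → ∃[ q ] (q ∈ boundary C × level q ≡ level p)
    go n {p} p∈ le with step p ∈? elems C
    ... | no out = step p , ∈-boundary⁺ C out p∈ (step-neighbour p) , step-level p
    go zero {p} p∈ le | yes s∈ = ⊥-elim
      (lin 3 (λ m p s → m :≤ p :+ # 0 ⇒ s :≤ m ⇒ s :≡ p :+ # 1 ⇒ ⊢⊥)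
        (height m) (height p) (height (step p)) le (top s∈) (step-height p))
    go (suc n) {p} p∈ le | yes s∈ with go n s∈
      (lin 4 (λ m p s n → m :≤ p :+ (# 1 :+ n) ⇒ s :≡ p :+ # 1 ⇒ ⊢ m :≤ s :+ n)
        (height m) (height p) (height (step p)) (+ n) le (step-height p))
    ...   | q , q∈ , eq = q , q∈ , trans eq (step-level p)

-- A point is recovered from a boundary point on its vertical line and one on its horizontal line.
-- The bound is crude, but it limits the size while the boundary stays fixed, which is what the
-- recursion in `box-bound` requires.
size≤bsize² : ∀ C → size C ℕ.≤ bsize C ℕ.* bsize C
size≤bsize² C = begin
  size C                                               ≤⟨ unique-⊆⇒length≤ (proj₂ C) sub ⟩
  length (map corner (cartesianProduct ∂C ∂C))         ≡⟨ Listₚ.length-map corner (cartesianProduct ∂C ∂C) ⟩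
  length (cartesianProduct ∂C ∂C)                      ≡⟨ length-cartesianProduct ∂C ∂C ⟩
  bsize C ℕ.* bsize C                                  ∎
  where
  open ℕₚ.≤-Reasoning
  ∂C = boundary C
  corner : Pt × Pt → Pt
  corner ((x , _) , (_ , y)) = x , y
  sub : elems C ⊆ map corner (cartesianProduct ∂C ∂C)
  sub {x , y} p∈
    with leave-along-line C {λ (x , y) → x , y + 1ℤ} {proj₂} {proj₁}
           (λ _ → refl) (λ _ → refl) (λ _ → there (there (here refl))) p∈
       | leave-along-line C {λ (x , y) → x + 1ℤ , y} {proj₁} {proj₂}
           (λ _ → refl) (λ _ → refl) (λ _ → here refl) p∈
  ... | q , q∈ , refl | q′ , q′∈ , refl = ∈-map⁺ corner (∈-cartesianProduct⁺ q∈ q′∈)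

-- Diagonal coordinates

≰⇒+1≤ : ∀ {i j} → ¬ i ≤ j → j + 1ℤ ≤ i
≰⇒+1≤ {i} {j} h = subst (_≤ i) (ℤₚ.+-comm 1ℤ j) (ℤₚ.i<j⇒suc[i]≤j (ℤₚ.≰⇒> h))

≤⇒≤+1 : ∀ {i j} → i ≤ j → i ≤ j + 1ℤ
≤⇒≤+1 {i} {j} = lin 2 (λ i j → i :≤ j ⇒ ⊢ i :≤ j :+ # 1) i j

≤⇒-1≤ : ∀ {i j} → i ≤ j → i - 1ℤ ≤ j
≤⇒-1≤ {i} {j} = lin 2 (λ i j → i :≤ j ⇒ ⊢ i :- # 1 :≤ j) i j

≤⇒≤⊎≡ : ∀ {i j} → i ≤ j + 1ℤ → i ≤ j ⊎ i ≡ j + 1ℤ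
≤⇒≤⊎≡ {i} {j} le with i ℤ.≤? j
... | yes h = inj₁ h
... | no h = inj₂ (ℤₚ.≤-antisym le (≰⇒+1≤ h))

sg : Bool → ℤ
sg true = 1ℤ
sg false = - 1ℤ

-- Coordinates in which the neighbours of a point differ from it by ±1 in both coordinates.  The
-- standard choice is U = y - x and V = y + x; the symmetries of the lattice give the others.
record Frame : Set where
  field
    U V : Pt → ℤ
    mv : Bool → Bool → Pt → Pt
    U-mv : ∀ e f p → U (mv e f p) ≡ U p + sg e
    V-mv : ∀ e f p → V (mv e f p) ≡ V p + sg f
    mv-neighbour : ∀ e f p → mv e f p ∈ neighbours p
    neighbour-mv : ∀ {p q} → q ∈ neighbours p → ∃[ e ] ∃[ f ] q ≡ mv e f p
    UV-injective : ∀ {p q} → U p ≡ U q → V p ≡ V q → p ≡ q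
    parity : ∀ p q → ∃[ k ] (U p - U q) + (V p - V q) ≡ k + k

standard : Frame
standard = record
  { U = λ (x , y) → y - x
  ; V = λ (x , y) → y + x
  ; mv = mv
  ; U-mv = U-mv
  ; V-mv = V-mv
  ; mv-neighbour = mv-neighbour
  ; neighbour-mv = neighbour-mv
  ; UV-injective = injective
  -- In the standard coordinates u + v equals 2 y.
  ; parity = λ (x , y) (x′ , y′) → y - y′ , even x y x′ y′
  }
  where
  mv : Bool → Bool → Pt → Pt
  mv true true (x , y) = x , y + 1ℤ
  mv true false (x , y) = x - 1ℤ , y
  mv false true (x , y) = x + 1ℤ , y
  mv false false (x , y) = x , y - 1ℤ
  U-mv : ∀ e f p → proj₂ (mv e f p) - proj₁ (mv e f p) ≡ (proj₂ p - proj₁ p) + sg e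
  U-mv true true (x , y) = lin 2 (λ x y → ⊢ y :+ # 1 :- x :≡ y :- x :+ # 1) x y
  U-mv true false (x , y) = lin 2 (λ x y → ⊢ y :- (x :- # 1) :≡ y :- x :+ # 1) x y
  U-mv false true (x , y) = lin 2 (λ x y → ⊢ y :- (x :+ # 1) :≡ y :- x :- # 1) x y
  U-mv false false (x , y) = lin 2 (λ x y → ⊢ y :- # 1 :- x :≡ y :- x :- # 1) x y
  V-mv : ∀ e f p → proj₂ (mv e f p) + proj₁ (mv e f p) ≡ (proj₂ p + proj₁ p) + sg f
  V-mv true true (x , y) = lin 2 (λ x y → ⊢ y :+ # 1 :+ x :≡ y :+ x :+ # 1) x y
  V-mv true false (x , y) = lin 2 (λ x y → ⊢ y :+ (x :- # 1) :≡ y :+ x :- # 1) x y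
  V-mv false true (x , y) = lin 2 (λ x y → ⊢ y :+ (x :+ # 1) :≡ y :+ x :+ # 1) x y
  V-mv false false (x , y) = lin 2 (λ x y → ⊢ y :- # 1 :+ x :≡ y :+ x :- # 1) x y
  mv-neighbour : ∀ e f p → mv e f p ∈ neighbours p
  mv-neighbour false true p = here refl
  mv-neighbour true false p = there (here refl)
  mv-neighbour true true p = there (there (here refl))
  mv-neighbour false false p = there (there (there (here refl)))
  neighbour-mv : ∀ {p q} → q ∈ neighbours p → ∃[ e ] ∃[ f ] q ≡ mv e f p
  neighbour-mv (here eq) = false , true , eq
  neighbour-mv (there (here eq)) = true , false , eq
  neighbour-mv (there (there (here eq))) = true , true , eq
  neighbour-mv (there (there (there (here eq)))) = false , false , eq
  injective : ∀ {p q} → proj₂ p - proj₁ p ≡ proj₂ q - proj₁ q → proj₂ p + proj₁ p ≡ proj₂ q + proj₁ q → p ≡ q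
  injective {x , y} {x′ , y′} eu ev = cong₂ _,_
    (lin 4 (λ x y x′ y′ → y :- x :≡ y′ :- x′ ⇒ y :+ x :≡ y′ :+ x′ ⇒ ⊢ x :≡ x′) x y x′ y′ eu ev)
    (lin 4 (λ x y x′ y′ → y :- x :≡ y′ :- x′ ⇒ y :+ x :≡ y′ :+ x′ ⇒ ⊢ y :≡ y′) x y x′ y′ eu ev)
  even : ∀ x y x′ y′ → ((y - x) - (y′ - x′)) + ((y + x) - (y′ + x′)) ≡ (y - y′) + (y - y′)
  even = solve-∀

flip : Frame → Frame
flip F = record
  { U = λ p → - U p
  ; V = V
  ; mv = λ e f → mv (not e) f
  ; U-mv = λ e f p → trans (cong -_ (U-mv (not e) f p)) (negate e (U p))
  ; V-mv = λ e f p → V-mv (not e) f p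
  ; mv-neighbour = λ e f p → mv-neighbour (not e) f p
  ; neighbour-mv = neighbour
  ; UV-injective = λ eu ev → UV-injective (ℤₚ.neg-injective eu) ev
  ; parity = λ p q → proj₁ (parity p q) - (U p - U q) , even (U p) (U q) (V p - V q) (proj₁ (parity p q)) (proj₂
      (parity p q))
  }
  where
  open Frame F
  negate : ∀ e u → - (u + sg (not e)) ≡ - u + sg e
  negate true u = lin 1 (λ u → ⊢ :- (u :- # 1) :≡ :- u :+ # 1) u
  negate false u = lin 1 (λ u → ⊢ :- (u :+ # 1) :≡ :- u :- # 1) u
  neighbour : ∀ {p q} → q ∈ neighbours p → ∃[ e ] ∃[ f ] q ≡ mv (not e) f p
  neighbour q∈ with neighbour-mv q∈
  ... | true , f , eq = false , f , eq
  ... | false , f , eq = true , f , eq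
  even : ∀ u u′ w k → (u - u′) + w ≡ k + k →
    (- u - - u′) + w ≡ (k - (u - u′)) + (k - (u - u′))
  even = lin 4 λ u u′ w k → u :- u′ :+ w :≡ k :+ k ⇒
    ⊢ :- u :- :- u′ :+ w :≡ (k :- (u :- u′)) :+ (k :- (u :- u′))

swap : Frame → Frame
swap F = record
  { U = V
  ; V = U
  ; mv = λ e f → mv f e
  ; U-mv = λ e f → V-mv f e
  ; V-mv = λ e f → U-mv f e
  ; mv-neighbour = λ e f → mv-neighbour f e
  ; neighbour-mv = λ q∈ → let e , f , eq = neighbour-mv q∈ in f , e , eq
  ; UV-injective = λ ev eu → UV-injective eu ev
  ; parity = λ p q → proj₁ (parity p q) , trans (ℤₚ.+-comm (V p - V q) (U p - U q)) (proj₂ (parity p q))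
  }
  where open Frame F

neighbours-sym : ∀ {p q} → q ∈ neighbours p → p ∈ neighbours q
neighbours-sym {p} q∈ with Frame.neighbour-mv standard q∈
... | e , f , refl = subst (_∈ neighbours (mv e f p)) (back e f) (mv-neighbour (not e) (not f) (mv e f p))
  where
  open Frame standard
  cancel : ∀ e {u v w} → v ≡ u + sg e → w ≡ v + sg (not e) → w ≡ u
  cancel true {u} {v} {w} = lin 3 (λ u v w → v :≡ u :+ # 1 ⇒ w :≡ v :- # 1 ⇒ ⊢ w :≡ u) u v w
  cancel false {u} {v} {w} = lin 3 (λ u v w → v :≡ u :- # 1 ⇒ w :≡ v :+ # 1 ⇒ ⊢ w :≡ u) u v w
  back : ∀ e f → mv (not e) (not f) (mv e f p) ≡ p
  back e f = UV-injective {mv (not e) (not f) (mv e f p)} {p}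
    (cancel e (U-mv e f p) (U-mv (not e) (not f) (mv e f p)))
    (cancel f (V-mv e f p) (V-mv (not e) (not f) (mv e f p)))

-- Boxes in a frame

module _ (F : Frame) where
  open Frame F

  InF : ℤ → ℤ → ℤ → ℤ → Pt → Set
  InF a b c d p = (a ≤ U p × U p ≤ b) × (c ≤ V p × V p ≤ d)

  Ext : ℤ → ℤ → ℤ → ℤ → Pt → Set
  Ext a b c d = InF (a - 1ℤ) (b + 1ℤ) (c - 1ℤ) (d + 1ℤ)

  -- The parameters are not wasteful: the closed neighbourhood of the box is the whole enlarged box.
  Tight : ℤ → ℤ → ℤ → ℤ → Set
  Tight a b c d = ∀ p → Ext a b c d p → InF a b c d p ⊎ ∃[ q ] (q ∈ neighbours p × InF a b c d q)

  InF? : ∀ a b c d → Decidable (InF a b c d)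
  InF? a b c d p = ((a ℤ.≤? U p) ×-dec (U p ℤ.≤? b)) ×-dec ((c ℤ.≤? V p) ×-dec (V p ℤ.≤? d))

  -- Parity enters the linear arguments only here: a position off the lattice is refuted by
  -- exhibiting its odd difference from a lattice point.
  odd-absurd : ∀ p q m → (U p - U q) + (V p - V q) ≡ m + m + 1ℤ → ⊥
  odd-absurd p q m eq with parity p q
  ... | k , ev with k ℤ.≤? m
  ...   | yes k≤m = lin 3 (λ k m s → k :≤ m ⇒ s :≡ k :+ k ⇒ s :≡ m :+ m :+ # 1 ⇒ ⊢⊥)
                      k m ((U p - U q) + (V p - V q)) k≤m ev eq
  ...   | no k≰m = lin 3 (λ k m s → m :+ # 1 :≤ k ⇒ s :≡ k :+ k ⇒ s :≡ m :+ m :+ # 1 ⇒ ⊢⊥)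
                      k m ((U p - U q) + (V p - V q)) (≰⇒+1≤ k≰m) ev eq

  -- With two columns and two rows, each coordinate can be moved inwards independently, and the two
  -- moves together make a single step to a neighbour.
  nondegenerate⇒Tight : ∀ {a b c d} → a + 1ℤ ≤ b → c + 1ℤ ≤ d → Tight a b c d
  nondegenerate⇒Tight {a} {b} {c} {d} a<b c<d p ((a≤ , ≤b) , (c≤ , ≤d)) =
    let e , a≤′ , ≤b′ = toward a b (U p) a<b a≤ ≤b
        f , c≤′ , ≤d′ = toward c d (V p) c<d c≤ ≤d
    in inj₂ (mv e f p , mv-neighbour e f p ,
         (subst (a ≤_) (sym (U-mv e f p)) a≤′ , subst (_≤ b) (sym (U-mv e f p)) ≤b′) ,
         (subst (c ≤_) (sym (V-mv e f p)) c≤′ , subst (_≤ d) (sym (V-mv e f p)) ≤d′))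
    where
    toward : ∀ a b u → a + 1ℤ ≤ b → a - 1ℤ ≤ u → u ≤ b + 1ℤ → ∃[ e ] (a ≤ u + sg e × u + sg e ≤ b)
    toward a b u a<b lo hi with a + 1ℤ ℤ.≤? u
    ... | yes h = false , lin 2 (λ a u → a :+ # 1 :≤ u ⇒ ⊢ a :≤ u :- # 1) a u h
                        , lin 2 (λ b u → u :≤ b :+ # 1 ⇒ ⊢ u :- # 1 :≤ b) b u hi
    ... | no h = true , lin 2 (λ a u → a :- # 1 :≤ u ⇒ ⊢ a :≤ u :+ # 1) a u lo
                      , lin 3 (λ a b u → a :+ # 1 :≤ b ⇒ u :+ # 1 :≤ a :+ # 1 ⇒ ⊢ u :+ # 1 :≤ b) a b u a<b
                          (≰⇒+1≤ h)

-- Growing boxes inside a set that no single point extends cheaply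

-- Here q is the only point that Cl A may gain from the insertion of p.
Stuck : List Pt → Set
Stuck A = ∀ p → p ∉ A → Cl A p → ∀ q → ¬ (∀ r → r ∈ neighbours p → Cl A r ⊎ r ≡ q)

module Growth (A : List Pt) (stuck : Stuck A) where

  record Good (F : Frame) (a b c d : ℤ) : Set where
    constructor good
    field
      a≤b : a ≤ b
      c≤d : c ≤ d
      inside : ∀ {p} → InF F a b c d p → p ∈ A
      tight : Tight F a b c d

  -- This is the purpose of tightness: the whole layer around the box counts as present in the
  -- closed neighbourhood of `A`.
  Ext⇒Cl : ∀ {F a b c d} → Good F a b c d → ∀ {p} → Ext F a b c d p → Cl A p
  Ext⇒Cl g {p} ext with Good.tight g p ext
  ... | inj₁ p∈ = inj₁ (Good.inside g p∈)
  ... | inj₂ (q , q∈ , q∈box) = inj₂ (q , Good.inside g q∈box , neighbours-sym q∈)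

  transfer : ∀ {F G a b c d a′ b′ c′ d′} → a′ ≤ b′ → c′ ≤ d′ →
    (∀ {p} → InF F a b c d p → InF G a′ b′ c′ d′ p) →
    (∀ {p} → InF G a′ b′ c′ d′ p → InF F a b c d p) →
    (∀ {p} → Ext G a′ b′ c′ d′ p → Ext F a b c d p) → Good F a b c d → Good G a′ b′ c′ d′
  transfer {F} {G} {a} {b} {c} {d} {a′} {b′} {c′} {d′} a′≤b′ c′≤d′ to from ext g =
    good a′≤b′ c′≤d′ (λ h → inside (from h)) tight′
    where
    open Good g
    tight′ : Tight G a′ b′ c′ d′
    tight′ p h with tight p (ext h)
    ... | inj₁ h′ = inj₁ (to h′)
    ... | inj₂ (q , q∈ , h′) = inj₂ (q , q∈ , to h′)

  module _ {F : Frame} where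
    open Frame F

    flip-InF⁺ : ∀ {a b c d p} → InF F a b c d p → InF (flip F) (- b) (- a) c d p
    flip-InF⁺ ((h₁ , h₂) , h) = (ℤₚ.neg-mono-≤ h₂ , ℤₚ.neg-mono-≤ h₁) , h

    flip-InF⁻ : ∀ {a b c d p} → InF (flip F) (- b) (- a) c d p → InF F a b c d p
    flip-InF⁻ ((h₁ , h₂) , h) = (ℤₚ.neg-cancel-≤ h₂ , ℤₚ.neg-cancel-≤ h₁) , h

    unflip-InF⁺ : ∀ {a b c d p} → InF (flip F) a b c d p → InF F (- b) (- a) c d p
    unflip-InF⁺ {a} {b} {p = p} ((h₁ , h₂) , h) =
      ( lin 2 (λ b u → :- u :≤ b ⇒ ⊢ :- b :≤ u) b (U p) h₂
      , lin 2 (λ a u → a :≤ :- u ⇒ ⊢ u :≤ :- a) a (U p) h₁) , h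

    unflip-InF⁻ : ∀ {a b c d p} → InF F (- b) (- a) c d p → InF (flip F) a b c d p
    unflip-InF⁻ {a} {b} {p = p} ((h₁ , h₂) , h) =
      ( lin 2 (λ a u → u :≤ :- a ⇒ ⊢ a :≤ :- u) a (U p) h₂
      , lin 2 (λ b u → :- b :≤ u ⇒ ⊢ :- u :≤ b) b (U p) h₁) , h

    flip-Ext⁻ : ∀ a b c d {p} → Ext (flip F) (- b) (- a) c d p → Ext F a b c d p
    flip-Ext⁻ a b c d {p} ((h₁ , h₂) , h) =
      ( lin 2 (λ a u → :- u :≤ :- a :+ # 1 ⇒ ⊢ a :- # 1 :≤ u) a (U p) h₂
      , lin 2 (λ b u → :- b :- # 1 :≤ :- u ⇒ ⊢ u :≤ b :+ # 1) b (U p) h₁) , h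

  flip-Good : ∀ {F a b c d} → Good F a b c d → Good (flip F) (- b) (- a) c d
  flip-Good {F} {a} {b} {c} {d} g = transfer {F} {flip F} (ℤₚ.neg-mono-≤ a≤b) c≤d
    (flip-InF⁺ {F}) (flip-InF⁻ {F})
    (flip-Ext⁻ {F} a b c d) g
    where open Good g

  unflip-Good : ∀ {F a b c d} → Good (flip F) a b c d → Good F (- b) (- a) c d
  unflip-Good {F} {a} {b} g = transfer {flip F} {F} (ℤₚ.neg-mono-≤ a≤b) c≤d
    (unflip-InF⁺ {F}) (unflip-InF⁻ {F})
    (λ {p} ((h₁ , h₂) , h) →
      (lin 2 (λ a u → u :≤ :- a :+ # 1 ⇒ ⊢ a :- # 1 :≤ :- u) a (U p) h₂ ,
       lin 2 (λ b u → :- b :- # 1 :≤ u ⇒ ⊢ :- u :≤ b :+ # 1) b (U p) h₁) , h) g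
    where
    open Good g
    open Frame F

  swap-Good : ∀ {F a b c d} → Good F a b c d → Good (swap F) c d a b
  swap-Good {F} g = transfer {F} {swap F} (Good.c≤d g) (Good.a≤b g)
    (λ (h , h′) → h′ , h) (λ (h , h′) → h′ , h) (λ (h , h′) → h′ , h) g

  unswap-Good : ∀ {F a b c d} → Good (swap F) a b c d → Good F c d a b
  unswap-Good {F} g = transfer {swap F} {F} (Good.c≤d g) (Good.a≤b g)
    (λ (h , h′) → h′ , h) (λ (h , h′) → h′ , h) (λ (h , h′) → h′ , h) g

  -- If three of the four neighbours of `p` are present, only `mv e f p` could be gained, which a
  -- stuck set forbids.
  stuck-mv : ∀ F {p} → let open Frame F in p ∉ A → Cl A p → ∀ e f → Cl A (mv (not e) f p) →
    Cl A (mv e (not f) p) → Cl A (mv (not e) (not f) p) → ⊥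
  stuck-mv F {p} p∉ clp e f c₁ c₂ c₃ = stuck p p∉ clp (mv e f p) others
    where
    open Frame F
    same : ∀ e e′ → e′ ≡ e ⊎ e′ ≡ not e
    same true true = inj₁ refl
    same true false = inj₂ refl
    same false true = inj₂ refl
    same false false = inj₁ refl
    others : ∀ r → r ∈ neighbours p → Cl A r ⊎ r ≡ mv e f p
    others r r∈ with neighbour-mv r∈
    ... | e′ , f′ , refl with same e e′ | same f f′
    ...   | inj₁ refl | inj₁ refl = inj₂ refl
    ...   | inj₁ refl | inj₂ refl = inj₁ c₂
    ...   | inj₂ refl | inj₁ refl = inj₁ c₁
    ...   | inj₂ refl | inj₂ refl = inj₁ c₃

  Cl-neighbour : ∀ {p q} → q ∈ A → q ∈ neighbours p → Cl A p
  Cl-neighbour q∈ n = inj₂ (_ , q∈ , neighbours-sym n)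

  module _ (F : Frame) {a b c d : ℤ} (g : Good F a b c d) where
    open Frame F
    open Good g

    -- Lattice points of the column `b + 1` are two apart. Going up from `r`, a missing point `p`
    -- has both inner neighbours in the enlarged box and its lower outer neighbour next to the
    -- preceding point `s` of the column. Only the upper outer neighbour could be new, so `p` is not
    -- missing.
    fill-upwards : ∀ {r} → r ∈ A → U r ≡ b + 1ℤ → c ≤ V r → ∀ n {p} →
      U p ≡ b + 1ℤ → V p ≡ V r + (+ n + + n) → V p ≤ d → p ∈ A
    fill-upwards {r} r∈ ur c≤ zero {p} up vp ≤d =
      subst (_∈ A) (UV-injective (trans ur (sym up)) (sym (trans vp (ℤₚ.+-identityʳ (V r))))) r∈
    fill-upwards {r} r∈ ur c≤ (suc n) {p} up vp ≤d with p ∈? A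
    ... | yes p∈ = p∈
    ... | no p∉ = ⊥-elim (stuck-mv F p∉ (Cl-neighbour q∈ (mv-neighbour false false p)) true true
                    (Ext⇒Cl g upper) (Cl-neighbour s∈ (mv-neighbour false false t)) (inj₁ q∈))
      where
      q = mv false false p
      t = mv true false p
      s = mv false false t
      w = mv false true p
      q∈ : q ∈ A
      q∈ = inside
        ( ( lin 4 (λ a b u u′ → a :≤ b ⇒ u :≡ b :+ # 1 ⇒ u′ :≡ u :- # 1 ⇒ ⊢ a :≤ u′)
              a b (U p) (U q) a≤b up (U-mv false false p)
          , lin 3 (λ b u u′ → u :≡ b :+ # 1 ⇒ u′ :≡ u :- # 1 ⇒ ⊢ u′ :≤ b)
              b (U p) (U q) up (U-mv false false p))
        , ( lin 5 (λ c r v v′ n → c :≤ r ⇒ v :≡ r :+ (# 1 :+ n :+ (# 1 :+ n)) ⇒ v′ :≡ v :- # 1 ⇒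
                     # 0 :≤ n ⇒ ⊢ c :≤ v′)
              c (V r) (V p) (V q) (+ n) c≤ vp (V-mv false false p) (+≤+ z≤n)
          , lin 3 (λ d v v′ → v :≤ d ⇒ v′ :≡ v :- # 1 ⇒ ⊢ v′ :≤ d)
              d (V p) (V q) ≤d (V-mv false false p)))
      s∈ : s ∈ A
      s∈ = fill-upwards r∈ ur c≤ n
        (lin 4 (λ b u t s → u :≡ b :+ # 1 ⇒ t :≡ u :+ # 1 ⇒ s :≡ t :- # 1 ⇒ ⊢ s :≡ b :+ # 1)
          b (U p) (U t) (U s) up (U-mv true false p) (U-mv false false t))
        (lin 5 (λ r v t s n → v :≡ r :+ (# 1 :+ n :+ (# 1 :+ n)) ⇒ t :≡ v :- # 1 ⇒ s :≡ t :- # 1 ⇒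
                  ⊢ s :≡ r :+ (n :+ n))
          (V r) (V p) (V t) (V s) (+ n) vp (V-mv true false p) (V-mv false false t))
        (lin 4 (λ d v t s → v :≤ d ⇒ t :≡ v :- # 1 ⇒ s :≡ t :- # 1 ⇒ ⊢ s :≤ d)
          d (V p) (V t) (V s) ≤d (V-mv true false p) (V-mv false false t))
      upper : Ext F a b c d w
      upper =
        ( ( lin 4 (λ a b u u′ → a :≤ b ⇒ u :≡ b :+ # 1 ⇒ u′ :≡ u :- # 1 ⇒ ⊢ a :- # 1 :≤ u′)
              a b (U p) (U w) a≤b up (U-mv false true p)
          , lin 3 (λ b u u′ → u :≡ b :+ # 1 ⇒ u′ :≡ u :- # 1 ⇒ ⊢ u′ :≤ b :+ # 1)
              b (U p) (U w) up (U-mv false true p))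
        , ( lin 5 (λ c r v v′ n → c :≤ r ⇒ v :≡ r :+ (# 1 :+ n :+ (# 1 :+ n)) ⇒ v′ :≡ v :+ # 1 ⇒
                     # 0 :≤ n ⇒ ⊢ c :- # 1 :≤ v′)
              c (V r) (V p) (V w) (+ n) c≤ vp (V-mv false true p) (+≤+ z≤n)
          , lin 3 (λ d v v′ → v :≤ d ⇒ v′ :≡ v :+ # 1 ⇒ ⊢ v′ :≤ d :+ # 1)
              d (V p) (V w) ≤d (V-mv false true p)))

  flip-V : Frame → Frame
  flip-V F = swap (flip (swap F))

  flip-V-Good : ∀ {F a b c d} → Good F a b c d → Good (flip-V F) a b (- d) (- c)
  flip-V-Good {F} g = swap-Good {flip (swap F)} (flip-Good {swap F} (swap-Good {F} g))

  module _ (F : Frame) {a b c d : ℤ} (g : Good F a b c d) where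
    open Frame F
    open Good g

    -- By parity every lattice point of the column is at an even distance from `r`. `fill-upwards`
    -- reaches those above `r`, and in the frame `flip-V` those below.
    grow-side : ∀ {r} → r ∈ A → U r ≡ b + 1ℤ → c ≤ V r → V r ≤ d → Good F a (b + 1ℤ) c d
    grow-side {r} r∈ ur c≤r r≤d =
      good (≤⇒≤+1 a≤b) c≤d inside′
        (nondegenerate⇒Tight F (lin 2 (λ a b → a :≤ b ⇒ ⊢ a :+ # 1 :≤ b :+ # 1) a b a≤b) c<d)
      where
      r∈Ext : Ext F a b c d r
      r∈Ext = (lin 3 (λ a b u → a :≤ b ⇒ u :≡ b :+ # 1 ⇒ ⊢ a :- # 1 :≤ u) a b (U r) a≤b ur , ℤₚ.≤-reflexive ur)
            , (≤⇒-1≤ c≤r , ≤⇒≤+1 r≤d)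
      -- `r` is in the enlarged box but not in the box, so tightness gives it a neighbour in the
      -- box, necessarily in another row. Hence there are two rows and the grown box is
      -- nondegenerate.
      c<d : c + 1ℤ ≤ d
      c<d with tight r r∈Ext
      ... | inj₁ ((_ , r≤b) , _) =
        ⊥-elim (lin 2 (λ b u → u :≤ b ⇒ u :≡ b :+ # 1 ⇒ ⊢⊥) b (U r) r≤b ur)
      ... | inj₂ (q , q∈ , (_ , (c≤q , q≤d))) with neighbour-mv q∈
      ...   | e , true , refl =
        lin 4 (λ c d v v′ → c :≤ v ⇒ v′ :≡ v :+ # 1 ⇒ v′ :≤ d ⇒ ⊢ c :+ # 1 :≤ d)
          c d (V r) (V q) c≤r (V-mv e true r) q≤d
      ...   | e , false , refl =
        lin 4 (λ c d v v′ → v :≤ d ⇒ v′ :≡ v :- # 1 ⇒ c :≤ v′ ⇒ ⊢ c :+ # 1 :≤ d)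
          c d (V r) (V q) r≤d (V-mv e false r) c≤q
      side : ∀ {p} → U p ≡ b + 1ℤ → c ≤ V p → V p ≤ d → p ∈ A
      side {p} up c≤p p≤d with parity p r
      ... | + n , ev = fill-upwards F g r∈ ur c≤r n up
        (lin 6 (λ b u u′ v v′ n → u :≡ b :+ # 1 ⇒ u′ :≡ b :+ # 1 ⇒ u :- u′ :+ (v :- v′) :≡ n :+ n ⇒
            ⊢ v :≡ v′ :+ (n :+ n))
          b (U p) (U r) (V p) (V r) (+ n) up ur ev)
        p≤d
      ... | -[1+ n ] , ev = fill-upwards (flip-V F) (flip-V-Good g) r∈ ur (ℤₚ.neg-mono-≤ r≤d) (suc n) up
        (lin 6 (λ b u u′ v v′ n → u :≡ b :+ # 1 ⇒ u′ :≡ b :+ # 1 ⇒ u :- u′ :+ (v :- v′) :≡ :- n :+ :- n ⇒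
            ⊢ :- v :≡ :- v′ :+ (n :+ n))
          b (U p) (U r) (V p) (V r) (+ suc n) up ur ev)
        (ℤₚ.neg-mono-≤ c≤p)
      inside′ : ∀ {p} → InF F a (b + 1ℤ) c d p → p ∈ A
      inside′ {p} ((a≤ , ≤b) , h) with ≤⇒≤⊎≡ ≤b
      ... | inj₁ ≤b′ = inside ((a≤ , ≤b′) , h)
      ... | inj₂ up = side up (proj₁ h) (proj₂ h)

    -- In a single row the lattice points are two apart, so the next one is in column `b + 2`. The
    -- position in column `b + 1` is off the lattice, hence nothing of the longer row is missing
    -- from `A`.
    grow-row : ∀ {r} → d ≤ c → r ∈ A → U r ≡ b + + 2 → V r ≡ c → Good F a (b + + 2) c d
    grow-row {r} d≤c r∈ ur vr =
      good (lin 2 (λ a b → a :≤ b ⇒ ⊢ a :≤ b :+ # 2) a b a≤b) c≤d inside′ tight′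
      where
      absurd : ∀ {p} m → (U p - U r) + (V p - V r) ≡ m + m + 1ℤ → ⊥
      absurd {p} m = odd-absurd F p r m
      old⊆new : ∀ {p} → InF F a b c d p → InF F a (b + + 2) c d p
      old⊆new {p} ((a≤ , ≤b) , h) = (a≤ , lin 2 (λ b u → u :≤ b ⇒ ⊢ u :≤ b :+ # 2) b (U p) ≤b) , h
      r∈new : InF F a (b + + 2) c d r
      r∈new = (lin 3 (λ a b u → a :≤ b ⇒ u :≡ b :+ # 2 ⇒ ⊢ a :≤ u) a b (U r) a≤b ur , ℤₚ.≤-reflexive ur)
            , (ℤₚ.≤-reflexive (sym vr) , ℤₚ.≤-trans (ℤₚ.≤-reflexive vr) c≤d)
      beyond : ∀ u → ¬ u ≤ b → u ≤ b + + 2 → u ≡ b + 1ℤ ⊎ u ≡ b + + 2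
      beyond u u≰b ≤b+2 with u ℤ.≤? b + 1ℤ
      ... | yes h = inj₁ (ℤₚ.≤-antisym h (≰⇒+1≤ u≰b))
      ... | no h = inj₂ (ℤₚ.≤-antisym ≤b+2
                     (lin 2 (λ b u → b :+ # 1 :+ # 1 :≤ u ⇒ ⊢ b :+ # 2 :≤ u) b u (≰⇒+1≤ h)))
      inside′ : ∀ {p} → InF F a (b + + 2) c d p → p ∈ A
      inside′ {p} ((a≤ , ≤b+2) , (c≤ , ≤d)) with U p ℤ.≤? b
      ... | yes ≤b = inside ((a≤ , ≤b) , (c≤ , ≤d))
      ... | no ≰b with ℤₚ.≤-antisym (ℤₚ.≤-trans ≤d d≤c) c≤ | beyond (U p) ≰b ≤b+2
      ...   | vp | inj₂ up = subst (_∈ A) (UV-injective (trans ur (sym up)) (trans vr (sym vp))) r∈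
      ...   | vp | inj₁ up = ⊥-elim (absurd {p} (- 1ℤ)
        (lin 6 (λ b c u u′ v v′ → u :≡ b :+ # 1 ⇒ u′ :≡ b :+ # 2 ⇒ v :≡ c ⇒ v′ :≡ c ⇒
                  ⊢ u :- u′ :+ (v :- v′) :≡ :- # 1 :+ :- # 1 :+ # 1)
          b c (U p) (U r) (V p) (V r) up ur vp vr))
      tight′ : Tight F a (b + + 2) c d
      tight′ p ((a≤ , ≤b+3) , (c≤ , ≤d)) with U p ℤ.≤? b + 1ℤ
      ... | yes ≤b+1 with tight p ((a≤ , ≤b+1) , (c≤ , ≤d))
      ...   | inj₁ h = inj₁ (old⊆new h)
      ...   | inj₂ (q , q∈ , h) = inj₂ (q , q∈ , old⊆new h)
      tight′ p ((a≤ , ≤b+3) , (c≤ , ≤d)) | no ≰b+1 with ≤⇒≤⊎≡ ≤b+3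
      ... | inj₁ ≤b+2 = level
        where
        up : U p ≡ b + + 2
        up = ℤₚ.≤-antisym ≤b+2 (lin 2 (λ b u → b :+ # 1 :+ # 1 :≤ u ⇒ ⊢ b :+ # 2 :≤ u) b (U p) (≰⇒+1≤ ≰b+1))
        level : InF F a (b + + 2) c d p ⊎ ∃[ q ] (q ∈ neighbours p × InF F a (b + + 2) c d q)
        level with V p ℤ.≤? c | c ℤ.≤? V p
        ... | yes v≤c | yes c≤v = inj₁ (subst (InF F a (b + + 2) c d)
                (UV-injective (trans ur (sym up)) (trans vr (ℤₚ.≤-antisym c≤v v≤c))) r∈new)
        ... | no v≰c | _ = ⊥-elim (absurd {p} 0ℤ
              (lin 7 (λ b c d u u′ v v′ → u :≡ b :+ # 2 ⇒ u′ :≡ b :+ # 2 ⇒ c :+ # 1 :≤ v ⇒ v :≤ d :+ # 1 ⇒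
                        d :≤ c ⇒ v′ :≡ c ⇒ ⊢ u :- u′ :+ (v :- v′) :≡ # 0 :+ # 0 :+ # 1)
                b c d (U p) (U r) (V p) (V r) up ur (≰⇒+1≤ v≰c) ≤d d≤c vr))
        ... | yes _ | no c≰v = ⊥-elim (absurd {p} (- 1ℤ)
              (lin 6 (λ b c u u′ v v′ → u :≡ b :+ # 2 ⇒ u′ :≡ b :+ # 2 ⇒ v :+ # 1 :≤ c ⇒ c :- # 1 :≤ v ⇒
                        v′ :≡ c ⇒ ⊢ u :- u′ :+ (v :- v′) :≡ :- # 1 :+ :- # 1 :+ # 1)
                b c (U p) (U r) (V p) (V r) up ur (≰⇒+1≤ c≰v) c≤ vr))
      ... | inj₂ up = level
        where
        next : ∀ f → V r ≡ V p + sg f → r ≡ mv false f p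
        next f eq = UV-injective
          (lin 4 (λ b u u′ w → u :≡ b :+ # 2 :+ # 1 ⇒ u′ :≡ b :+ # 2 ⇒ w :≡ u :- # 1 ⇒ ⊢ u′ :≡ w)
            b (U p) (U r) (U (mv false f p)) up ur (U-mv false f p))
          (trans eq (sym (V-mv false f p)))
        via : ∀ f → V r ≡ V p + sg f → ∃[ q ] (q ∈ neighbours p × InF F a (b + + 2) c d q)
        via f eq = r , subst (_∈ neighbours p) (sym (next f eq)) (mv-neighbour false f p) , r∈new
        level : InF F a (b + + 2) c d p ⊎ ∃[ q ] (q ∈ neighbours p × InF F a (b + + 2) c d q)
        level with V p ℤ.≤? c | c ℤ.≤? V p
        ... | yes v≤c | yes c≤v = ⊥-elim (absurd {p} 0ℤ
              (lin 6 (λ b c u u′ v v′ → u :≡ b :+ # 2 :+ # 1 ⇒ u′ :≡ b :+ # 2 ⇒ v :≤ c ⇒ c :≤ v ⇒ v′ :≡ c ⇒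
                        ⊢ u :- u′ :+ (v :- v′) :≡ # 0 :+ # 0 :+ # 1)
                b c (U p) (U r) (V p) (V r) up ur v≤c c≤v vr))
        ... | no v≰c | _ = inj₂ (via false
              (lin 4 (λ c d v v′ → c :+ # 1 :≤ v ⇒ v :≤ d :+ # 1 ⇒ d :≤ c ⇒ v′ :≡ c ⇒ ⊢ v′ :≡ v :- # 1)
                c d (V p) (V r) (≰⇒+1≤ v≰c) ≤d d≤c vr))
        ... | yes _ | no c≰v = inj₂ (via true
              (lin 3 (λ c v v′ → v :+ # 1 :≤ c ⇒ c :- # 1 :≤ v ⇒ v′ :≡ c ⇒ ⊢ v′ :≡ v :+ # 1)
                c (V p) (V r) (≰⇒+1≤ c≰v) c≤ vr))

-- Closing a box under growth

module Closure (A : List Pt) (stuck : Stuck A) where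
  open Growth A stuck

  -- The new box must contain a point of `A` that the old one lacks; this makes repeated growth
  -- terminate.
  Grows : Frame → (Pt → Set) → Set
  Grows F Q = ∃[ a ] ∃[ b ] ∃[ c ] ∃[ d ] (Good F a b c d × (∀ {p} → Q p → InF F a b c d p)
    × ∃[ r ] (r ∈ A × InF F a b c d r × ¬ Q r))

  unflip-Grows : ∀ {F a b c d} → Grows (flip F) (InF (flip F) (- b) (- a) c d) → Grows F (InF F a b c d)
  unflip-Grows {F} (a , b , c , d , g , old , r , r∈ , rin , rout) =
    - b , - a , c , d , unflip-Good {F} g , (λ h → unflip-InF⁺ {F} (old (flip-InF⁺ {F} h))) ,
    r , r∈ , unflip-InF⁺ {F} rin , λ h → rout (flip-InF⁺ {F} h)

  unswap-Grows : ∀ {F a b c d} → Grows (swap F) (InF (swap F) c d a b) → Grows F (InF F a b c d)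
  unswap-Grows {F} (a , b , c , d , g , old , r , r∈ , (h , h′) , rout) =
    c , d , a , b , unswap-Good {F} g , (λ (h , h′) → let k , k′ = old (h′ , h) in k′ , k) ,
    r , r∈ , (h′ , h) , λ (h , h′) → rout (h′ , h)

  module _ (F : Frame) {a b c d : ℤ} (g : Good F a b c d) where
    open Frame F
    open Good g

    grows-side : ∀ {r} → r ∈ A → U r ≡ b + 1ℤ → c ≤ V r → V r ≤ d → Grows F (InF F a b c d)
    grows-side {r} r∈ ur c≤ ≤d =
      a , b + 1ℤ , c , d , grow-side F g r∈ ur c≤ ≤d ,
      (λ {p} ((h₁ , h₂) , h) → (h₁ , ≤⇒≤+1 h₂) , h) ,
      r , r∈ ,
      ( ( lin 3 (λ a b u → a :≤ b ⇒ u :≡ b :+ # 1 ⇒ ⊢ a :≤ u) a b (U r) a≤b ur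
        , ℤₚ.≤-reflexive ur) , (c≤ , ≤d)) ,
      λ ((_ , h) , _) → lin 2 (λ b u → u :≡ b :+ # 1 ⇒ u :≤ b ⇒ ⊢⊥) b (U r) ur h

    grows-row : ∀ {r} → d ≤ c → r ∈ A → U r ≡ b + + 2 → V r ≡ c → Grows F (InF F a b c d)
    grows-row {r} d≤c r∈ ur vr =
      a , b + + 2 , c , d , grow-row F g d≤c r∈ ur vr ,
      (λ {p} ((h₁ , h₂) , h) → (h₁ , lin 2 (λ b u → u :≤ b ⇒ ⊢ u :≤ b :+ # 2) b (U p) h₂) , h) ,
      r , r∈ ,
      ( ( lin 3 (λ a b u → a :≤ b ⇒ u :≡ b :+ # 2 ⇒ ⊢ a :≤ u) a b (U r) a≤b ur
        , ℤₚ.≤-reflexive ur) , (ℤₚ.≤-reflexive (sym vr) , ℤₚ.≤-trans (ℤₚ.≤-reflexive vr) c≤d)) ,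
      λ ((_ , h) , _) → lin 2 (λ b u → u :≡ b :+ # 2 ⇒ u :≤ b ⇒ ⊢⊥) b (U r) ur h

    -- A point diagonal to the corner is reduced to the point `p` two rows below it, which lies
    -- beside the box because there are two rows. If `p` were missing, its inner neighbours would be
    -- in the enlarged box and its upper outer neighbour next to `r`, so only the lower outer one
    -- could be new.
    grows-corner-wide : ∀ {r} → c + 1ℤ ≤ d → r ∈ A → U r ≡ b + 1ℤ → V r ≡ d + 1ℤ → Grows F (InF F a b c d)
    grows-corner-wide {r} c<d r∈ ur vr with mv true false (mv false false r) ∈? A
    ... | yes p∈ = grows-side p∈
      (lin 4 (λ b u u′ u″ → u :≡ b :+ # 1 ⇒ u′ :≡ u :- # 1 ⇒ u″ :≡ u′ :+ # 1 ⇒ ⊢ u″ :≡ b :+ # 1)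
        b (U r) (U k) (U p) ur (U-mv false false r) (U-mv true false k))
      (lin 5 (λ c d v v′ v″ → c :+ # 1 :≤ d ⇒ v :≡ d :+ # 1 ⇒ v′ :≡ v :- # 1 ⇒ v″ :≡ v′ :- # 1 ⇒ ⊢ c :≤ v″)
        c d (V r) (V k) (V p) c<d vr (V-mv false false r) (V-mv true false k))
      (lin 4 (λ d v v′ v″ → v :≡ d :+ # 1 ⇒ v′ :≡ v :- # 1 ⇒ v″ :≡ v′ :- # 1 ⇒ ⊢ v″ :≤ d)
        d (V r) (V k) (V p) vr (V-mv false false r) (V-mv true false k))
      where
      k = mv false false r
      p = mv true false k
    ... | no p∉ = ⊥-elim (stuck-mv F p∉ (Ext⇒Cl g p∈Ext) true false
                    (Ext⇒Cl g q∈Ext) (Cl-neighbour r∈ r∈n) (Ext⇒Cl g s∈Ext))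
      where
      k = mv false false r
      p = mv true false k
      q = mv false false p
      s = mv false true p
      t = mv true true p
      uk : U k ≡ b
      uk = lin 3 (λ b u u′ → u :≡ b :+ # 1 ⇒ u′ :≡ u :- # 1 ⇒ ⊢ u′ :≡ b) b (U r) (U k) ur (U-mv false false r)
      vk : V k ≡ d
      vk = lin 3 (λ b u u′ → u :≡ b :+ # 1 ⇒ u′ :≡ u :- # 1 ⇒ ⊢ u′ :≡ b) d (V r) (V k) vr (V-mv false false r)
      up : U p ≡ b + 1ℤ
      up = trans (U-mv true false k) (cong (_+ 1ℤ) uk)
      vp : V p ≡ d - 1ℤ
      vp = trans (V-mv true false k) (cong (_- 1ℤ) vk)
      p∈Ext : Ext F a b c d p
      p∈Ext = ( lin 3 (λ a b u → a :≤ b ⇒ u :≡ b :+ # 1 ⇒ ⊢ a :- # 1 :≤ u) a b (U p) a≤b up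
              , ℤₚ.≤-reflexive up)
            , ( lin 3 (λ c d v → c :≤ d ⇒ v :≡ d :- # 1 ⇒ ⊢ c :- # 1 :≤ v) c d (V p) c≤d vp
              , lin 2 (λ d v → v :≡ d :- # 1 ⇒ ⊢ v :≤ d :+ # 1) d (V p) vp)
      column : ∀ {w} → U w ≡ U p - 1ℤ → a - 1ℤ ≤ U w × U w ≤ b + 1ℤ
      column {w} uw =
          lin 4 (λ a b u w → a :≤ b ⇒ u :≡ b :+ # 1 ⇒ w :≡ u :- # 1 ⇒ ⊢ a :- # 1 :≤ w) a b (U p) (U w) a≤b up uw
        , lin 3 (λ b u w → u :≡ b :+ # 1 ⇒ w :≡ u :- # 1 ⇒ ⊢ w :≤ b :+ # 1) b (U p) (U w) up uw
      q∈Ext : Ext F a b c d q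
      q∈Ext = column {q} (U-mv false false p)
            , ( lin 4 (λ c d v w → c :+ # 1 :≤ d ⇒ v :≡ d :- # 1 ⇒ w :≡ v :- # 1 ⇒ ⊢ c :- # 1 :≤ w)
                  c d (V p) (V q) c<d vp (V-mv false false p)
              , lin 3 (λ d v w → v :≡ d :- # 1 ⇒ w :≡ v :- # 1 ⇒
                  ⊢ w :≤ d :+ # 1) d (V p) (V q) vp (V-mv false false p))
      s∈Ext : Ext F a b c d s
      s∈Ext = column {s} (U-mv false true p)
            , ( lin 4 (λ c d v w → c :≤ d ⇒ v :≡ d :- # 1 ⇒ w :≡ v :+ # 1 ⇒ ⊢ c :- # 1 :≤ w)
                  c d (V p) (V s) c≤d vp (V-mv false true p)
              , lin 3 (λ d v w → v :≡ d :- # 1 ⇒ w :≡ v :+ # 1 ⇒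
                  ⊢ w :≤ d :+ # 1) d (V p) (V s) vp (V-mv false true p))
      r∈n : r ∈ neighbours t
      r∈n = subst (_∈ neighbours t) (UV-injective
        (lin 5 (λ b r p t w → r :≡ b :+ # 1 ⇒ p :≡ b :+ # 1 ⇒ t :≡ p :+ # 1 ⇒ w :≡ t :- # 1 ⇒ ⊢ w :≡ r)
          b (U r) (U p) (U t) (U (mv false true t)) ur up (U-mv true true p) (U-mv false true t))
        (lin 5 (λ d r p t w → r :≡ d :+ # 1 ⇒ p :≡ d :- # 1 ⇒ t :≡ p :+ # 1 ⇒ w :≡ t :+ # 1 ⇒ ⊢ w :≡ r)
          d (V r) (V p) (V t) (V (mv false true t)) vr vp (V-mv true true p) (V-mv false true t)))
        (mv-neighbour false true t)

    -- A single position and its diagonal neighbour already fill a two by two box, since the other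
    -- two positions have the wrong parity.
    grows-corner-point : ∀ {r} → b ≤ a → d ≤ c → r ∈ A → U r ≡ b + 1ℤ → V r ≡ d + 1ℤ → Grows F (InF F a b c d)
    grows-corner-point {r} b≤a d≤c r∈ ur vr =
      a , b + 1ℤ , c , d + 1ℤ ,
      good (≤⇒≤+1 a≤b) (≤⇒≤+1 c≤d) inside′
        (nondegenerate⇒Tight F (lin 2 (λ a b → a :≤ b ⇒ ⊢ a :+ # 1 :≤ b :+ # 1) a b a≤b)
                               (lin 2 (λ a b → a :≤ b ⇒ ⊢ a :+ # 1 :≤ b :+ # 1) c d c≤d)) ,
      (λ {p} ((h₁ , h₂) , (h₃ , h₄)) →
          (h₁ , ≤⇒≤+1 h₂)
        , (h₃ , ≤⇒≤+1 h₄)) ,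
      r , r∈ ,
      ( (lin 3 (λ a b u → a :≤ b ⇒ u :≡ b :+ # 1 ⇒ ⊢ a :≤ u) a b (U r) a≤b ur , ℤₚ.≤-reflexive ur)
      , (lin 3 (λ a b u → a :≤ b ⇒ u :≡ b :+ # 1 ⇒ ⊢ a :≤ u) c d (V r) c≤d vr , ℤₚ.≤-reflexive vr)) ,
      λ ((_ , h) , _) → lin 2 (λ b u → u :≡ b :+ # 1 ⇒ u :≤ b ⇒ ⊢⊥) b (U r) ur h
      where
      inside′ : ∀ {p} → InF F a (b + 1ℤ) c (d + 1ℤ) p → p ∈ A
      inside′ {p} ((a≤ , ≤b) , (c≤ , ≤d)) with ≤⇒≤⊎≡ ≤b | ≤⇒≤⊎≡ ≤d
      ... | inj₁ ≤b′ | inj₁ ≤d′ = inside ((a≤ , ≤b′) , (c≤ , ≤d′))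
      ... | inj₂ up | inj₂ vp = subst (_∈ A) (UV-injective (trans ur (sym up)) (trans vr (sym vp))) r∈
      ... | inj₁ ≤b′ | inj₂ vp = ⊥-elim (odd-absurd F p r (- 1ℤ)
        (lin 7 (λ a b d u u′ v v′ → b :≤ a ⇒ a :≤ u ⇒ u :≤ b ⇒ u′ :≡ b :+ # 1 ⇒ v :≡ d :+ # 1 ⇒ v′ :≡ d :+ # 1 ⇒
                  ⊢ u :- u′ :+ (v :- v′) :≡ :- # 1 :+ :- # 1 :+ # 1)
          a b d (U p) (U r) (V p) (V r) b≤a a≤ ≤b′ ur vp vr))
      ... | inj₂ up | inj₁ ≤d′ = ⊥-elim (odd-absurd F p r (- 1ℤ)
        (lin 7 (λ a b d u u′ v v′ → b :≤ a ⇒ a :≤ u ⇒ u :≤ b ⇒ u′ :≡ b :+ # 1 ⇒ v :≡ d :+ # 1 ⇒ v′ :≡ d :+ # 1 ⇒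
                  ⊢ v :- v′ :+ (u :- u′) :≡ :- # 1 :+ :- # 1 :+ # 1)
          c d b (V p) (V r) (U p) (U r) d≤c c≤ ≤d′ vr up ur))

  module _ (F : Frame) {a b c d : ℤ} (g : Good F a b c d) where
    open Frame F
    open Good g

    grows-corner : ∀ {r} → r ∈ A → U r ≡ b + 1ℤ → V r ≡ d + 1ℤ → Grows F (InF F a b c d)
    grows-corner {r} r∈ ur vr with c + 1ℤ ℤ.≤? d | a + 1ℤ ℤ.≤? b
    ... | yes c<d | _ = grows-corner-wide F g c<d r∈ ur vr
    ... | no _ | yes a<b = unswap-Grows {F} (grows-corner-wide (swap F) (swap-Good {F} g) a<b r∈ vr ur)
    ... | no c≮d | no a≮b = grows-corner-point F g (narrow a≮b) (narrow c≮d) r∈ ur vr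
      where
      narrow : ∀ {i j} → ¬ i + 1ℤ ≤ j → j ≤ i
      narrow {i} {j} h = lin 2 (λ i j → j :+ # 1 :≤ i :+ # 1 ⇒ ⊢ j :≤ i) i j (≰⇒+1≤ h)

    -- These are the positions from which a point of `A` forces growth: the surrounding layer and,
    -- for a single row or column, the next lattice position on its line. The lower ends are written
    -- with negated coordinates so that they are literally the upper ends in the flipped frame.
    Attached : Pt → Set
    Attached r = Ext F a b c d r
      ⊎ (d ≤ c × V r ≡ c × (U r ≡ b + + 2 ⊎ - U r ≡ - a + + 2))
      ⊎ (b ≤ a × U r ≡ a × (V r ≡ d + + 2 ⊎ - V r ≡ - c + + 2))

    Attached? : Decidable Attached
    Attached? r = InF? F (a - 1ℤ) (b + 1ℤ) (c - 1ℤ) (d + 1ℤ) r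
      ⊎-dec (((d ℤ.≤? c) ×-dec ((V r ℤ.≟ c) ×-dec ((U r ℤ.≟ b + + 2) ⊎-dec (- U r ℤ.≟ - a + + 2))))
      ⊎-dec ((b ℤ.≤? a) ×-dec ((U r ℤ.≟ a) ×-dec ((V r ℤ.≟ d + + 2) ⊎-dec (- V r ℤ.≟ - c + + 2)))))

  private
    ≡-1⇒-≡ : ∀ a u → ¬ a ≤ u → a - 1ℤ ≤ u → - u ≡ - a + 1ℤ
    ≡-1⇒-≡ a u h h′ = lin 2 (λ a u → u :+ # 1 :≤ a ⇒ a :- # 1 :≤ u ⇒ ⊢ :- u :≡ :- a :+ # 1) a u (≰⇒+1≤ h) h′

  grows-right : ∀ F {a b c d} → Good F a b c d → let open Frame F in ∀ {r} → r ∈ A → U r ≡ b + 1ℤ →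
    c - 1ℤ ≤ V r → V r ≤ d + 1ℤ → Grows F (InF F a b c d)
  grows-right F {a} {b} {c} {d} g {r} r∈ ur c≤ ≤d with ≤⇒≤⊎≡ ≤d | c ℤ.≤? Frame.V F r
  ... | inj₂ vr | _ = grows-corner F g r∈ ur vr
  ... | inj₁ ≤d′ | yes c≤′ = grows-side F g r∈ ur c≤′ ≤d′
  ... | inj₁ _ | no c≰ = unflip-V (grows-corner (flip-V F) (flip-V-Good {F} g) r∈ ur (≡-1⇒-≡ c _ c≰ c≤))
    where
    unflip-V : Grows (flip-V F) (InF (flip-V F) a b (- d) (- c)) → Grows F (InF F a b c d)
    unflip-V h = unswap-Grows {F} (unflip-Grows {swap F} (unswap-Grows {flip (swap F)} h))

  attached-grows : ∀ F {a b c d} (g : Good F a b c d) {r} → r ∈ A → ¬ InF F a b c d r → Attached F g r →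
    Grows F (InF F a b c d)
  attached-grows F {a} {b} {c} {d} g {r} r∈ r∉ (inj₁ ((a≤ , ≤b) , (c≤ , ≤d)))
    with ≤⇒≤⊎≡ ≤b | a ℤ.≤? Frame.U F r | ≤⇒≤⊎≡ ≤d | c ℤ.≤? Frame.V F r
  ... | inj₂ ur | _ | _ | _ = grows-right F g r∈ ur c≤ ≤d
  ... | inj₁ _ | no a≰ | _ | _ =
    unflip-Grows {F} (grows-right (flip F) (flip-Good {F} g) r∈ (≡-1⇒-≡ a _ a≰ a≤) c≤ ≤d)
  ... | inj₁ _ | yes _ | inj₂ vr | _ =
    unswap-Grows {F} (grows-right (swap F) (swap-Good {F} g) r∈ vr a≤ ≤b)
  ... | inj₁ _ | yes _ | inj₁ _ | no c≰ =
    unswap-Grows {F} (unflip-Grows {swap F} (grows-right (flip (swap F)) (flip-Good {swap F} (swap-Good {F} g))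
      r∈ (≡-1⇒-≡ c _ c≰ c≤) a≤ ≤b))
  ... | inj₁ ≤b′ | yes a≤′ | inj₁ ≤d′ | yes c≤′ = ⊥-elim (r∉ ((a≤′ , ≤b′) , (c≤′ , ≤d′)))
  attached-grows F g r∈ r∉ (inj₂ (inj₁ (d≤c , vr , inj₁ ur))) = grows-row F g d≤c r∈ ur vr
  attached-grows F g r∈ r∉ (inj₂ (inj₁ (d≤c , vr , inj₂ ur))) =
    unflip-Grows {F} (grows-row (flip F) (flip-Good {F} g) d≤c r∈ ur vr)
  attached-grows F g r∈ r∉ (inj₂ (inj₂ (b≤a , ur , inj₁ vr))) =
    unswap-Grows {F} (grows-row (swap F) (swap-Good {F} g) b≤a r∈ vr ur)
  attached-grows F g r∈ r∉ (inj₂ (inj₂ (b≤a , ur , inj₂ vr))) =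
    unswap-Grows {F} (unflip-Grows {swap F} (grows-row (flip (swap F)) (flip-Good {swap F}
        (swap-Good {F} g)) b≤a r∈ vr ur))

  point-Good : ∀ F {r} → r ∈ A → let open Frame F in Good F (U r) (U r) (V r) (V r)
  point-Good F {r} r∈ = good ℤₚ.≤-refl ℤₚ.≤-refl
    (λ ((h₁ , h₂) , (h₃ , h₄)) → subst (_∈ A) (UV-injective (ℤₚ.≤-antisym h₁ h₂) (ℤₚ.≤-antisym h₃ h₄)) r∈) tight
    where
    open Frame F
    position : ∀ u w → u - 1ℤ ≤ w → w ≤ u + 1ℤ → w ≡ u ⊎ ∃[ e ] u ≡ w + sg e
    position u w lo hi with w ℤ.≤? u | u ℤ.≤? w
    ... | yes h | yes h′ = inj₁ (ℤₚ.≤-antisym h h′)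
    ... | no h | _ = inj₂ (false , lin 2 (λ u w → u :+ # 1 :≤ w ⇒ w :≤ u :+ # 1 ⇒ ⊢ u :≡ w :- # 1) u w (≰⇒+1≤ h) hi)
    ... | yes _ | no h = inj₂ (true , lin 2 (λ u w → w :+ # 1 :≤ u ⇒ u :- # 1 :≤ w ⇒
        ⊢ u :≡ w :+ # 1) u w (≰⇒+1≤ h) lo)
    r∈box : InF F (U r) (U r) (V r) (V r) r
    r∈box = (ℤₚ.≤-refl , ℤₚ.≤-refl) , (ℤₚ.≤-refl , ℤₚ.≤-refl)
    absurd : ∀ e {i j i′ j′} → i ≡ i′ → j ≡ j′ + sg e →
      (∀ m → (i′ - i) + (j′ - j) ≡ m + m + 1ℤ → ⊥) → ⊥
    absurd true {i} {j} {i′} {j′} h h′ odd = odd (- 1ℤ)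
      (lin 4 (λ i j i′ j′ → i :≡ i′ ⇒ j :≡ j′ :+ # 1 ⇒ ⊢ i′ :- i :+
          (j′ :- j) :≡ :- # 1 :+ :- # 1 :+ # 1) i j i′ j′ h h′)
    absurd false {i} {j} {i′} {j′} h h′ odd = odd 0ℤ
      (lin 4 (λ i j i′ j′ → i :≡ i′ ⇒ j :≡ j′ :- # 1 ⇒ ⊢ i′ :- i :+ (j′ :- j) :≡ # 0 :+ # 0 :+ # 1) i j i′ j′ h h′)
    tight : Tight F (U r) (U r) (V r) (V r)
    tight p ((h₁ , h₂) , (h₃ , h₄)) with position (U r) (U p) h₁ h₂ | position (V r) (V p) h₃ h₄
    ... | inj₁ eu | inj₁ ev = inj₁ (subst (InF F (U r) (U r) (V r) (V r)) (UV-injective (sym eu) (sym ev)) r∈box)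
    ... | inj₂ (e , eu) | inj₂ (f , ev) = inj₂ (r ,
      subst (_∈ neighbours p) (UV-injective (trans (U-mv e f p) (sym eu))
          (trans (V-mv e f p) (sym ev))) (mv-neighbour e f p) ,
      r∈box)
    ... | inj₁ eu | inj₂ (f , ev) = ⊥-elim (absurd f {j′ = V p} (sym eu) ev (odd-absurd F p r))
    ... | inj₂ (e , eu) | inj₁ ev = ⊥-elim (absurd e {j′ = U p} (sym ev) eu (odd-absurd (swap F) p r))

  ClosedBox : Frame → Pt → Set
  ClosedBox F x = ∃[ a ] ∃[ b ] ∃[ c ] ∃[ d ] Σ (Good F a b c d) λ g → InF F a b c d x ×
    (∀ {r} → r ∈ A → ¬ InF F a b c d r → ¬ Attached F g r)

  -- Each growth absorbs a further point of `A`, so the number of points outside the box decreases.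
  -- `A` is a bare list, and `deduplicate` makes the lengths count points.
  closed-box : ∀ F {x} → x ∈ A → ClosedBox F x
  closed-box F {x} x∈ = go (point-Good F x∈) ((ℤₚ.≤-refl , ℤₚ.≤-refl) , (ℤₚ.≤-refl , ℤₚ.≤-refl)) (<-wellFounded _)
    where
    outside : ∀ a b c d → List Pt
    outside a b c d = filter (λ p → ¬? (InF? F a b c d p)) (deduplicate _≟ₚ_ A)
    go : ∀ {a b c d} → Good F a b c d → InF F a b c d x → Acc ℕ._<_ (length (outside a b c d)) → ClosedBox F x
    go {a} {b} {c} {d} g x∈box (acc rec)
      with any? (λ r → ¬? (InF? F a b c d r) ×-dec Attached? F g r) A
    ... | no none = a , b , c , d , g , x∈box , λ r∈ r∉ att → none (lose r∈ (r∉ , att))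
    ... | yes some with find some
    ...   | r , r∈ , r∉ , att with attached-grows F g r∈ r∉ att
    ...     | a′ , b′ , c′ , d′ , g′ , old , s , s∈ , s∈new , s∉old = go g′ (old x∈box)
      (rec (unique-⊂⇒length< (Uniqueₚ.filter⁺ (λ p → ¬? (InF? F a′ b′ c′ d′ p)) (deduplicate-! A)) sub
        (∈-filter⁺ (λ p → ¬? (InF? F a b c d p)) (∈-deduplicate⁺ _≟ₚ_ s∈) s∉old)
        λ h → proj₂ (∈-filter⁻ (λ p → ¬? (InF? F a′ b′ c′ d′ p)) {xs = deduplicate _≟ₚ_ A} h) s∈new))
      where
      sub : outside a′ b′ c′ d′ ⊆ outside a b c d
      sub h with ∈-filter⁻ (λ p → ¬? (InF? F a′ b′ c′ d′ p)) {xs = deduplicate _≟ₚ_ A} h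
      ... | q∈ , q∉ = ∈-filter⁺ (λ p → ¬? (InF? F a b c d p)) q∈ (λ q∈old → q∉ (old q∈old))

  module _ (F : Frame) {a b c d : ℤ} (g : Good F a b c d) where
    open Frame F
    open Good g

    -- The inner neighbours of `z` are in the enlarged box and one outer neighbour would be in `A`,
    -- so inserting `z` could gain only the other outer neighbour.
    beside-side-absurd : ∀ {z} f → z ∉ A → U z ≡ b + 1ℤ → c ≤ V z → V z ≤ d → mv true f z ∉ A
    beside-side-absurd {z} f z∉ uz c≤ ≤d r∈ = helper f r∈
      where
      z∈Ext : Ext F a b c d z
      z∈Ext = (lin 3 (λ a b u → a :≤ b ⇒ u :≡ b :+ # 1 ⇒ ⊢ a :- # 1 :≤ u) a b (U z) a≤b uz , ℤₚ.≤-reflexive uz)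
            , (≤⇒-1≤ c≤ , ≤⇒≤+1 ≤d)
      column : ∀ f → a - 1ℤ ≤ U (mv false f z) × U (mv false f z) ≤ b + 1ℤ
      column f = lin 4 (λ a b u w → a :≤ b ⇒ u :≡ b :+ # 1 ⇒ w :≡ u :- # 1 ⇒ ⊢ a :- # 1 :≤ w)
                   a b (U z) (U (mv false f z)) a≤b uz (U-mv false f z)
               , lin 3 (λ b u w → u :≡ b :+ # 1 ⇒ w :≡ u :- # 1 ⇒ ⊢ w :≤ b :+ # 1)
                   b (U z) (U (mv false f z)) uz (U-mv false f z)
      near : ∀ f → Cl A (mv false f z)
      near true = Ext⇒Cl g (column true ,
        ( lin 3 (λ c v w → c :≤ v ⇒ w :≡ v :+ # 1 ⇒ ⊢ c :- # 1 :≤ w) c (V z) (V (mv false true z)) c≤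
            (V-mv false true z)
        , lin 3 (λ d v w → v :≤ d ⇒ w :≡ v :+ # 1 ⇒ ⊢ w :≤ d :+ # 1) d (V z) (V (mv false true z)) ≤d
            (V-mv false true z)))
      near false = Ext⇒Cl g (column false ,
        ( lin 3 (λ c v w → c :≤ v ⇒ w :≡ v :- # 1 ⇒ ⊢ c :- # 1 :≤ w) c (V z) (V (mv false false z)) c≤
            (V-mv false false z)
        , lin 3 (λ d v w → v :≤ d ⇒ w :≡ v :- # 1 ⇒ ⊢ w :≤ d :+ # 1) d (V z) (V (mv false false z)) ≤d
            (V-mv false false z)))
      helper : ∀ f → mv true f z ∈ A → ⊥
      helper true r∈ = stuck-mv F z∉ (Ext⇒Cl g z∈Ext) true false (near false) (inj₁ r∈) (near true)
      helper false r∈ = stuck-mv F z∉ (Ext⇒Cl g z∈Ext) true true (near true) (inj₁ r∈) (near false)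

    -- A point two columns beyond the side is an outer neighbour of a point `z` beside the side, to
    -- which `beside-side-absurd` applies. `z` is taken one row below if that row belongs to the
    -- box, otherwise one row above. If neither does, the box is a single row continued by `r`,
    -- which `row` excludes.
    beyond-side-absurd : ∀ {r} → (∀ {z} → Ext F a b c d z → U z ≡ b + 1ℤ → z ∉ A) →
      (d ≤ c → V r ≡ c → ⊥) → U r ≡ b + + 2 → c ≤ V r → V r ≤ d → r ∉ A
    beyond-side-absurd {r} side row ur c≤ ≤d r∈ with c ℤ.≤? V r - 1ℤ
    ... | yes c≤r-1 = beside-side-absurd true (side z∈Ext uz) uz
            (subst (c ≤_) (sym vz) c≤r-1)
            (lin 3 (λ d v w → v :≤ d ⇒ w :≡ v :- # 1 ⇒ ⊢ w :≤ d) d (V r) (V z) ≤d vz)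
            (subst (_∈ A) (sym back) r∈)
      where
      z = mv false false r
      uz : U z ≡ b + 1ℤ
      uz = lin 3 (λ b u w → u :≡ b :+ # 2 ⇒ w :≡ u :- # 1 ⇒ ⊢ w :≡ b :+ # 1) b (U r) (U z) ur (U-mv false false r)
      vz : V z ≡ V r - 1ℤ
      vz = V-mv false false r
      z∈Ext : Ext F a b c d z
      z∈Ext = (lin 3 (λ a b u → a :≤ b ⇒ u :≡ b :+ # 1 ⇒ ⊢ a :- # 1 :≤ u) a b (U z) a≤b uz , ℤₚ.≤-reflexive uz)
            , ( lin 3 (λ c v w → c :≤ v ⇒ w :≡ v :- # 1 ⇒ ⊢ c :- # 1 :≤ w) c (V r) (V z) c≤ vz
              , lin 3 (λ d v w → v :≤ d ⇒ w :≡ v :- # 1 ⇒ ⊢ w :≤ d :+ # 1) d (V r) (V z) ≤d vz)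
      back : mv true true z ≡ r
      back = UV-injective
        (lin 3 (λ u w t → w :≡ u :- # 1 ⇒ t :≡ w :+ # 1 ⇒
            ⊢ t :≡ u) (U r) (U z) (U (mv true true z)) (U-mv false false r) (U-mv true true z))
        (lin 3 (λ u w t → w :≡ u :- # 1 ⇒ t :≡ w :+ # 1 ⇒
            ⊢ t :≡ u) (V r) (V z) (V (mv true true z)) vz (V-mv true true z))
    ... | no c≰r-1 with V r + 1ℤ ℤ.≤? d
    ...   | no r≮d = row
            (lin 3 (λ c d v → v :- # 1 :+ # 1 :≤ c ⇒ d :+ # 1 :≤ v :+ # 1 ⇒
                ⊢ d :≤ c) c d (V r) (≰⇒+1≤ c≰r-1) (≰⇒+1≤ r≮d))
            (lin 2 (λ c v → v :- # 1 :+ # 1 :≤ c ⇒ c :≤ v ⇒ ⊢ v :≡ c) c (V r) (≰⇒+1≤ c≰r-1) c≤)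
    ...   | yes r<d = beside-side-absurd false (side z∈Ext uz) uz
            (lin 3 (λ c v w → c :≤ v ⇒ w :≡ v :+ # 1 ⇒ ⊢ c :≤ w) c (V r) (V z) c≤ vz)
            (subst (_≤ d) (sym vz) r<d)
            (subst (_∈ A) (sym back) r∈)
      where
      z = mv false true r
      uz : U z ≡ b + 1ℤ
      uz = lin 3 (λ b u w → u :≡ b :+ # 2 ⇒ w :≡ u :- # 1 ⇒ ⊢ w :≡ b :+ # 1) b (U r) (U z) ur (U-mv false true r)
      vz : V z ≡ V r + 1ℤ
      vz = V-mv false true r
      z∈Ext : Ext F a b c d z
      z∈Ext = (lin 3 (λ a b u → a :≤ b ⇒ u :≡ b :+ # 1 ⇒ ⊢ a :- # 1 :≤ u) a b (U z) a≤b uz , ℤₚ.≤-reflexive uz)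
            , ( lin 3 (λ c v w → c :≤ v ⇒ w :≡ v :+ # 1 ⇒ ⊢ c :- # 1 :≤ w) c (V r) (V z) c≤ vz
              , lin 3 (λ d v w → v :≤ d ⇒ w :≡ v :+ # 1 ⇒ ⊢ w :≤ d :+ # 1) d (V r) (V z) ≤d vz)
      back : mv true false z ≡ r
      back = UV-injective
        (lin 3 (λ u w t → w :≡ u :- # 1 ⇒ t :≡ w :+ # 1 ⇒
            ⊢ t :≡ u) (U r) (U z) (U (mv true false z)) (U-mv false true r) (U-mv true false z))
        (lin 3 (λ u w t → w :≡ u :+ # 1 ⇒ t :≡ w :- # 1 ⇒
            ⊢ t :≡ u) (V r) (V z) (V (mv true false z)) vz (V-mv true false z))

-- Moving a separated box closer to the rest of the set

translate : Pt → Pt → Pt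
translate (s , t) (x , y) = x + s , y + t

neighbours-translate : ∀ t {p q} → q ∈ neighbours p → translate t q ∈ neighbours (translate t p)
neighbours-translate (s , t) {x , y} (here refl) =
  here (cong (_, y + t) (lin 2 (λ x s → ⊢ x :+ # 1 :+ s :≡ x :+ s :+ # 1) x s))
neighbours-translate (s , t) {x , y} (there (here refl)) =
  there (here (cong (_, y + t) (lin 2 (λ x s → ⊢ x :- # 1 :+ s :≡ x :+ s :- # 1) x s)))
neighbours-translate (s , t) {x , y} (there (there (here refl))) =
  there (there (here (cong (x + s ,_) (lin 2 (λ x s → ⊢ x :+ # 1 :+ s :≡ x :+ s :+ # 1) y t))))
neighbours-translate (s , t) {x , y} (there (there (there (here refl)))) =
  there (there (there (here (cong (x + s ,_) (lin 2 (λ x s → ⊢ x :- # 1 :+ s :≡ x :+ s :- # 1) y t)))))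

translate-inverse : ∀ s t p → translate (- s , - t) (translate (s , t) p) ≡ p
translate-inverse s t (x , y) = cong₂ _,_ (cancel x s) (cancel y t)
  where
  cancel : ∀ x s → (x + s) + - s ≡ x
  cancel = lin 2 λ x s → ⊢ x :+ s :+ :- s :≡ x

translate-inverse′ : ∀ s t p → translate (s , t) (translate (- s , - t) p) ≡ p
translate-inverse′ s t (x , y) = cong₂ _,_ (cancel x s) (cancel y t)
  where
  cancel : ∀ x s → (x + - s) + s ≡ x
  cancel = lin 2 λ x s → ⊢ x :+ :- s :+ s :≡ x

Cl-map : ∀ (f : Pt → Pt) → (∀ {p q} → q ∈ neighbours p → f q ∈ neighbours (f p)) →
  ∀ {B z} → Cl B z → Cl (map f B) (f z)
Cl-map f pres (inj₁ z∈) = inj₁ (∈-map⁺ f z∈)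
Cl-map f pres (inj₂ (q , q∈ , z∈)) = inj₂ (f q , ∈-map⁺ f q∈ , pres z∈)

module Replace (A : FinSet) {P : Pt → Set} (P? : Decidable P) (s t : ℤ) where

  B R B′ : List Pt
  B = filter P? (elems A)
  R = filter (λ p → ¬? (P? p)) (elems A)
  B′ = map (translate (s , t)) B

  ∈B⁺ : ∀ {p} → p ∈ₛ A → P p → p ∈ B
  ∈B⁺ = ∈-filter⁺ P?

  ∈B⁻ : ∀ {p} → p ∈ B → p ∈ₛ A × P p
  ∈B⁻ = ∈-filter⁻ P?

  ∈R⁺ : ∀ {p} → p ∈ₛ A → ¬ P p → p ∈ R
  ∈R⁺ = ∈-filter⁺ (λ p → ¬? (P? p))

  ∈R⁻ : ∀ {p} → p ∈ R → p ∈ₛ A × ¬ P p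
  ∈R⁻ = ∈-filter⁻ (λ p → ¬? (P? p))

  private
    back : Pt → Pt
    back = translate (- s , - t)

    translate-injective : ∀ {p q} → translate (s , t) p ≡ translate (s , t) q → p ≡ q
    translate-injective {p} {q} eq =
      trans (sym (translate-inverse s t p)) (trans (cong back eq) (translate-inverse s t q))

    back-injective : ∀ {p q} → back p ≡ back q → p ≡ q
    back-injective {p} {q} eq =
      trans (sym (translate-inverse′ s t p)) (trans (cong (translate (s , t)) eq) (translate-inverse′ s t q))

    uniqueB = Uniqueₚ.filter⁺ P? (proj₂ A)
    uniqueR = Uniqueₚ.filter⁺ (λ p → ¬? (P? p)) (proj₂ A)

  Cl-B′⁺ : ∀ {z} → Cl B (back z) → Cl B′ z
  Cl-B′⁺ {z} h = subst (Cl B′) (translate-inverse′ s t z)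
    (Cl-map (translate (s , t)) (neighbours-translate (s , t)) h)

  Cl-B′⁻ : ∀ {z} → Cl B′ z → Cl B (back z)
  Cl-B′⁻ {z} (inj₁ z∈) with ∈-map⁻ (translate (s , t)) z∈
  ... | p , p∈ , refl = inj₁ (subst (_∈ B) (sym (translate-inverse s t p)) p∈)
  Cl-B′⁻ {z} (inj₂ (q , q∈ , z∈)) with ∈-map⁻ (translate (s , t)) q∈
  ... | p , p∈ , refl = inj₂ (p , p∈ ,
        subst (back z ∈_) (cong neighbours (translate-inverse s t p)) (neighbours-translate (- s , - t) z∈))

  -- The closed neighbourhood of a union is that of the moved piece together with the part of the
  -- closed neighbourhood of `R` outside it. Translation preserves the first. If the overlap keeps
  -- its old points and gains `w`, the second part strictly shrinks, while the number of points of
  -- the set is unchanged.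
  replace : (∀ {p} → p ∈ B → translate (s , t) p ∉ R) → (∀ {z} → Cl R z → Cl B z → Cl B′ z) →
    ∀ {w} → Cl R w → Cl B′ w → ¬ Cl B w → ∃[ C ] (size C ≡ size A × bsize C ℕ.< bsize A)
  replace disjoint common {w} wR wB′ w∉B = C , size-C , ℕₚ.+-cancelˡ-< (size A) _ _ (begin-strict
      size A ℕ.+ bsize C           ≡⟨ cong (ℕ._+ bsize C) size-C ⟨
      size C ℕ.+ bsize C           ≡⟨ cl-length C ⟨
      length (cl (elems C))        ≤⟨ unique-⊆⇒length≤ (cl-unique (elems C)) cl-C ⟩
      length (cl B′ ++ D′)         ≡⟨ Listₚ.length-++ (cl B′) ⟩
      length (cl B′) ℕ.+ length D′ ≤⟨ ℕₚ.+-monoˡ-≤ (length D′)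
                                        (injection⇒length≤ back back-injective (cl-unique B′)
                                          (λ h → ∈-cl⁺ (Cl-B′⁻ (∈-cl⁻ h)))) ⟩
      length (cl B) ℕ.+ length D′  <⟨ ℕₚ.+-monoʳ-< (length (cl B)) D′<D ⟩
      length (cl B) ℕ.+ length D   ≡⟨ Listₚ.length-++ (cl B) ⟨
      length (cl B ++ D)           ≤⟨ unique-⊆⇒length≤ uniqueBD cl-A ⟩
      length (cl (elems A))        ≡⟨ cl-length A ⟩
      size A ℕ.+ bsize A           ∎)
    where
    open ℕₚ.≤-Reasoning
    C : FinSet
    C = R ++ B′ , Uniqueₚ.++⁺ uniqueR (Uniqueₚ.map⁺ translate-injective uniqueB) disj
      where
      disj : ∀ {p} → ¬ (p ∈ R × p ∈ B′)
      disj (p∈R , p∈B′) with ∈-map⁻ (translate (s , t)) p∈B′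
      ... | q , q∈ , refl = disjoint q∈ p∈R
    size-C : size C ≡ size A
    size-C = begin-equality
      length (R ++ B′)           ≡⟨ Listₚ.length-++ R ⟩
      length R ℕ.+ length B′     ≡⟨ cong (length R ℕ.+_) (Listₚ.length-map (translate (s , t)) B) ⟩
      length R ℕ.+ length B      ≡⟨ Listₚ.length-++ R ⟨
      length (R ++ B)            ≡⟨ unique-≈⇒length≡ (Uniqueₚ.++⁺ uniqueR uniqueB
                                      λ (h , h′) → proj₂ (∈R⁻ h) (proj₂ (∈B⁻ h′))) (proj₂ A) sub sup ⟩
      size A                     ∎
      where
      sub : R ++ B ⊆ elems A
      sub h with ∈-++⁻ R h
      ... | inj₁ h′ = proj₁ (∈R⁻ h′)
      ... | inj₂ h′ = proj₁ (∈B⁻ h′)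
      sup : elems A ⊆ R ++ B
      sup {p} p∈ with P? p
      ... | yes h = ∈-++⁺ʳ R (∈B⁺ p∈ h)
      ... | no h = ∈-++⁺ˡ (∈R⁺ p∈ h)
    out = λ X z → ¬? (Cl? X z)
    D D′ : List Pt
    D = filter (out B) (cl R)
    D′ = filter (out B′) (cl R)
    cl-C : cl (elems C) ⊆ cl B′ ++ D′
    cl-C {z} z∈ with Cl? B′ z
    ... | yes h = ∈-++⁺ˡ (∈-cl⁺ h)
    ... | no h = ∈-++⁺ʳ (cl B′) (∈-filter⁺ (out B′) (∈-cl⁺ (rest (∈-cl⁻ z∈))) h)
      where
      rest : Cl (R ++ B′) z → Cl R z
      rest (inj₁ z∈) with ∈-++⁻ R z∈
      ... | inj₁ z∈R = inj₁ z∈R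
      ... | inj₂ z∈B′ = ⊥-elim (h (inj₁ z∈B′))
      rest (inj₂ (q , q∈ , n)) with ∈-++⁻ R q∈
      ... | inj₁ q∈R = inj₂ (q , q∈R , n)
      ... | inj₂ q∈B′ = ⊥-elim (h (inj₂ (q , q∈B′ , n)))
    uniqueBD : Unique (cl B ++ D)
    uniqueBD = Uniqueₚ.++⁺ (cl-unique B) (Uniqueₚ.filter⁺ (out B) (cl-unique R))
      λ (h , h′) → proj₂ (∈-filter⁻ (out B) {xs = cl R} h′) (∈-cl⁻ h)
    cl-A : cl B ++ D ⊆ cl (elems A)
    cl-A h with ∈-++⁻ (cl B) h
    ... | inj₁ h′ = ∈-cl⁺ (Cl-mono (λ p∈ → proj₁ (∈B⁻ p∈)) (∈-cl⁻ h′))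
    ... | inj₂ h′ = ∈-cl⁺ (Cl-mono (λ p∈ → proj₁ (∈R⁻ p∈)) (∈-cl⁻ (proj₁ (∈-filter⁻ (out B) h′))))
    D′<D : length D′ ℕ.< length D
    D′<D = unique-⊂⇒length< (Uniqueₚ.filter⁺ (out B′) (cl-unique R)) sub
      (∈-filter⁺ (out B) (∈-cl⁺ wR) w∉B) (λ h → proj₂ (∈-filter⁻ (out B′) {xs = cl R} h) wB′)
      where
      sub : D′ ⊆ D
      sub {z} h with ∈-filter⁻ (out B′) {xs = cl R} h
      ... | z∈ , z∉ = ∈-filter⁺ (out B) z∈ λ zB → z∉ (common (∈-cl⁻ z∈) zB)

Ext-intro : ∀ F {a b c d L} → (∀ {p} → p ∈ L → InF F a b c d p) → ∀ {z} → Cl L z → Ext F a b c d z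
Ext-intro F {a} {b} {c} {d} inbox {z} (inj₁ z∈) =
  let (h₁ , h₂) , (h₃ , h₄) = inbox z∈ in
  ( ≤⇒-1≤ h₁ , ≤⇒≤+1 h₂) ,
  ( ≤⇒-1≤ h₃ , ≤⇒≤+1 h₄)
  where open Frame F
Ext-intro F {a} {b} {c} {d} inbox {z} (inj₂ (q , q∈ , n)) with Frame.neighbour-mv F n
... | e , f , refl = let (h₁ , h₂) , (h₃ , h₄) = inbox q∈ in
  step e (U-mv e f q) h₁ h₂ , step f (V-mv e f q) h₃ h₄
  where
  open Frame F
  step : ∀ e {a b u w} → w ≡ u + sg e → a ≤ u → u ≤ b → a - 1ℤ ≤ w × w ≤ b + 1ℤ
  step true {a} {b} {u} {w} eq lo hi =
    lin 3 (λ a u w → w :≡ u :+ # 1 ⇒ a :≤ u ⇒ ⊢ a :- # 1 :≤ w) a u w eq lo ,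
    lin 3 (λ b u w → w :≡ u :+ # 1 ⇒ u :≤ b ⇒ ⊢ w :≤ b :+ # 1) b u w eq hi
  step false {a} {b} {u} {w} eq lo hi =
    lin 3 (λ a u w → w :≡ u :- # 1 ⇒ a :≤ u ⇒ ⊢ a :- # 1 :≤ w) a u w eq lo ,
    lin 3 (λ b u w → w :≡ u :- # 1 ⇒ u :≤ b ⇒ ⊢ w :≤ b :+ # 1) b u w eq hi

TightBox : FinSet → Set
TightBox A = ∃[ a ] ∃[ b ] ∃[ c ] ∃[ d ]
  ((a ≤ b × c ≤ d) × Tight standard a b c d × (∀ p → p ∈ₛ A ⇔ InBox a b c d p))

Improvement : FinSet → Set
Improvement A = ∃[ C ] (size C ≡ size A × bsize C ℕ.< bsize A)

module Separate (A : FinSet) (stuck : Stuck (elems A)) {a b c d : ℤ}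
  (g : Growth.Good (elems A) stuck standard a b c d)
  (rightmost : ∀ {p} → p ∈ₛ A → Frame.U standard p ≤ b)
  (closed : ∀ {p} → p ∈ₛ A → ¬ InF standard a b c d p → ¬ Closure.Attached (elems A) stuck standard g p) where

  open Frame standard
  open Growth (elems A) stuck
  open Closure (elems A) stuck
  open Good g

  Box : Pt → Set
  Box = InF standard a b c d

  Ext∩A⊆Box : ∀ {p} → p ∈ₛ A → Ext standard a b c d p → Box p
  Ext∩A⊆Box {p} p∈ ext = decidable-stable (InF? standard a b c d p) λ out → closed p∈ out (inj₁ ext)

  left-column : ∀ {z} → Ext standard a b c d z → - U z ≡ - a + 1ℤ → z ∉ elems A
  left-column {z} ext uz z∈ = let (a≤ , _) , _ = Ext∩A⊆Box z∈ ext in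
    lin 2 (λ a u → :- u :≡ :- a :+ # 1 ⇒ a :≤ u ⇒ ⊢⊥) a (U z) uz a≤

  top-row : ∀ {z} → Ext standard a b c d z → V z ≡ d + 1ℤ → z ∉ elems A
  top-row {z} ext vz z∈ = let _ , (_ , ≤d) = Ext∩A⊆Box z∈ ext in
    lin 2 (λ d v → v :≡ d :+ # 1 ⇒ v :≤ d ⇒ ⊢⊥) d (V z) vz ≤d

  bottom-row : ∀ {z} → Ext standard a b c d z → - V z ≡ - c + 1ℤ → z ∉ elems A
  bottom-row {z} ext vz z∈ = let _ , (c≤ , _) = Ext∩A⊆Box z∈ ext in
    lin 2 (λ c v → :- v :≡ :- c :+ # 1 ⇒ c :≤ v ⇒ ⊢⊥) c (V z) vz c≤

  beyond-left : ∀ {r} → - U r ≡ - a + + 2 → c ≤ V r → V r ≤ d → r ∉ elems A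
  beyond-left {r} ur c≤ ≤d r∈ = beyond-side-absurd (flip standard) (flip-Good {standard} g)
    (λ {z} ext → left-column {z} (flip-Ext⁻ {standard} a b c d {z} ext))
    (λ d≤c vr → closed r∈
      (λ ((a≤ , _) , _) → lin 2 (λ a u → :- u :≡ :- a :+ # 2 ⇒ a :≤ u ⇒ ⊢⊥) a (U r) ur a≤)
      (inj₂ (inj₁ (d≤c , vr , inj₂ ur))))
    ur c≤ ≤d r∈

  beyond-top : ∀ {r} → V r ≡ d + + 2 → a ≤ U r → U r ≤ b → r ∉ elems A
  beyond-top {r} vr a≤ ≤b r∈ = beyond-side-absurd (swap standard) (swap-Good {standard} g)
    (λ {z} (h , h′) → top-row {z} (h′ , h))
    (λ b≤a ur → closed r∈
      (λ (_ , (_ , ≤d)) → lin 2 (λ d v → v :≡ d :+ # 2 ⇒ v :≤ d ⇒ ⊢⊥) d (V r) vr ≤d)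
      (inj₂ (inj₂ (b≤a , ur , inj₁ vr))))
    vr a≤ ≤b r∈

  beyond-bottom : ∀ {r} → - V r ≡ - c + + 2 → a ≤ U r → U r ≤ b → r ∉ elems A
  beyond-bottom {r} vr a≤ ≤b r∈ =
    beyond-side-absurd (flip (swap standard)) (flip-Good {swap standard} (swap-Good {standard} g))
    (λ {z} ext → let h , h′ = flip-Ext⁻ {swap standard} c d a b {z} ext in bottom-row {z} (h′ , h))
    (λ b≤a ur → closed r∈
      (λ (_ , (c≤ , _)) → lin 2 (λ c v → :- v :≡ :- c :+ # 2 ⇒ c :≤ v ⇒ ⊢⊥) c (V r) vr c≤)
      (inj₂ (inj₂ (b≤a , ur , inj₂ vr))))
    vr a≤ ≤b r∈

  -- The two lattice points at which the rest of A can touch the closed neighbourhood of the box.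
  LeftCorner : Pt → Set
  LeftCorner r = U r ≡ a - + 2 × (V r ≡ d + + 2 ⊎ V r ≡ c - + 2)

  -- `r` is adjacent to the enlarged box but not in it, so it is two beyond some side, and not the
  -- right one since nothing of `A` lies further right than the box. If it is two beyond only one of
  -- the left, top and bottom sides, `beside-side-absurd` or the corresponding lemma among
  -- `beyond-left`, `beyond-top` and `beyond-bottom` excludes it. What remains is two beyond the
  -- left side and another side at once.
  touching-point : ∀ {z r} → Ext standard a b c d z → r ∈ₛ A → ¬ Box r → r ∈ neighbours z → LeftCorner r
  touching-point {z} {r} ext@((a≤z , z≤b) , (c≤z , z≤d)) r∈ r∉ n with neighbour-mv {z} n
  ... | e , f , eq = go e f eq (trans (cong U eq) (U-mv e f z)) (trans (cong V eq) (V-mv e f z))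
    where
    r∉Ext : ¬ Ext standard a b c d r
    r∉Ext h = r∉ (Ext∩A⊆Box r∈ h)
    z∉A : z ∉ elems A
    z∉A z∈ = r∉Ext (Ext-intro standard {L = z ∷ []} (λ { (here refl) → Ext∩A⊆Box z∈ ext })
      (inj₂ (z , here refl , n)))
    go : ∀ e f → r ≡ mv e f z → U r ≡ U z + sg e → V r ≡ V z + sg f → LeftCorner r
    go true true eq ur vr with V r ℤ.≤? d + 1ℤ
    ...   | yes r≤d = ⊥-elim (r∉Ext
            ( ( lin 3 (λ a u w → w :≡ u :+ # 1 ⇒ a :- # 1 :≤ u ⇒ ⊢ a :- # 1 :≤ w) a (U z) (U r) ur a≤z
              , ≤⇒≤+1 (rightmost r∈))
            , ( lin 3 (λ a u w → w :≡ u :+ # 1 ⇒ a :- # 1 :≤ u ⇒ ⊢ a :- # 1 :≤ w) c (V z) (V r) vr c≤z , r≤d)))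
    ...   | no r≰d = ⊥-elim (beyond-top
            (lin 3 (λ d v w → w :≡ v :+ # 1 ⇒ v :≤ d :+ # 1 ⇒ d :+ # 1 :+ # 1 :≤ w ⇒
                ⊢ w :≡ d :+ # 2) d (V z) (V r) vr z≤d (≰⇒+1≤ r≰d))
            (lin 3 (λ a u w → w :≡ u :+ # 1 ⇒ a :- # 1 :≤ u ⇒ ⊢ a :≤ w) a (U z) (U r) ur a≤z)
            (rightmost r∈) r∈)
    go true false eq ur vr with c - 1ℤ ℤ.≤? V r
    ...   | yes c≤r = ⊥-elim (r∉Ext
            ( ( lin 3 (λ a u w → w :≡ u :+ # 1 ⇒ a :- # 1 :≤ u ⇒ ⊢ a :- # 1 :≤ w) a (U z) (U r) ur a≤z
              , ≤⇒≤+1 (rightmost r∈))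
            , ( c≤r , lin 3 (λ d v w → w :≡ v :- # 1 ⇒ v :≤ d :+ # 1 ⇒ ⊢ w :≤ d :+ # 1) d (V z) (V r) vr z≤d)))
    ...   | no c≰r = ⊥-elim (beyond-bottom
            (lin 3 (λ c v w → w :≡ v :- # 1 ⇒ c :- # 1 :≤ v ⇒ w :+ # 1 :≤ c :- # 1 ⇒
                ⊢ :- w :≡ :- c :+ # 2) c (V z) (V r) vr c≤z (≰⇒+1≤ c≰r))
            (lin 3 (λ a u w → w :≡ u :+ # 1 ⇒ a :- # 1 :≤ u ⇒ ⊢ a :≤ w) a (U z) (U r) ur a≤z)
            (rightmost r∈) r∈)
    go false true eq ur vr with V r ℤ.≤? d + 1ℤ | a ℤ.≤? U z
    ...   | no r≰d | yes a≤z′ with lin 3 (λ d v w → w :≡ v :+ # 1 ⇒ v :≤ d :+ # 1 ⇒ d :+ # 1 :+ # 1 :≤ w ⇒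
        ⊢ v :≡ d :+ # 1) d (V z) (V r) vr z≤d (≰⇒+1≤ r≰d)
    ...     | vz with ≤⇒≤⊎≡ z≤b
    ...       | inj₁ z≤b′ = ⊥-elim (beside-side-absurd (swap standard)
        (swap-Good {standard} g) false z∉A vz a≤z′ z≤b′ (subst (_∈ elems A) eq r∈))
    ...       | inj₂ uz = ⊥-elim (beyond-top
                (lin 3 (λ d v w → w :≡ v :+ # 1 ⇒ v :≡ d :+ # 1 ⇒ ⊢ w :≡ d :+ # 2) d (V z) (V r) vr vz)
                (lin 4 (λ a b u w → a :≤ b ⇒ w :≡ u :- # 1 ⇒ u :≡ b :+ # 1 ⇒ ⊢ a :≤ w) a b (U z) (U r) a≤b ur uz)
                (rightmost r∈) r∈)
    go false true eq ur vr | no r≰d | no a≰z =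
      lin 3 (λ a u w → w :≡ u :- # 1 ⇒ a :- # 1 :≤ u ⇒ u :+ # 1 :≤ a ⇒
          ⊢ w :≡ a :- # 2) a (U z) (U r) ur a≤z (≰⇒+1≤ a≰z) ,
      inj₁ (lin 3 (λ d v w → w :≡ v :+ # 1 ⇒ v :≤ d :+ # 1 ⇒ d :+ # 1 :+ # 1 :≤ w ⇒
          ⊢ w :≡ d :+ # 2) d (V z) (V r) vr z≤d (≰⇒+1≤ r≰d))
    go false true eq ur vr | yes r≤d | yes a≤z′ = ⊥-elim (r∉Ext
            ( ( lin 3 (λ a u w → w :≡ u :- # 1 ⇒ a :≤ u ⇒ ⊢ a :- # 1 :≤ w) a (U z) (U r) ur a≤z′
              , ≤⇒≤+1 (rightmost r∈))
            , ( lin 3 (λ a u w → w :≡ u :+ # 1 ⇒ a :- # 1 :≤ u ⇒ ⊢ a :- # 1 :≤ w) c (V z) (V r) vr c≤z , r≤d)))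
    go false true eq ur vr | yes r≤d | no a≰z with c ℤ.≤? V z
    ...   | yes c≤z′ = ⊥-elim (beside-side-absurd (flip standard) (flip-Good {standard} g) true z∉A
              (lin 2 (λ a u → a :- # 1 :≤ u ⇒ u :+ # 1 :≤ a ⇒ ⊢ :- u :≡ :- a :+ # 1) a (U z) a≤z (≰⇒+1≤ a≰z))
              c≤z′ (lin 3 (λ d v w → w :≡ v :+ # 1 ⇒ w :≤ d :+ # 1 ⇒ ⊢ v :≤ d) d (V z) (V r) vr r≤d)
                  (subst (_∈ elems A) eq r∈))
    ...   | no c≰z = ⊥-elim (beyond-left
              (lin 3 (λ a u w → w :≡ u :- # 1 ⇒ a :- # 1 :≤ u ⇒ u :+ # 1 :≤ a ⇒
                  ⊢ :- w :≡ :- a :+ # 2) a (U z) (U r) ur a≤z (≰⇒+1≤ a≰z))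
              (lin 3 (λ c v w → w :≡ v :+ # 1 ⇒ c :- # 1 :≤ v ⇒ ⊢ c :≤ w) c (V z) (V r) vr c≤z)
              (lin 4 (λ c d v w → c :≤ d ⇒ w :≡ v :+ # 1 ⇒ v :+ # 1 :≤ c ⇒
                  ⊢ w :≤ d) c d (V z) (V r) c≤d vr (≰⇒+1≤ c≰z)) r∈)
    go false false eq ur vr with c - 1ℤ ℤ.≤? V r | a ℤ.≤? U z
    ...   | no c≰r | yes a≤z′ with lin 3 (λ c v w → w :≡ v :- # 1 ⇒ c :- # 1 :≤ v ⇒ w :+ # 1 :≤ c :- # 1 ⇒
        ⊢ :- v :≡ :- c :+ # 1) c (V z) (V r) vr c≤z (≰⇒+1≤ c≰r)
    ...     | vz with ≤⇒≤⊎≡ z≤b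
    ...       | inj₁ z≤b′ = ⊥-elim (beside-side-absurd (flip (swap standard)) (flip-Good {swap standard}
        (swap-Good {standard} g)) false z∉A vz a≤z′ z≤b′ (subst (_∈ elems A) eq r∈))
    ...       | inj₂ uz = ⊥-elim (beyond-bottom
                (lin 3 (λ c v w → w :≡ v :- # 1 ⇒ :- v :≡ :- c :+ # 1 ⇒ ⊢ :- w :≡ :- c :+ # 2) c (V z) (V r) vr vz)
                (lin 4 (λ a b u w → a :≤ b ⇒ w :≡ u :- # 1 ⇒ u :≡ b :+ # 1 ⇒ ⊢ a :≤ w) a b (U z) (U r) a≤b ur uz)
                (rightmost r∈) r∈)
    go false false eq ur vr | no c≰r | no a≰z =
      lin 3 (λ a u w → w :≡ u :- # 1 ⇒ a :- # 1 :≤ u ⇒ u :+ # 1 :≤ a ⇒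
          ⊢ w :≡ a :- # 2) a (U z) (U r) ur a≤z (≰⇒+1≤ a≰z) ,
      inj₂ (lin 3 (λ c v w → w :≡ v :- # 1 ⇒ c :- # 1 :≤ v ⇒ w :+ # 1 :≤ c :- # 1 ⇒
          ⊢ w :≡ c :- # 2) c (V z) (V r) vr c≤z (≰⇒+1≤ c≰r))
    go false false eq ur vr | yes c≤r | yes a≤z′ = ⊥-elim (r∉Ext
            ( ( lin 3 (λ a u w → w :≡ u :- # 1 ⇒ a :≤ u ⇒ ⊢ a :- # 1 :≤ w) a (U z) (U r) ur a≤z′
              , ≤⇒≤+1 (rightmost r∈))
            , ( c≤r , lin 3 (λ d v w → w :≡ v :- # 1 ⇒ v :≤ d :+ # 1 ⇒ ⊢ w :≤ d :+ # 1) d (V z) (V r) vr z≤d)))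
    go false false eq ur vr | yes c≤r | no a≰z with V z ℤ.≤? d
    ...   | yes z≤d′ = ⊥-elim (beside-side-absurd (flip standard) (flip-Good {standard} g) false z∉A
              (lin 2 (λ a u → a :- # 1 :≤ u ⇒ u :+ # 1 :≤ a ⇒ ⊢ :- u :≡ :- a :+ # 1) a (U z) a≤z (≰⇒+1≤ a≰z))
              (lin 3 (λ c v w → w :≡ v :- # 1 ⇒ c :- # 1 :≤ w ⇒ ⊢ c :≤ v) c (V z) (V r) vr c≤r) z≤d′
                  (subst (_∈ elems A) eq r∈))
    ...   | no z≰d = ⊥-elim (beyond-left
              (lin 3 (λ a u w → w :≡ u :- # 1 ⇒ a :- # 1 :≤ u ⇒ u :+ # 1 :≤ a ⇒
                  ⊢ :- w :≡ :- a :+ # 2) a (U z) (U r) ur a≤z (≰⇒+1≤ a≰z))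
              (lin 4 (λ c d v w → c :≤ d ⇒ w :≡ v :- # 1 ⇒ d :+ # 1 :≤ v ⇒
                  ⊢ c :≤ w) c d (V z) (V r) c≤d vr (≰⇒+1≤ z≰d))
              (lin 3 (λ d v w → w :≡ v :- # 1 ⇒ v :≤ d :+ # 1 ⇒ ⊢ w :≤ d) d (V z) (V r) vr z≤d) r∈)

module Improve (A : FinSet) (stuck : Stuck (elems A)) {a b c d : ℤ}
  (g : Growth.Good (elems A) stuck standard a b c d)
  (rightmost : ∀ {p} → p ∈ₛ A → Frame.U standard p ≤ b)
  (closed : ∀ {p} → p ∈ₛ A → ¬ InF standard a b c d p → ¬ Closure.Attached (elems A) stuck standard g p) where

  open Frame standard
  open Growth.Good g
  open Separate A stuck g rightmost closed

  Box? : Decidable Box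
  Box? = InF? standard a b c d

  Cl-rest⇒touching : ∀ {z} → Ext standard a b c d z → Cl (filter (λ p → ¬? (Box? p)) (elems A)) z →
    ∃[ r ] (r ∈ₛ A × ¬ Box r × z ∈ neighbours r × LeftCorner r)
  Cl-rest⇒touching {z} ext (inj₁ z∈) with ∈-filter⁻ (λ p → ¬? (Box? p)) z∈
  ... | z∈A , z∉ = ⊥-elim (z∉ (Ext∩A⊆Box z∈A ext))
  Cl-rest⇒touching {z} ext (inj₂ (r , r∈ , n)) with ∈-filter⁻ (λ p → ¬? (Box? p)) r∈
  ... | r∈A , r∉ = r , r∈A , r∉ , n , touching-point {z} {r} ext r∈A r∉ (neighbours-sym {r} {z} n)

  module Shift where
    -- The translation by (1, -1) lowers u by two and keeps v.
    open Replace A Box? 1ℤ (- 1ℤ)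

    Ext⇒Cl-B : ∀ {p} → Ext standard a b c d p → Cl B p
    Ext⇒Cl-B {p} ext with tight p ext
    ... | inj₁ h = inj₁ (∈B⁺ (inside h) h)
    ... | inj₂ (q , n , h) = inj₂ (q , ∈B⁺ (inside h) h , neighbours-sym {p} {q} n)

    Cl-B⇒Ext : ∀ {p} → Cl B p → Ext standard a b c d p
    Cl-B⇒Ext = Ext-intro standard (λ p∈ → proj₂ (∈B⁻ p∈))

    Ext-left⇒Cl-B′ : ∀ z → a - + 3 ≤ U z → U z ≤ b - 1ℤ → c - 1ℤ ≤ V z → V z ≤ d + 1ℤ → Cl B′ z
    Ext-left⇒Cl-B′ (x , y) h₁ h₂ h₃ h₄ = Cl-B′⁺ (Ext⇒Cl-B
      ( ( lin 3 (λ a x y → a :- # 3 :≤ y :- x ⇒ ⊢ a :- # 1 :≤ y :+ :- :- # 1 :- (x :+ :- # 1)) a x y h₁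
        , lin 3 (λ b x y → y :- x :≤ b :- # 1 ⇒ ⊢ y :+ :- :- # 1 :- (x :+ :- # 1) :≤ b :+ # 1) b x y h₂)
      , ( lin 3 (λ c x y → c :- # 1 :≤ y :+ x ⇒ ⊢ c :- # 1 :≤ y :+ :- :- # 1 :+ (x :+ :- # 1)) c x y h₃
        , lin 3 (λ d x y → y :+ x :≤ d :+ # 1 ⇒ ⊢ y :+ :- :- # 1 :+ (x :+ :- # 1) :≤ d :+ # 1) d x y h₄)))

    disjoint : ∀ {p} → p ∈ B → translate (1ℤ , - 1ℤ) p ∉ R
    disjoint {p@(x , y)} p∈ q∈ with ∈B⁻ p∈ | ∈R⁻ q∈
    ... | p∈A , (a≤ , ≤b) , (c≤ , ≤d) | q∈A , q∉ = cases (a ℤ.≤? U q) (a - 1ℤ ℤ.≤? U q)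
      where
      q = translate (1ℤ , - 1ℤ) p
      uq : U q ≡ U p - + 2
      uq = lin 2 (λ x y → ⊢ y :+ :- # 1 :- (x :+ # 1) :≡ y :- x :- # 2) x y
      vq : V q ≡ V p
      vq = lin 2 (λ x y → ⊢ y :+ :- # 1 :+ (x :+ # 1) :≡ y :+ x) x y
      c≤q : c ≤ V q
      c≤q = subst (c ≤_) (sym vq) c≤
      q≤d : V q ≤ d
      q≤d = subst (_≤ d) (sym vq) ≤d
      cases : Dec (a ≤ U q) → Dec (a - 1ℤ ≤ U q) → ⊥
      cases (yes h) _ = q∉ ((h , rightmost q∈A) , (c≤q , q≤d))
      cases (no _) (yes h) = q∉ (Ext∩A⊆Box q∈A
        ( (h , ≤⇒≤+1 (rightmost q∈A))
        , ( ≤⇒-1≤ c≤q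
          , ≤⇒≤+1 q≤d)))
      cases (no _) (no h) = beyond-left
        (lin 3 (λ a u w → w :≡ u :- # 2 ⇒ a :≤ u ⇒ w :+ # 1 :≤ a :- # 1 ⇒ ⊢ :- w :≡ :- a :+ # 2)
          a (U p) (U q) uq a≤ (≰⇒+1≤ h))
        c≤q q≤d q∈A

    -- Contacts occur only next to left corners, hence in columns up to `a - 1`; the shifted
    -- enlarged box still reaches to column `b - 1`.
    common : ∀ {z} → Cl R z → Cl B z → Cl B′ z
    common {z} zR zB with Cl-B⇒Ext zB
    ... | ext@((a≤ , _) , (c≤ , ≤d)) with Cl-rest⇒touching {z} ext zR
    ...   | r , _ , _ , n , (ur , _) with neighbour-mv {r} n
    ...     | e , f , refl = Ext-left⇒Cl-B′ z
      (lin 2 (λ a u → a :- # 1 :≤ u ⇒ ⊢ a :- # 3 :≤ u) a (U z) a≤) (left e (U-mv e f r)) c≤ ≤d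
      where
      left : ∀ e → U z ≡ U r + sg e → U z ≤ b - 1ℤ
      left true eq = lin 4 (λ a b r z → a :≤ b ⇒ r :≡ a :- # 2 ⇒ z :≡ r :+ # 1 ⇒
          ⊢ z :≤ b :- # 1) a b (U r) (U z) a≤b ur eq
      left false eq = lin 4 (λ a b r z → a :≤ b ⇒ r :≡ a :- # 2 ⇒ z :≡ r :- # 1 ⇒
          ⊢ z :≤ b :- # 1) a b (U r) (U z) a≤b ur eq

    -- The corner point `r` is in column `a - 2`. Its left neighbour `w` in row `d + 1` or `c - 1`
    -- is in column `a - 3`, which the enlarged box reaches only after the shift.
    shift : ∀ {r} → r ∈ₛ A → ¬ Box r → LeftCorner r → Improvement A
    shift {r} r∈ r∉ (ur , vr) = replace disjoint common
      (inj₂ (r , ∈R⁺ r∈ r∉ , mv-neighbour false f r))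
      (Ext-left⇒Cl-B′ w
        (lin 3 (λ a r w → r :≡ a :- # 2 ⇒ w :≡ r :- # 1 ⇒ ⊢ a :- # 3 :≤ w) a (U r) (U w) ur uw)
        (lin 4 (λ a b r w → a :≤ b ⇒ r :≡ a :- # 2 ⇒ w :≡ r :- # 1 ⇒ ⊢ w :≤ b :- # 1) a b (U r) (U w) a≤b ur uw)
        (proj₁ vw) (proj₂ vw))
      (λ wB → let (a≤ , _) , _ = Cl-B⇒Ext {w} wB in
        lin 3 (λ a r w → r :≡ a :- # 2 ⇒ w :≡ r :- # 1 ⇒ a :- # 1 :≤ w ⇒ ⊢⊥) a (U r) (U w) ur uw a≤)
      where
      toward : V r ≡ d + + 2 ⊎ V r ≡ c - + 2 → ∃[ f ] (c - 1ℤ ≤ V r + sg f × V r + sg f ≤ d + 1ℤ)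
      toward (inj₁ eq) = false ,
        lin 3 (λ c d v → c :≤ d ⇒ v :≡ d :+ # 2 ⇒ ⊢ c :- # 1 :≤ v :- # 1) c d (V r) c≤d eq ,
        lin 2 (λ d v → v :≡ d :+ # 2 ⇒ ⊢ v :- # 1 :≤ d :+ # 1) d (V r) eq
      toward (inj₂ eq) = true ,
        lin 2 (λ c v → v :≡ c :- # 2 ⇒ ⊢ c :- # 1 :≤ v :+ # 1) c (V r) eq ,
        lin 3 (λ c d v → c :≤ d ⇒ v :≡ c :- # 2 ⇒ ⊢ v :+ # 1 :≤ d :+ # 1) c d (V r) c≤d eq
      f = proj₁ (toward vr)
      w = mv false f r
      uw : U w ≡ U r - 1ℤ
      uw = U-mv false f r
      vw : c - 1ℤ ≤ V w × V w ≤ d + 1ℤ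
      vw = subst (λ v → c - 1ℤ ≤ v × v ≤ d + 1ℤ) (sym (V-mv false f r)) (proj₂ (toward vr))

  -- The translation carries the leftmost point `(x′ , y′)` of the box to `(x - 1 , y + 1)`, two
  -- columns to the right of the rightmost point `(x , y)` of the rest. The point `(x , y + 1)`
  -- between them becomes common to two closed neighbourhoods that were disjoint.
  module Place {x y x′ y′ : ℤ} (r∈ : (x , y) ∈ₛ A) (r∉ : ¬ Box (x , y)) (q∈ : (x′ , y′) ∈ₛ A) (q∈Box : Box (x′ , y′))
    (r-max : ∀ {p} → p ∈ₛ A → ¬ Box p → U p ≤ y - x) (q-min : ∀ {p} → p ∈ₛ A → Box p → y′ - x′ ≤ U p) where
    open Replace A Box? ((x - 1ℤ) - x′) ((y + 1ℤ) - y′)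

    place : (∀ {z} → Cl R z → ¬ Cl B z) → Improvement A
    place separated = replace disjoint (λ zR zB → ⊥-elim (separated zR zB)) {w} wR
      (inj₂ (q′ , ∈-map⁺ (translate _) (∈B⁺ q∈ q∈Box) , here w≡)) (separated wR)
      where
      q′ w : Pt
      q′ = translate ((x - 1ℤ) - x′ , (y + 1ℤ) - y′) (x′ , y′)
      w = x , y + 1ℤ
      wR : Cl R w
      wR = inj₂ ((x , y) , ∈R⁺ r∈ r∉ , there (there (here refl)))
      w≡ : w ≡ (proj₁ q′ + 1ℤ , proj₂ q′)
      w≡ = cong₂ _,_ (lin 2 (λ x x′ → ⊢ x :≡ x′ :+ (x :- # 1 :- x′) :+ # 1) x x′)
                     (lin 2 (λ y y′ → ⊢ y :+ # 1 :≡ y′ :+ (y :+ # 1 :- y′)) y y′)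
      disjoint : ∀ {p} → p ∈ B → translate ((x - 1ℤ) - x′ , (y + 1ℤ) - y′) p ∉ R
      disjoint {p@(u , v)} p∈ p′∈ with ∈B⁻ p∈ | ∈R⁻ p′∈
      ... | p∈A , p∈Box | p′∈A , p′∉ =
        lin 6 (λ x y x′ y′ u v → y′ :- x′ :≤ v :- u ⇒
                 v :+ (y :+ # 1 :- y′) :- (u :+ (x :- # 1 :- x′)) :≤ y :- x ⇒ ⊢⊥)
          x y x′ y′ u v (q-min p∈A p∈Box) (r-max p′∈A p′∉)

  improve : ∀ {q r} → q ∈ₛ A → Box q → r ∈ₛ A → ¬ Box r → Improvement A
  improve {q} {r} q∈ q∈Box r∈ r∉ with any? (Cl? B) (cl R)
    -- `B` and `R` do not depend on the translation, so any instance will do.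
    where open Replace A Box? 0ℤ 0ℤ
  ... | yes touch with find touch
  ...   | z , zR , zB with Cl-rest⇒touching {z} (Shift.Cl-B⇒Ext zB) (∈-cl⁻ zR)
  ...     | s , s∈ , s∉ , _ , corner = Shift.shift s∈ s∉ corner
  improve {q} {r} q∈ q∈Box r∈ r∉ | no separated
    with maximum U (Replace.∈R⁺ A Box? 0ℤ 0ℤ r∈ r∉) | maximum (λ p → - U p) (Replace.∈B⁺ A Box? 0ℤ 0ℤ q∈ q∈Box)
  ... | (x , y) , r₀∈ , r₀-max | (x′ , y′) , q₀∈ , q₀-min =
    Place.place (proj₁ (∈R⁻ r₀∈)) (proj₂ (∈R⁻ r₀∈)) (proj₁ (∈B⁻ q₀∈)) (proj₂ (∈B⁻ q₀∈))
      (λ p∈ p∉ → r₀-max (∈R⁺ p∈ p∉)) (λ p∈ p∈Box → ℤₚ.neg-cancel-≤ (q₀-min (∈B⁺ p∈ p∈Box)))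
      (λ zR zB → separated (lose (∈-cl⁺ zR) zB))
    where open Replace A Box? 0ℤ 0ℤ

-- Every finite nonempty set is dominated by a box

Extension : FinSet → Set
Extension A = ∃[ p ] Σ (p ∉ elems A) λ p∉ → bsize (insert A p∉) ℕ.≤ bsize A

-- The search is finite: a point that violates stuckness is a boundary point, and its gain `q` may
-- be sought among its neighbours.
stuck-or-extension : ∀ A → Stuck (elems A) ⊎ Extension A
stuck-or-extension A with any? (λ p → any? (λ q → All.all? (fits? q) (neighbours p)) (neighbours p)) (boundary A)
  where
  fits? : ∀ q r → Dec (Cl (elems A) r ⊎ r ≡ q)
  fits? q r = Cl? (elems A) r ⊎-dec (r ≟ₚ q)
... | yes some with find some
...   | p , p∈∂ , some′ with find some′ | ∈-boundary⁻ A p∈∂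
...     | q , _ , all | p∉ , near = inj₂ (p , p∉ , ℕ.s≤s⁻¹ (bsize-insert-≤ A p∉ (q ∷ []) new))
  where
  new : ∀ r → Near p r → Cl (elems A) r ⊎ r ∈ q ∷ []
  new r (inj₁ refl) = inj₁ (inj₂ near)
  new r (inj₂ r∈) with All.lookup all r∈
  ... | inj₁ h = inj₁ h
  ... | inj₂ eq = inj₂ (here eq)
stuck-or-extension A | no none = inj₁ stuck
  where
  stuck : Stuck (elems A)
  stuck p p∉ (inj₁ p∈) q h = p∉ p∈
  stuck p p∉ (inj₂ (s , s∈ , n)) q h with q ∈? neighbours p
  ... | yes q∈ = none (lose (∈-boundary⁺ A p∉ s∈ n) (lose q∈ (All.tabulate (λ {r} → h r))))
  -- If `q` is not a neighbour, nothing is gained at all and any neighbour can take its place.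
  ... | no q∉ = none (lose (∈-boundary⁺ A p∉ s∈ n) (lose {x = proj₁ p + 1ℤ , proj₂ p} (here refl)
    (All.tabulate λ {r} r∈ → [ inj₁ , (λ { refl → ⊥-elim (q∉ r∈) }) ]′ (h r r∈))))

-- The box grown from a rightmost point of a stuck set is either everything or can be moved.
trichotomy : ∀ A {x} → x ∈ₛ A → Extension A ⊎ TightBox A ⊎ Improvement A
trichotomy A x∈ with stuck-or-extension A
... | inj₂ ext = inj₁ ext
... | inj₁ stuck with maximum (Frame.U standard) x∈
...   | m , m∈ , max with Closure.closed-box (elems A) stuck standard m∈
...     | a , b , c , d , g , m∈Box@((_ , m≤b) , _) , closed with any? (λ r → ¬? (InF? standard a b c d r)) (elems A)
...       | yes some with find some
...         | r , r∈ , r∉ = inj₂ (inj₂ (Improve.improve A stuck g (λ p∈ →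
    ℤₚ.≤-trans (max p∈) m≤b) closed m∈ m∈Box r∈ r∉))
trichotomy A x∈ | inj₁ stuck | m , m∈ , max | a , b , c , d , g , m∈Box , closed | no none =
  inj₂ (inj₁ (a , b , c , d , (a≤b , c≤d) , tight , λ p → mk⇔
    (λ p∈ → decidable-stable (InF? standard a b c d p) λ p∉ → none (lose p∈ p∉)) inside))
  where open Growth.Good g

∈⇒length≡suc : ∀ {x : Pt} {xs} → x ∈ xs → ∃[ n ] length xs ≡ suc n
∈⇒length≡suc {xs = _ ∷ xs} _ = length xs , refl

BoxBound : FinSet → Set
BoxBound C = ∃[ D ] (TightBox D × size C ℕ.≤ size D × bsize D ℕ.≤ bsize C)

box-bound-step : ∀ C {x} → x ∈ₛ C →
  (∀ C′ {x′} → x′ ∈ₛ C′ → bsize C′ ℕ.< bsize C → BoxBound C′) →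
  (∀ C′ {x′} → x′ ∈ₛ C′ → bsize C′ ≡ bsize C → size C′ ≡ suc (size C) → BoxBound C′) → BoxBound C
box-bound-step C x∈ smaller larger with trichotomy C x∈
... | inj₂ (inj₁ box) = C , box , ℕₚ.≤-refl , ℕₚ.≤-refl
... | inj₂ (inj₂ (C′ , sz , lt)) =
  let D , box , sz′ , le = smaller C′ (proj₂ (nonempty {elems C′} (trans sz (proj₂ (∈⇒length≡suc x∈))))) lt
  in D , box , subst (ℕ._≤ size D) sz sz′ , ℕₚ.≤-trans le (ℕₚ.<⇒≤ lt)
... | inj₁ (p , p∉ , le) with ℕₚ.m≤n⇒m<n∨m≡n le
...   | inj₁ lt = let D , box , sz , le′ = smaller (insert C p∉) (here refl) lt
                  in D , box , ℕₚ.≤-trans (ℕₚ.n≤1+n _) sz , ℕₚ.≤-trans le′ le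
...   | inj₂ eq = let D , box , sz , le′ = larger (insert C p∉) (here refl) eq refl
                  in D , box , ℕₚ.≤-trans (ℕₚ.n≤1+n _) sz , ℕₚ.≤-trans le′ le

-- Lexicographic descent. An improvement, or an extension with smaller boundary, decreases `bsize`.
-- An extension with equal boundary increases the size, which `size≤bsize²` bounds, so
-- `k * k ∸ size C` decreases.
box-bound : ∀ C {x} → x ∈ₛ C → BoxBound C
box-bound C x∈ = go C x∈ (<-wellFounded _) (<-wellFounded _) refl refl
  where
  go : ∀ {k n} C {x} → x ∈ₛ C → Acc ℕ._<_ k → Acc ℕ._<_ n → bsize C ≡ k → k ℕ.* k ℕ.∸ size C ≡ n → BoxBound C
  go C x∈ (acc outer) (acc inner) refl refl = box-bound-step C x∈
    (λ C′ x′∈ lt → go C′ x′∈ (outer lt) (<-wellFounded _) refl refl)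
    (λ C′ x′∈ eq sz → go C′ x′∈ (acc outer)
      (inner (ℕₚ.∸-monoʳ-< (ℕₚ.≤-reflexive (sym sz)) (subst (λ k →
          size C′ ℕ.≤ k ℕ.* k) eq (size≤bsize² C′)))) eq refl)

TightBox⇒IsBox : ∀ A {x} → x ∈ₛ A → TightBox A → IsBox A
TightBox⇒IsBox A {x} x∈ (a , b , c , d , _ , _ , iff) = a , b , c , d , (x , Equivalence.to (iff x) x∈) , iff

-- Adding a point to a box: dead against efficient

module _ (F : Frame) where
  open Frame F

  -- The two right-hand neighbours of `p` are in a column beyond `b + 1`, out of reach of the closed
  -- neighbourhood of a set inside the box.
  bsize-point-beyond-> : ∀ {a b c d p} A A′ → (∀ {q} → q ∈ₛ A → InF F a b c d q) → A ⊆ₛ A′ →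
    size A′ ≡ suc (size A) → p ∈ₛ A′ → ¬ U p ≤ b → bsize A ℕ.< bsize A′
  bsize-point-beyond-> {a} {b} {c} {d} {p} A A′ inbox sub sz p∈ out =
    bsize-superset-> A A′ sub sz p∈ (inj₂ (mv-neighbour true true p)) (inj₂ (mv-neighbour true false p))
      (λ eq → lin 3 (λ v w w′ → w :≡ v :+ # 1 ⇒ w′ :≡ v :- # 1 ⇒ w :≡ w′ ⇒
          ⊢⊥) (V p) (V (mv true true p)) (V (mv true false p))
        (V-mv true true p) (V-mv true false p) (cong V eq))
      (far true) (far false)
    where
    far : ∀ f → ¬ Cl (elems A) (mv true f p)
    far f h = let (_ , ≤b) , _ = Ext-intro F {a} {b} {c} {d} inbox h in
      lin 3 (λ b u w → b :+ # 1 :≤ u ⇒ w :≡ u :+ # 1 ⇒ w :≤ b :+ # 1 ⇒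
          ⊢⊥) b (U p) (U (mv true f p)) (≰⇒+1≤ out) (U-mv true f p) ≤b

  -- The inner neighbours of a point beside a side are in the enlarged box, hence present by
  -- tightness; only the two outer ones are new.
  side-insertion : ∀ {a b c d} A → a ≤ b → Tight F a b c d → (∀ p → p ∈ₛ A ⇔ InF F a b c d p) →
    ∀ {p} → U p ≡ b + 1ℤ → c ≤ V p → V p ≤ d → Σ (p ∉ elems A) λ p∉ → bsize (insert A p∉) ℕ.≤ suc (bsize A)
  side-insertion {a} {b} {c} {d} A a≤b tight iff {p} up c≤ ≤d =
    p∉ , ℕ.s≤s⁻¹ (bsize-insert-≤ A p∉ (mv true true p ∷ mv true false p ∷ []) new)
    where
    p∉ : p ∉ elems A
    p∉ p∈ = let (_ , ≤b) , _ = Equivalence.to (iff p) p∈ in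
      lin 2 (λ b u → u :≡ b :+ # 1 ⇒ u :≤ b ⇒ ⊢⊥) b (U p) up ≤b
    Ext⇒Cl : ∀ {q} → Ext F a b c d q → Cl (elems A) q
    Ext⇒Cl {q} ext with tight q ext
    ... | inj₁ h = inj₁ (Equivalence.from (iff q) h)
    ... | inj₂ (r , n , h) = inj₂ (r , Equivalence.from (iff r) h , neighbours-sym {q} {r} n)
    column : ∀ f → a - 1ℤ ≤ U (mv false f p) × U (mv false f p) ≤ b + 1ℤ
    column f = lin 4 (λ a b u w → a :≤ b ⇒ u :≡ b :+ # 1 ⇒ w :≡ u :- # 1 ⇒ ⊢ a :- # 1 :≤ w)
                 a b (U p) (U (mv false f p)) a≤b up (U-mv false f p)
             , lin 3 (λ b u w → u :≡ b :+ # 1 ⇒ w :≡ u :- # 1 ⇒ ⊢ w :≤ b :+ # 1)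
                 b (U p) (U (mv false f p)) up (U-mv false f p)
    new : ∀ r → Near p r → Cl (elems A) r ⊎ r ∈ mv true true p ∷ mv true false p ∷ []
    new r (inj₁ refl) = inj₁ (Ext⇒Cl
      ( (lin 3 (λ a b u → a :≤ b ⇒ u :≡ b :+ # 1 ⇒ ⊢ a :- # 1 :≤ u) a b (U p) a≤b up , ℤₚ.≤-reflexive up)
      , (≤⇒-1≤ c≤ , ≤⇒≤+1 ≤d)))
    new r (inj₂ r∈) with neighbour-mv r∈
    ... | true , true , refl = inj₂ (here refl)
    ... | true , false , refl = inj₂ (there (here refl))
    ... | false , true , refl = inj₁ (Ext⇒Cl (column true ,
        ( lin 3 (λ c v w → c :≤ v ⇒ w :≡ v :+ # 1 ⇒ ⊢ c :- # 1 :≤ w) c (V p) (V r) c≤ (V-mv false true p)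
        , lin 3 (λ d v w → v :≤ d ⇒ w :≡ v :+ # 1 ⇒ ⊢ w :≤ d :+ # 1) d (V p) (V r) ≤d (V-mv false true p))))
    ... | false , false , refl = inj₁ (Ext⇒Cl (column false ,
        ( lin 3 (λ c v w → c :≤ v ⇒ w :≡ v :- # 1 ⇒ ⊢ c :- # 1 :≤ w) c (V p) (V r) c≤ (V-mv false false p)
        , lin 3 (λ d v w → v :≤ d ⇒ w :≡ v :- # 1 ⇒ ⊢ w :≤ d :+ # 1) d (V p) (V r) ≤d (V-mv false false p))))

IsBox⇒bsize-superset-> : ∀ {A A′} → IsBox A → A ⊆ₛ A′ → size A′ ≡ suc (size A) → bsize A ℕ.< bsize A′
IsBox⇒bsize-superset-> {A} {A′} (a , b , c , d , _ , iff) sub sz with any? (λ p → ¬? (p ∈? elems A)) (elems A′)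
... | no none = ⊥-elim (ℕₚ.1+n≰n (subst (ℕ._≤ size A) sz (unique-⊆⇒length≤ (proj₂ A′)
        (λ {p} p∈ → decidable-stable (p ∈? elems A) λ p∉ → none (lose p∈ p∉)))))
... | yes some with find some
...   | p@(x , y) , p∈ , p∉ with y - x ℤ.≤? b | a ℤ.≤? y - x | y + x ℤ.≤? d | c ℤ.≤? y + x
...     | no h | _ | _ | _ = bsize-point-beyond-> standard {a} {b} {c} {d} A A′ inbox sub sz p∈ h
    where
    inbox : ∀ {q} → q ∈ₛ A → InBox a b c d q
    inbox {q} = Equivalence.to (iff q)
...     | yes _ | no h | _ | _ = bsize-point-beyond-> (flip standard) { - b} { - a} {c} {d} A A′
    (λ {q} q∈ → let (h₁ , h₂) , h = Equivalence.to (iff q) q∈ in (ℤₚ.neg-mono-≤ h₂ , ℤₚ.neg-mono-≤ h₁) , h)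
    sub sz p∈ (h ∘ ℤₚ.neg-cancel-≤)
...     | yes _ | yes _ | no h | _ = bsize-point-beyond-> (swap standard) {c} {d} {a} {b} A A′
    (λ {q} q∈ → let h , h′ = Equivalence.to (iff q) q∈ in h′ , h) sub sz p∈ h
...     | yes _ | yes _ | yes _ | no h = bsize-point-beyond-> (flip (swap standard)) { - d} { - c} {a} {b} A A′
    (λ {q} q∈ → let h , (h₁ , h₂) = Equivalence.to (iff q) q∈ in (ℤₚ.neg-mono-≤ h₂ , ℤₚ.neg-mono-≤ h₁) , h)
    sub sz p∈ (h ∘ ℤₚ.neg-cancel-≤)
...     | yes h₁ | yes h₂ | yes h₃ | yes h₄ = ⊥-elim (p∉ (Equivalence.from (iff p) ((h₂ , h₁) , (h₄ , h₃))))

-- A minimal `A′` with one more point has a larger boundary than `A`. A larger set with the boundary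
-- of `A` could be shrunk to the size of `A′` and would beat it, so there is none and `A` would be
-- efficient.
¬Efficient-box⇒Dead : ∀ {A} → Minimal A → IsBox A → ¬ Efficient A → Dead A
¬Efficient-box⇒Dead minA box ¬eff zero _ = refl
¬Efficient-box⇒Dead {A} minA box ¬eff (suc n) (A′ , sub , sz , (_ , min′) , _) = ⊥-elim (¬eff efficient)
  where
  efficient : Efficient A
  efficient C eq with size C ℕ.≤? size A
  ... | yes le = le
  ... | no ≰ with shrink {suc (size A)} C (ℕₚ.≰⇒> ≰)
  ...   | C′ , sz′ , le = ⊥-elim (ℕₚ.<⇒≱ (IsBox⇒bsize-superset-> {A} {A′} box sub sz)
            (ℕₚ.≤-trans (min′ C′ (trans sz′ (sym sz))) (ℕₚ.≤-trans le (ℕₚ.≤-reflexive eq))))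

Dead⇒no-minimal-insertion : ∀ {A p} (p∉ : p ∉ elems A) → Dead A → ¬ Minimal (insert A p∉)
Dead⇒no-minimal-insertion {A} p∉ dead min with dead 1 (insert A p∉ , (λ _ → there) , refl , min , tt)
... | ()

Dead⇒TightBox : ∀ {A} → Minimal A → Dead A → TightBox A
Dead⇒TightBox {A} minA@((x , x∈) , min) dead with trichotomy A x∈
... | inj₂ (inj₁ box) = box
... | inj₂ (inj₂ (C , sz , lt)) = ⊥-elim (ℕₚ.<⇒≱ lt (min C sz))
... | inj₁ (p , p∉ , le) = ⊥-elim (Dead⇒no-minimal-insertion p∉ dead ((p , here refl) , λ C sz →
        ℕₚ.≤-trans le (Minimal-bsize≤ {A} minA C (subst (size A ℕ.≤_) (sym sz) (ℕₚ.n≤1+n _)))))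

-- A box is stuck, so a minimal one falls into the middle case of the trichotomy.
IsBox⇒TightBox : ∀ {A} → Minimal A → IsBox A → TightBox A
IsBox⇒TightBox {A} ((x , x∈) , min) box with trichotomy A x∈
... | inj₂ (inj₁ tight) = tight
... | inj₂ (inj₂ (C , sz , lt)) = ⊥-elim (ℕₚ.<⇒≱ lt (min C sz))
... | inj₁ (p , p∉ , le) = ⊥-elim (ℕₚ.<⇒≱ (IsBox⇒bsize-superset-> {A} {insert A p∉} box (λ _ → there) refl) le)

-- A competitor with one more point than `A` has at least the boundary of `A` by monotonicity, and
-- not the same boundary because `A` is efficient. So it has at least one more, which is all that
-- the insertion costs.
Efficient⇒Minimal-insertion : ∀ {A p} (p∉ : p ∉ elems A) → Minimal A → Efficient A →
  bsize (insert A p∉) ℕ.≤ suc (bsize A) → Minimal (insert A p∉)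
Efficient⇒Minimal-insertion {A} {p} p∉ minA eff le = (p , here refl) , λ C sz →
  ℕₚ.≤-trans le (ℕₚ.≤∧≢⇒< (Minimal-bsize≤ {A} minA C (subst (size A ℕ.≤_) (sym sz) (ℕₚ.n≤1+n _)))
    λ eq → ℕₚ.1+n≰n (subst (ℕ._≤ size A) sz (eff C (sym eq))))

-- Lattice points and parity

even⊎odd : ∀ n → ∃[ k ] (n ≡ k ℕ.+ k ⊎ n ≡ suc (k ℕ.+ k))
even⊎odd zero = 0 , inj₁ refl
even⊎odd (suc n) with even⊎odd n
... | k , inj₁ eq = k , inj₂ (cong suc eq)
... | k , inj₂ eq = suc k , inj₁ (cong suc (trans eq (sym (ℕₚ.+-suc k k))))

even⊎oddℤ : ∀ z → ∃[ k ] (z ≡ k + k ⊎ z ≡ k + k + 1ℤ)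
even⊎oddℤ (+ n) with even⊎odd n
... | k , inj₁ refl = + k , inj₁ refl
... | k , inj₂ refl = + k , inj₂ (ℤₚ.+-comm 1ℤ (+ (k ℕ.+ k)))
even⊎oddℤ -[1+ n ] with even⊎odd n
... | k , inj₁ refl = - + suc k , inj₂
  (lin 1 (λ k → ⊢ :- (# 1 :+ (k :+ k)) :≡ :- (# 1 :+ k) :+ :- (# 1 :+ k) :+ # 1) (+ k))
... | k , inj₂ refl = - + suc k , inj₁
  (lin 1 (λ k → ⊢ :- (# 1 :+ (# 1 :+ (k :+ k))) :≡ :- (# 1 :+ k) :+ :- (# 1 :+ k)) (+ k))

lattice-point : ∀ u v → ∃[ p ] (Frame.U standard p ≡ u × (Frame.V standard p ≡ v ⊎ Frame.V standard p ≡ v + 1ℤ))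
lattice-point u v with even⊎oddℤ (v - u)
... | k , inj₁ eq = (k , u + k) , lin 2 (λ u k → ⊢ u :+ k :- k :≡ u) u k ,
  inj₁ (lin 3 (λ u v k → v :- u :≡ k :+ k ⇒ ⊢ u :+ k :+ k :≡ v) u v k eq)
... | k , inj₂ eq = (k + 1ℤ , u + (k + 1ℤ)) , lin 2 (λ u k → ⊢ u :+ (k :+ # 1) :- (k :+ # 1) :≡ u) u k ,
  inj₂ (lin 3 (λ u v k → v :- u :≡ k :+ k :+ # 1 ⇒ ⊢ u :+ (k :+ # 1) :+ (k :+ # 1) :≡ v :+ # 1) u v k eq)

-- Counting the points of a box

<⌊/2⌋⁺ : ∀ n {i} → suc (i ℕ.+ i) ℕ.< n → i ℕ.< ⌊ n /2⌋
<⌊/2⌋⁺ (suc (suc n)) {zero} _ = s≤s z≤n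
<⌊/2⌋⁺ (suc (suc n)) {suc i} (s≤s (s≤s h)) = s≤s (<⌊/2⌋⁺ n (subst (ℕ._≤ n) (cong suc (ℕₚ.+-suc i i)) h))
<⌊/2⌋⁺ (suc zero) (s≤s ())

<⌊/2⌋⁻ : ∀ n {i} → i ℕ.< ⌊ n /2⌋ → suc (i ℕ.+ i) ℕ.< n
<⌊/2⌋⁻ (suc (suc n)) {zero} _ = s≤s (s≤s z≤n)
<⌊/2⌋⁻ (suc (suc n)) {suc i} (s≤s h) = s≤s (s≤s (subst (ℕ._≤ n) (sym (cong suc (ℕₚ.+-suc i i))) (<⌊/2⌋⁻ n h)))

grid-point : Pt → ℕ × ℕ → Pt
grid-point (x , y) (i , j) = (x - + i) + + j , (y + + i) + + j

grid : Pt → ℕ → ℕ → List Pt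
grid q m n = map (grid-point q) (cartesianProduct (upTo m) (upTo n))

module _ where
  open Frame standard

  U-grid-point : ∀ q i j → U (grid-point q (i , j)) ≡ U q + (+ i + + i)
  U-grid-point (x , y) i j =
    lin 4 (λ x y i j → ⊢ y :+ i :+ j :- (x :- i :+ j) :≡ y :- x :+ (i :+ i)) x y (+ i) (+ j)

  V-grid-point : ∀ q i j → V (grid-point q (i , j)) ≡ V q + (+ j + + j)
  V-grid-point (x , y) i j =
    lin 4 (λ x y i j → ⊢ y :+ i :+ j :+ (x :- i :+ j) :≡ y :+ x :+ (j :+ j)) x y (+ i) (+ j)

  grid-point-injective : ∀ q {ij kl} → grid-point q ij ≡ grid-point q kl → ij ≡ kl
  grid-point-injective q {i , j} {k , l} eq = cong₂ _,_
    (half {U q} (trans (sym (U-grid-point q i j)) (trans (cong U eq) (U-grid-point q k l))))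
    (half {V q} (trans (sym (V-grid-point q i j)) (trans (cong V eq) (V-grid-point q k l))))
    where
    half : ∀ {a m n} → a + (+ m + + m) ≡ a + (+ n + + n) → m ≡ n
    half {a} {m} {n} eq = ℤₚ.+-injective
      (lin 3 (λ a m n → a :+ (m :+ m) :≡ a :+ (n :+ n) ⇒ ⊢ m :≡ n) a (+ m) (+ n) eq)

  grid-unique : ∀ q m n → Unique (grid q m n)
  grid-unique q m n = Uniqueₚ.map⁺ (grid-point-injective q) (Uniqueₚ.cartesianProduct⁺ (Uniqueₚ.upTo⁺ m)
      (Uniqueₚ.upTo⁺ n))

  grid-length : ∀ q m n → length (grid q m n) ≡ m ℕ.* n
  grid-length q m n = trans (Listₚ.length-map (grid-point q) (cartesianProduct (upTo m) (upTo n)))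
    (trans (length-cartesianProduct (upTo m) (upTo n)) (cong₂ ℕ._*_ (Listₚ.length-upTo m) (Listₚ.length-upTo n)))

  ∈-grid⁺ : ∀ q {m n i j} → i ℕ.< m → j ℕ.< n → grid-point q (i , j) ∈ grid q m n
  ∈-grid⁺ q i<m j<n = ∈-map⁺ (grid-point q) (∈-cartesianProduct⁺ (∈-upTo⁺ i<m) (∈-upTo⁺ j<n))

  ∈-grid⁻ : ∀ q {m n p} → p ∈ grid q m n → ∃[ i ] ∃[ j ] (i ℕ.< m × j ℕ.< n × p ≡ grid-point q (i , j))
  ∈-grid⁻ q {m} {n} p∈ with ∈-map⁻ (grid-point q) p∈
  ... | (i , j) , ij∈ , eq with ∈-cartesianProduct⁻ (upTo m) (upTo n) ij∈
  ...   | i∈ , j∈ = i , j , ∈-upTo⁻ i∈ , ∈-upTo⁻ j∈ , eq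

  -- The points of a box with U ≡ a (mod 2) form a grid based at q, the others a grid based at q′.
  module TwoGrids {a b c d : ℤ} {s t : ℕ} (b+1≡ : b + 1ℤ ≡ a + + s) (d+1≡ : d + 1ℤ ≡ c + + t)
    {q q′ : Pt} {δ δ′ n n′ : ℕ} (δ≤1 : δ ℕ.≤ 1) (δ′≤1 : δ′ ℕ.≤ 1)
    (uq : U q ≡ a) (vq : V q ≡ c + + δ) (uq′ : U q′ ≡ a + 1ℤ) (vq′ : V q′ ≡ c + + δ′)
    (n⁺ : ∀ {j} → δ ℕ.+ (j ℕ.+ j) ℕ.< t → j ℕ.< n) (n⁻ : ∀ {j} → j ℕ.< n → δ ℕ.+ (j ℕ.+ j) ℕ.< t)
    (n′⁺ : ∀ {j} → δ′ ℕ.+ (j ℕ.+ j) ℕ.< t → j ℕ.< n′) (n′⁻ : ∀ {j} → j ℕ.< n′ → δ′ ℕ.+ (j ℕ.+ j) ℕ.< t) where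

    points : List Pt
    points = grid q ⌈ s /2⌉ n ++ grid q′ ⌊ s /2⌋ n′

    points-unique : Unique points
    points-unique = Uniqueₚ.++⁺ (grid-unique q ⌈ s /2⌉ n) (grid-unique q′ ⌊ s /2⌋ n′) disjoint
      where
      disjoint : ∀ {p} → ¬ (p ∈ grid q ⌈ s /2⌉ n × p ∈ grid q′ ⌊ s /2⌋ n′)
      disjoint {p} (h , h′) with ∈-grid⁻ q {⌈ s /2⌉} {n} h | ∈-grid⁻ q′ {⌊ s /2⌋} {n′} h′
      ... | i , j , _ , _ , eq | k , l , _ , _ , eq′ with + i ℤ.≤? + k
      ...   | yes i≤k = lin 6 (λ a q q′ p i k → i :≤ k ⇒ q :≡ a ⇒ q′ :≡ a :+ # 1 ⇒ p :≡ q :+ (i :+ i) ⇒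
          p :≡ q′ :+ (k :+ k) ⇒ ⊢⊥)
              a (U q) (U q′) (U p) (+ i) (+ k) i≤k uq uq′ (trans (cong U eq) (U-grid-point q i j)) (trans
                  (cong U eq′) (U-grid-point q′ k l))
      ...   | no i≰k = lin 6 (λ a q q′ p i k → k :+ # 1 :≤ i ⇒ q :≡ a ⇒ q′ :≡ a :+ # 1 ⇒ p :≡ q :+ (i :+ i) ⇒
          p :≡ q′ :+ (k :+ k) ⇒ ⊢⊥)
              a (U q) (U q′) (U p) (+ i) (+ k) (≰⇒+1≤ i≰k) uq uq′ (trans (cong U eq) (U-grid-point q i j)) (trans
                  (cong U eq′) (U-grid-point q′ k l))

    points-length : length points ≡ ⌈ s /2⌉ ℕ.* n ℕ.+ ⌊ s /2⌋ ℕ.* n′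
    points-length = trans (Listₚ.length-++ (grid q ⌈ s /2⌉ n))
        (cong₂ ℕ._+_ (grid-length q ⌈ s /2⌉ n) (grid-length q′ ⌊ s /2⌋ n′))

    private
      rows⁻ : ∀ {v w δ j} → d + 1ℤ ≡ c + + t → w ≡ c + + δ → v ≡ w + (+ j + + j) → δ ℕ.+ (j ℕ.+ j) ℕ.< t →
          c ≤ v × v ≤ d
      rows⁻ {v} {w} {δ} {j} d+1≡ eq eq′ lt =
        lin 5 (λ c v w δ j → # 0 :≤ δ ⇒ # 0 :≤ j ⇒ w :≡ c :+ δ ⇒ v :≡ w :+ (j :+ j) ⇒ ⊢ c :≤ v)
          c v w (+ δ) (+ j) (+≤+ z≤n) (+≤+ z≤n) eq eq′ ,
        lin 7 (λ c d t v w δ j → d :+ # 1 :≡ c :+ t ⇒ w :≡ c :+ δ ⇒ v :≡ w :+ (j :+ j) ⇒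
            # 1 :+ (δ :+ (j :+ j)) :≤ t ⇒ ⊢ v :≤ d)
          c d (+ t) v w (+ δ) (+ j) d+1≡ eq eq′ (+≤+ lt)

      offset : ∀ z → 0ℤ ≤ z → ∃[ k ] z ≡ + k
      offset (+ k) _ = k , refl

      rows⁺ : ∀ {v w δ e} → δ ℕ.≤ 1 → w ≡ c + + δ → v - w ≡ e + e → c ≤ v → v ≤ d →
        ∃[ j ] (δ ℕ.+ (j ℕ.+ j) ℕ.< t × v ≡ w + (+ j + + j))
      rows⁺ {v} {w} {δ} {e} δ≤1 eq eq′ c≤ ≤d with 0ℤ ℤ.≤? e
      -- `v - w` is even and the base row is `c` or `c + 1`, so a row below the base would be below
      -- `c`.
      ... | no e<0 = ⊥-elim (lin 5 (λ c v w δ e → δ :≤ # 1 ⇒ w :≡ c :+ δ ⇒ v :- w :≡ e :+ e ⇒ c :≤ v ⇒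
          e :+ # 1 :≤ # 0 ⇒ ⊢⊥)
              c v w (+ δ) e (+≤+ δ≤1) eq eq′ c≤ (≰⇒+1≤ e<0))
      ... | yes 0≤e with offset e 0≤e
      ...   | j , refl = j ,
              ℤₚ.drop‿+≤+ (lin 7 (λ c d t v w δ j → d :+ # 1 :≡ c :+ t ⇒ w :≡ c :+ δ ⇒ v :- w :≡ j :+ j ⇒ v :≤ d ⇒
                                    ⊢ # 1 :+ (δ :+ (j :+ j)) :≤ t) c d (+ t) v w (+ δ) (+ j) d+1≡ eq eq′ ≤d) ,
              lin 3 (λ v w j → v :- w :≡ j :+ j ⇒ ⊢ v :≡ w :+ (j :+ j)) v w (+ j) eq′

    ∈-points⁻ : ∀ {p} → p ∈ points → InBox a b c d p
    ∈-points⁻ {p} p∈ with ∈-++⁻ (grid q ⌈ s /2⌉ n) p∈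
    ... | inj₁ h with ∈-grid⁻ q {⌈ s /2⌉} {n} h
    ...   | i , j , i< , j< , refl =
      ( lin 4 (λ a u p i → # 0 :≤ i ⇒ u :≡ a ⇒ p :≡ u :+ (i :+ i) ⇒
          ⊢ a :≤ p) a (U q) (U p) (+ i) (+≤+ z≤n) uq (U-grid-point q i j)
      , lin 6 (λ a b s u p i → b :+ # 1 :≡ a :+ s ⇒ u :≡ a ⇒ p :≡ u :+ (i :+ i) ⇒
          # 1 :+ (# 1 :+ (i :+ i)) :≤ # 1 :+ s ⇒ ⊢ p :≤ b)
          a b (+ s) (U q) (U p) (+ i) b+1≡ uq (U-grid-point q i j) (+≤+ (<⌊/2⌋⁻ (suc s) i<))) ,
      rows⁻ {j = j} d+1≡ vq (V-grid-point q i j) (n⁻ j<)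
    ∈-points⁻ {p} p∈ | inj₂ h with ∈-grid⁻ q′ {⌊ s /2⌋} {n′} h
    ...   | i , j , i< , j< , refl =
      ( lin 4 (λ a u p i → # 0 :≤ i ⇒ u :≡ a :+ # 1 ⇒ p :≡ u :+ (i :+ i) ⇒
          ⊢ a :≤ p) a (U q′) (U p) (+ i) (+≤+ z≤n) uq′ (U-grid-point q′ i j)
      , lin 6 (λ a b s u p i → b :+ # 1 :≡ a :+ s ⇒ u :≡ a :+ # 1 ⇒ p :≡ u :+ (i :+ i) ⇒
          # 1 :+ (# 1 :+ (i :+ i)) :≤ s ⇒ ⊢ p :≤ b)
          a b (+ s) (U q′) (U p) (+ i) b+1≡ uq′ (U-grid-point q′ i j) (+≤+ (<⌊/2⌋⁻ s i<))) ,
      rows⁻ {j = j} d+1≡ vq′ (V-grid-point q′ i j) (n′⁻ j<)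

    ∈-points⁺ : ∀ {p} → InBox a b c d p → p ∈ points
    ∈-points⁺ {p} ((a≤ , ≤b) , (c≤ , ≤d)) with offset (U p - a) (ℤₚ.i≤j⇒0≤j-i a≤)
    ... | m , eqm with even⊎odd m
    -- The column parity selects the grid; the lattice parity then makes the row difference even
    -- too, with half `e - i`.
    ...   | i , inj₁ refl = let e , par = parity p q in
      let j , j< , vp = rows⁺ {V p} {V q} {δ} {e - + i} δ≤1 vq
            (lin 7 (λ a p q v w i e → p :- a :≡ i :+ i ⇒ q :≡ a ⇒ p :- q :+ (v :- w) :≡ e :+ e ⇒
                ⊢ v :- w :≡ (e :- i) :+ (e :- i))
              a (U p) (U q) (V p) (V q) (+ i) e eqm uq par) c≤ ≤d
          up = lin 4 (λ a p q i → p :- a :≡ i :+ i ⇒ q :≡ a ⇒ ⊢ p :≡ q :+ (i :+ i)) a (U p) (U q) (+ i) eqm uq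
      in subst (_∈ points) (UV-injective {grid-point q (i , j)} {p} (trans (U-grid-point q i j) (sym up))
          (trans (V-grid-point q i j) (sym vp)))
           (∈-++⁺ˡ (∈-grid⁺ q (<⌊/2⌋⁺ (suc s) (ℤₚ.drop‿+≤+
             (lin 5 (λ a b s p i → b :+ # 1 :≡ a :+ s ⇒ p :- a :≡ i :+ i ⇒ p :≤ b ⇒
                 ⊢ # 1 :+ (# 1 :+ (i :+ i)) :≤ # 1 :+ s)
               a b (+ s) (U p) (+ i) b+1≡ eqm ≤b))) (n⁺ j<)))
    ...   | i , inj₂ refl = let e , par = parity p q′ in
      let j , j< , vp = rows⁺ {V p} {V q′} {δ′} {e - + i} δ′≤1 vq′
            (lin 7 (λ a p q v w i e → p :- a :≡ # 1 :+ (i :+ i) ⇒ q :≡ a :+ # 1 ⇒ p :- q :+ (v :- w) :≡ e :+ e ⇒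
                ⊢ v :- w :≡ (e :- i) :+ (e :- i))
              a (U p) (U q′) (V p) (V q′) (+ i) e eqm uq′ par) c≤ ≤d
          up = lin 4 (λ a p q i → p :- a :≡ # 1 :+ (i :+ i) ⇒ q :≡ a :+ # 1 ⇒
              ⊢ p :≡ q :+ (i :+ i)) a (U p) (U q′) (+ i) eqm uq′
      in subst (_∈ points) (UV-injective {grid-point q′ (i , j)} {p} (trans (U-grid-point q′ i j) (sym up))
          (trans (V-grid-point q′ i j) (sym vp)))
           (∈-++⁺ʳ (grid q ⌈ s /2⌉ n) (∈-grid⁺ q′ (<⌊/2⌋⁺ s (ℤₚ.drop‿+≤+
             (lin 5 (λ a b s p i → b :+ # 1 :≡ a :+ s ⇒ p :- a :≡ # 1 :+ (i :+ i) ⇒ p :≤ b ⇒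
                 ⊢ # 1 :+ (# 1 :+ (i :+ i)) :≤ s)
               a b (+ s) (U p) (+ i) b+1≡ eqm ≤b))) (n′⁺ j<)))

  -- Lattice points have U + V even, so exactly one of (a , c) and (a , c + 1) is a lattice point.
  Corner : Bool → ℤ → ℤ → Set
  Corner true a c = ∃[ q ] (U q ≡ a × V q ≡ c)
  Corner false a c = ∃[ q ] (U q ≡ a × V q ≡ c + 1ℤ)

  -- Of `s` consecutive columns, ⌈s/2⌉ have the parity of the first and ⌊s/2⌋ the other, and
  -- likewise for rows. Lattice points combine equal parities if the lower corner is a lattice
  -- point, and opposite parities if it is not.
  count : Bool → ℕ → ℕ → ℕ
  count true s t = ⌈ s /2⌉ ℕ.* ⌈ t /2⌉ ℕ.+ ⌊ s /2⌋ ℕ.* ⌊ t /2⌋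
  count false s t = ⌈ s /2⌉ ℕ.* ⌊ t /2⌋ ℕ.+ ⌊ s /2⌋ ℕ.* ⌈ t /2⌉

  abstract
    box-points : ∀ π {a b c d s t} → b + 1ℤ ≡ a + + s → d + 1ℤ ≡ c + + t → Corner π a c →
      ∃[ D ] (size D ≡ count π s t × ∀ p → p ∈ₛ D ⇔ InBox a b c d p)
    box-points true {a} {b} {c} {d} {s} {t} b+1≡ d+1≡ (q , uq , vq) =
      (points , points-unique) , points-length , λ p → mk⇔ ∈-points⁻ ∈-points⁺
      where
      open TwoGrids {a} {b} {c} {d} {s} {t} b+1≡ d+1≡ {q} {mv true true q} {0} {1} z≤n ℕₚ.≤-refl uq
          (trans vq (sym (ℤₚ.+-identityʳ c)))
        (trans (U-mv true true q) (cong (_+ 1ℤ) uq)) (trans (V-mv true true q) (cong (_+ 1ℤ) vq))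
        -- Rows at offset 0 number ⌈t/2⌉ = ⌊(t + 1)/2⌋, so the floor lemmas are applied to `suc t`.
        (λ h → <⌊/2⌋⁺ (suc t) (s≤s h)) (λ h → ℕ.s≤s⁻¹ (<⌊/2⌋⁻ (suc t) h)) (<⌊/2⌋⁺ t) (<⌊/2⌋⁻ t)
    box-points false {a} {b} {c} {d} {s} {t} b+1≡ d+1≡ (q , uq , vq) =
      (points , points-unique) , points-length , λ p → mk⇔ ∈-points⁻ ∈-points⁺
      where
      open TwoGrids {a} {b} {c} {d} {s} {t} b+1≡ d+1≡ {q} {mv true false q} {1} {0} ℕₚ.≤-refl z≤n uq vq
        (trans (U-mv true false q) (cong (_+ 1ℤ) uq))
        (lin 3 (λ c v w → v :≡ c :+ # 1 ⇒ w :≡ v :- # 1 ⇒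
            ⊢ w :≡ c :+ # 0) c (V q) (V (mv true false q)) vq (V-mv true false q))
        (<⌊/2⌋⁺ t) (<⌊/2⌋⁻ t) (λ h → <⌊/2⌋⁺ (suc t) (s≤s h)) (λ h → ℕ.s≤s⁻¹ (<⌊/2⌋⁻ (suc t) h))

⌊k+k/2⌋ : ∀ k → ⌊ k ℕ.+ k /2⌋ ≡ k
⌊k+k/2⌋ zero = refl
⌊k+k/2⌋ (suc k) rewrite ℕₚ.+-suc k k = cong suc (⌊k+k/2⌋ k)

⌈k+k/2⌉ : ∀ k → ⌈ k ℕ.+ k /2⌉ ≡ k
⌈k+k/2⌉ zero = refl
⌈k+k/2⌉ (suc k) rewrite ℕₚ.+-suc k k = cong suc (⌈k+k/2⌉ k)

double-count-odd : ∀ k l → let n = count false (suc (k ℕ.+ k)) (suc (l ℕ.+ l)) in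
  suc (n ℕ.+ n) ≡ suc (k ℕ.+ k) ℕ.* suc (l ℕ.+ l)
double-count-odd k l rewrite ⌊k+k/2⌋ k | ⌈k+k/2⌉ k | ⌊k+k/2⌋ l | ⌈k+k/2⌉ l = lemma k l
  where
  lemma : ∀ k l → suc ((suc k ℕ.* l ℕ.+ k ℕ.* suc l) ℕ.+ (suc k ℕ.* l ℕ.+ k ℕ.* suc l)) ≡ suc (k ℕ.+ k) ℕ.* suc
      (l ℕ.+ l)
  lemma = ℕ-Solver.solve-∀

-- ⌈s/2⌉ - ⌊s/2⌋ is 1 for odd s and 0 otherwise, and twice the count is
-- s t ± (⌈s/2⌉ - ⌊s/2⌋) (⌈t/2⌉ - ⌊t/2⌋).
double-count : ∀ π s t → let n = count π s t in
    n ℕ.+ n ≡ s ℕ.* t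
  ⊎ (∃[ k ] s ≡ suc (k ℕ.+ k)) × (∃[ l ] t ≡ suc (l ℕ.+ l)) ×
    (π ≡ true × n ℕ.+ n ≡ suc (s ℕ.* t) ⊎ π ≡ false × suc (n ℕ.+ n) ≡ s ℕ.* t)
double-count π s t with even⊎odd s | even⊎odd t
double-count true _ _ | k , inj₁ refl | l , inj₁ refl
  rewrite ⌊k+k/2⌋ k | ⌈k+k/2⌉ k | ⌊k+k/2⌋ l | ⌈k+k/2⌉ l = inj₁ (lemma k l)
  where
  lemma : ∀ k l → (k ℕ.* l ℕ.+ k ℕ.* l) ℕ.+ (k ℕ.* l ℕ.+ k ℕ.* l) ≡ (k ℕ.+ k) ℕ.* (l ℕ.+ l)
  lemma = ℕ-Solver.solve-∀
double-count false _ _ | k , inj₁ refl | l , inj₁ refl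
  rewrite ⌊k+k/2⌋ k | ⌈k+k/2⌉ k | ⌊k+k/2⌋ l | ⌈k+k/2⌉ l = inj₁ (lemma k l)
  where
  lemma : ∀ k l → (k ℕ.* l ℕ.+ k ℕ.* l) ℕ.+ (k ℕ.* l ℕ.+ k ℕ.* l) ≡ (k ℕ.+ k) ℕ.* (l ℕ.+ l)
  lemma = ℕ-Solver.solve-∀
double-count true _ _ | k , inj₁ refl | l , inj₂ refl
  rewrite ⌊k+k/2⌋ k | ⌈k+k/2⌉ k | ⌊k+k/2⌋ l | ⌈k+k/2⌉ l = inj₁ (lemma k l)
  where
  lemma : ∀ k l → (k ℕ.* suc l ℕ.+ k ℕ.* l) ℕ.+ (k ℕ.* suc l ℕ.+ k ℕ.* l) ≡ (k ℕ.+ k) ℕ.* suc (l ℕ.+ l)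
  lemma = ℕ-Solver.solve-∀
double-count false _ _ | k , inj₁ refl | l , inj₂ refl
  rewrite ⌊k+k/2⌋ k | ⌈k+k/2⌉ k | ⌊k+k/2⌋ l | ⌈k+k/2⌉ l = inj₁ (lemma k l)
  where
  lemma : ∀ k l → (k ℕ.* l ℕ.+ k ℕ.* suc l) ℕ.+ (k ℕ.* l ℕ.+ k ℕ.* suc l) ≡ (k ℕ.+ k) ℕ.* suc (l ℕ.+ l)
  lemma = ℕ-Solver.solve-∀
double-count true _ _ | k , inj₂ refl | l , inj₁ refl
  rewrite ⌊k+k/2⌋ k | ⌈k+k/2⌉ k | ⌊k+k/2⌋ l | ⌈k+k/2⌉ l = inj₁ (lemma k l)
  where
  lemma : ∀ k l → (suc k ℕ.* l ℕ.+ k ℕ.* l) ℕ.+ (suc k ℕ.* l ℕ.+ k ℕ.* l) ≡ suc (k ℕ.+ k) ℕ.* (l ℕ.+ l)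
  lemma = ℕ-Solver.solve-∀
double-count false _ _ | k , inj₂ refl | l , inj₁ refl
  rewrite ⌊k+k/2⌋ k | ⌈k+k/2⌉ k | ⌊k+k/2⌋ l | ⌈k+k/2⌉ l = inj₁ (lemma k l)
  where
  lemma : ∀ k l → (suc k ℕ.* l ℕ.+ k ℕ.* l) ℕ.+ (suc k ℕ.* l ℕ.+ k ℕ.* l) ≡ suc (k ℕ.+ k) ℕ.* (l ℕ.+ l)
  lemma = ℕ-Solver.solve-∀
double-count true _ _ | k , inj₂ refl | l , inj₂ refl
  rewrite ⌊k+k/2⌋ k | ⌈k+k/2⌉ k | ⌊k+k/2⌋ l | ⌈k+k/2⌉ l = inj₂ ((k , refl) , (l , refl) , inj₁ (refl , lemma k l))
  where
  lemma : ∀ k l → (suc k ℕ.* suc l ℕ.+ k ℕ.* l) ℕ.+ (suc k ℕ.* suc l ℕ.+ k ℕ.* l) ≡ suc (suc (k ℕ.+ k) ℕ.* suc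
      (l ℕ.+ l))
  lemma = ℕ-Solver.solve-∀
double-count false _ _ | k , inj₂ refl | l , inj₂ refl =
  inj₂ ((k , refl) , (l , refl) , inj₂ (refl , double-count-odd k l))

double-count-≤ : ∀ π s t → count π s t ℕ.+ count π s t ℕ.≤ suc (s ℕ.* t)
double-count-≤ π s t with double-count π s t
... | inj₁ eq = ℕₚ.≤-trans (ℕₚ.≤-reflexive eq) (ℕₚ.n≤1+n _)
... | inj₂ (_ , _ , inj₁ (_ , eq)) = ℕₚ.≤-reflexive eq
... | inj₂ (_ , _ , inj₂ (_ , eq)) = ℕₚ.≤-trans (ℕₚ.n≤1+n _) (ℕₚ.≤-trans (ℕₚ.≤-reflexive eq) (ℕₚ.n≤1+n _))

double-count-true-≥ : ∀ s t → s ℕ.* t ℕ.≤ count true s t ℕ.+ count true s t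
double-count-true-≥ s t with double-count true s t
... | inj₁ eq = ℕₚ.≤-reflexive (sym eq)
... | inj₂ (_ , _ , inj₁ (_ , eq)) = ℕₚ.≤-trans (ℕₚ.n≤1+n _) (ℕₚ.≤-reflexive (sym eq))

-- A tight box has the box enlarged by one on each side as its closed neighbourhood, so the excess
-- `s + t + 2` is its boundary. The parity does not matter because the enlargement adds one to each
-- of the four half counts.
count-enlarged : ∀ π s t → count π (2 ℕ.+ s) (2 ℕ.+ t) ≡ count π s t ℕ.+ (s ℕ.+ t ℕ.+ 2)
count-enlarged true s t = trans (lemma ⌈ s /2⌉ ⌊ s /2⌋ ⌈ t /2⌉ ⌊ t /2⌋)
  (cong₂ (λ s′ t′ → count true s t ℕ.+ (s′ ℕ.+ t′ ℕ.+ 2)) (ℕₚ.⌊n/2⌋+⌈n/2⌉≡n s) (ℕₚ.⌊n/2⌋+⌈n/2⌉≡n t))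
  where
  lemma : ∀ m m′ n n′ → suc m ℕ.* suc n ℕ.+ suc m′ ℕ.* suc n′ ≡
    (m ℕ.* n ℕ.+ m′ ℕ.* n′) ℕ.+ ((m′ ℕ.+ m) ℕ.+ (n′ ℕ.+ n) ℕ.+ 2)
  lemma = ℕ-Solver.solve-∀
count-enlarged false s t = trans (lemma ⌈ s /2⌉ ⌊ s /2⌋ ⌈ t /2⌉ ⌊ t /2⌋)
  (cong₂ (λ s′ t′ → count false s t ℕ.+ (s′ ℕ.+ t′ ℕ.+ 2)) (ℕₚ.⌊n/2⌋+⌈n/2⌉≡n s) (ℕₚ.⌊n/2⌋+⌈n/2⌉≡n t))
  where
  lemma : ∀ m m′ n n′ → suc m ℕ.* suc n′ ℕ.+ suc m′ ℕ.* suc n ≡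
    (m ℕ.* n′ ℕ.+ m′ ℕ.* n) ℕ.+ ((m′ ℕ.+ m) ℕ.+ (n′ ℕ.+ n) ℕ.+ 2)
  lemma = ℕ-Solver.solve-∀

corner-dec : ∀ a c → ∃[ π ] Corner π a c
corner-dec a c with lattice-point a c
... | q , uq , inj₁ vq = true , q , uq , vq
... | q , uq , inj₂ vq = false , q , uq , vq

box-size : ∀ A π {a b c d s t} → b + 1ℤ ≡ a + + s → d + 1ℤ ≡ c + + t → Corner π a c →
  (∀ p → p ∈ₛ A ⇔ InBox a b c d p) → size A ≡ count π s t
box-size A π b+1≡ d+1≡ corner iff with box-points π b+1≡ d+1≡ corner
... | D , sz , iffD = trans (unique-≈⇒length≡ (proj₂ A) (proj₂ D)
  (λ {p} p∈ → Equivalence.from (iffD p) (Equivalence.to (iff p) p∈))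
  (λ {p} p∈ → Equivalence.from (iff p) (Equivalence.to (iffD p) p∈))) sz

module _ (A : FinSet) {a b c d : ℤ} {s t : ℕ} (b+1≡ : b + 1ℤ ≡ a + + s) (d+1≡ : d + 1ℤ ≡ c + + t)
  (iff : ∀ p → p ∈ₛ A ⇔ InBox a b c d p) where
  open ℕₚ.≤-Reasoning
  open Frame standard

  private
    grow : ∀ {a b s} → b + 1ℤ ≡ a + + s → (b + 1ℤ) + 1ℤ ≡ (a - 1ℤ) + + (2 ℕ.+ s)
    grow {a} {b} {s} = lin 3 (λ a b s → b :+ # 1 :≡ a :+ s ⇒ ⊢ b :+ # 1 :+ # 1 :≡ a :- # 1 :+ (# 2 :+ s)) a b (+ s)

    enlarge : ∀ π → Corner π a c → Corner π (a - 1ℤ) (c - 1ℤ)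
    enlarge true (q , uq , vq) =
      mv false false q , trans (U-mv false false q) (cong (_- 1ℤ) uq) , trans (V-mv false false q) (cong (_- 1ℤ) vq)
    enlarge false (q , uq , vq) = mv false false q , trans (U-mv false false q) (cong (_- 1ℤ) uq) ,
      lin 3 (λ c v w → v :≡ c :+ # 1 ⇒ w :≡ v :- # 1 ⇒ ⊢ w :≡ c :- # 1 :+ # 1)
        c (V q) (V (mv false false q)) vq (V-mv false false q)

    in-enlarged : ∀ {p} → p ∈ cl (elems A) → Ext standard a b c d p
    in-enlarged p∈ = Ext-intro standard (λ {q} → Equivalence.to (iff q)) (∈-cl⁻ p∈)

    enlarged-box : ∀ π → Corner π a c → ∃[ D ] (size D ≡ count π (2 ℕ.+ s) (2 ℕ.+ t) × ∀ p →
        p ∈ₛ D ⇔ Ext standard a b c d p)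
    enlarged-box π corner = box-points π (grow {a} {b} {s} b+1≡) (grow {c} {d} {t} d+1≡) (enlarge π corner)

  -- Loose bounds only make the enlarged box larger than the closed neighbourhood, so the formula
  -- survives as an upper bound.
  box-bsize-≤ : bsize A ℕ.≤ s ℕ.+ t ℕ.+ 2
  box-bsize-≤ with corner-dec a c
  ... | π , corner with enlarged-box π corner
  ...   | D , sz , iffD = ℕₚ.+-cancelˡ-≤ (size A) _ _ (begin
    size A ℕ.+ bsize A               ≡⟨ cl-length A ⟨
    length (cl (elems A))            ≤⟨ unique-⊆⇒length≤ (cl-unique (elems A)) (λ {p} p∈ →
        Equivalence.from (iffD p) (in-enlarged p∈)) ⟩
    size D                           ≡⟨ sz ⟩
    count π (2 ℕ.+ s) (2 ℕ.+ t)      ≡⟨ count-enlarged π s t ⟩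
    count π s t ℕ.+ (s ℕ.+ t ℕ.+ 2)  ≡⟨ cong (ℕ._+ (s ℕ.+ t ℕ.+ 2)) (box-size A π b+1≡ d+1≡ corner iff) ⟨
    size A ℕ.+ (s ℕ.+ t ℕ.+ 2)       ∎)

  tight-bsize : Tight standard a b c d → bsize A ≡ s ℕ.+ t ℕ.+ 2
  tight-bsize tight with corner-dec a c
  ... | π , corner with enlarged-box π corner
  ...   | D , sz , iffD = ℕₚ.≤-antisym box-bsize-≤ (ℕₚ.+-cancelˡ-≤ (size A) _ _ (begin
    size A ℕ.+ (s ℕ.+ t ℕ.+ 2)       ≡⟨ cong (ℕ._+ (s ℕ.+ t ℕ.+ 2)) (box-size A π b+1≡ d+1≡ corner iff) ⟩
    count π s t ℕ.+ (s ℕ.+ t ℕ.+ 2)  ≡⟨ count-enlarged π s t ⟨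
    count π (2 ℕ.+ s) (2 ℕ.+ t)      ≡⟨ sz ⟨
    size D                           ≤⟨ unique-⊆⇒length≤ (proj₂ D) (λ {p} p∈ →
        ∈-cl⁺ (near (Equivalence.to (iffD p) p∈))) ⟩
    length (cl (elems A))            ≡⟨ cl-length A ⟩
    size A ℕ.+ bsize A               ∎))
    where
    near : ∀ {p} → Ext standard a b c d p → Cl (elems A) p
    near {p} ext with tight p ext
    ... | inj₁ h = inj₁ (Equivalence.from (iff p) h)
    ... | inj₂ (q , n , h) = inj₂ (q , Equivalence.from (iff q) h , neighbours-sym {p} {q} n)

-- Efficient minimal boxes are not dead

record Shape (A : FinSet) : Set where
  field
    a b c d : ℤ
    α β : ℕ
    b≡ : b ≡ a + + α
    d≡ : d ≡ c + + β
    tight : Tight standard a b c d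
    iff : ∀ p → p ∈ₛ A ⇔ InBox a b c d p
    π : Bool
    corner : Corner π a c
    size≡ : size A ≡ count π (suc α) (suc β)
    bsize≡ : bsize A ≡ suc α ℕ.+ suc β ℕ.+ 2

+1≡ : ∀ {a b α} → b ≡ a + + α → b + 1ℤ ≡ a + + suc α
+1≡ {a} {b} {α} = lin 3 (λ a b α → b :≡ a :+ α ⇒ ⊢ b :+ # 1 :≡ a :+ (# 1 :+ α)) a b (+ α)

shape : ∀ A → TightBox A → Shape A
shape A (a , b , c , d , (a≤b , c≤d) , tight , iff) with difference a≤b | difference c≤d | corner-dec a c
  where
  difference : ∀ {i j} → i ≤ j → ∃[ k ] j ≡ i + + k
  difference {i} {j} i≤j = ∣ j - i ∣ , trans (lin 2 (λ i j → ⊢ j :≡ i :+ (j :- i)) i j)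
    (cong (_+_ i) (sym (ℤₚ.0≤i⇒+∣i∣≡i (ℤₚ.i≤j⇒0≤j-i i≤j))))
... | α , b≡ | β , d≡ | π , corner = record
  { b≡ = b≡ ; d≡ = d≡ ; tight = tight ; iff = iff ; corner = corner
  ; size≡ = box-size A π (+1≡ {a} {b} {α} b≡) (+1≡ {c} {d} {β} d≡) corner iff
  ; bsize≡ = tight-bsize A {s = suc α} {suc β} (+1≡ {a} {b} {α} b≡) (+1≡ {c} {d} {β} d≡) iff tight
  }

swap-Tight : ∀ {a b c d} → Tight standard a b c d → Tight (swap standard) c d a b
swap-Tight tight p (h , h′) with tight p (h′ , h)
... | inj₁ (k , k′) = inj₁ (k′ , k)
... | inj₂ (q , n , (k , k′)) = inj₂ (q , n , (k′ , k))

-- Two points force (α + 1)(β + 1) to be at least 3 by the count, hence α + β to be at least 2.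
Shape⇒6≤bsize : ∀ {D} → Shape D → 2 ℕ.≤ size D → 6 ℕ.≤ bsize D
Shape⇒6≤bsize sh 2≤D = subst (6 ℕ.≤_) (sym bsize≡) (perimeter α β 4≤)
  where
  open Shape sh
  4≤ : 4 ℕ.≤ suc (suc α ℕ.* suc β)
  4≤ = ℕₚ.≤-trans (ℕₚ.+-mono-≤ 2≤ 2≤) (double-count-≤ π (suc α) (suc β))
    where
    2≤ : 2 ℕ.≤ count π (suc α) (suc β)
    2≤ = subst (2 ℕ.≤_) size≡ 2≤D
  perimeter : ∀ α β → 4 ℕ.≤ suc (suc α ℕ.* suc β) → 6 ℕ.≤ suc α ℕ.+ suc β ℕ.+ 2
  perimeter zero zero (s≤s (s≤s ()))
  perimeter zero (suc zero) (s≤s (s≤s (s≤s ())))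
  perimeter zero (suc (suc β)) _ = s≤s (s≤s (s≤s (s≤s (ℕₚ.m≤n+m 2 β))))
  perimeter (suc zero) zero (s≤s (s≤s (s≤s ())))
  perimeter (suc zero) (suc β) _ = s≤s (s≤s (s≤s (s≤s (ℕₚ.m≤n+m 2 β))))
  perimeter (suc (suc α)) β _ = s≤s (s≤s (s≤s (subst (3 ℕ.≤_) (lemma α β) (s≤s (s≤s (s≤s z≤n))))))
    where
    lemma : ∀ α β → 3 ℕ.+ (α ℕ.+ β) ≡ α ℕ.+ suc β ℕ.+ 2
    lemma = ℕ-Solver.solve-∀

two-points⇒6≤bsize : ∀ C → size C ≡ 2 → 6 ℕ.≤ bsize C
two-points⇒6≤bsize C sz with box-bound C (proj₂ (nonempty {elems C} sz))
... | D , box , 2≤D , le = ℕₚ.≤-trans (Shape⇒6≤bsize (shape D box) (subst (ℕ._≤ size D) sz 2≤D)) le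

singleton-≡ : ∀ {xs : List Pt} {p q} → length xs ≡ 1 → p ∈ xs → q ∈ xs → p ≡ q
singleton-≡ {_ ∷ []} _ (here eq) (here eq′) = trans eq (sym eq′)

-- No lattice position lies directly beside a single point, so `side-insertion` does not apply.
-- Adding a neighbour gains three points instead of two; the resulting boundary 6 is still the least
-- possible for two points.
point⇒minimal-insertion : ∀ A {x y} → (x , y) ∈ₛ A → size A ≡ 1 → bsize A ≡ 4 →
  ∃[ p ] Σ (p ∉ elems A) λ p∉ → Minimal (insert A p∉)
point⇒minimal-insertion A {x} {y} x∈ size≡1 bsize≡4 = p , p∉ , (p , here refl) , λ C sz →
  ℕₚ.≤-trans (ℕ.s≤s⁻¹ (ℕₚ.≤-trans (bsize-insert-≤ A p∉ others new) (ℕₚ.≤-reflexive (cong (3 ℕ.+_) bsize≡4))))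
    (two-points⇒6≤bsize C (trans sz (cong suc size≡1)))
  where
  p : Pt
  p = x + 1ℤ , y
  others : List Pt
  others = (x + 1ℤ + 1ℤ , y) ∷ (x + 1ℤ , y + 1ℤ) ∷ (x + 1ℤ , y - 1ℤ) ∷ []
  p∉ : p ∉ elems A
  p∉ p∈ = lin 1 (λ x → x :+ # 1 :≡ x ⇒ ⊢⊥) x (cong proj₁ (singleton-≡ size≡1 p∈ x∈))
  new : ∀ r → Near p r → Cl (elems A) r ⊎ r ∈ others
  new r (inj₁ refl) = inj₁ (inj₂ (_ , x∈ , here refl))
  new r (inj₂ (here eq)) = inj₂ (here eq)
  new r (inj₂ (there (here refl))) = inj₁ (inj₁ (subst (_∈ elems A) (cong (_, y)
      (lin 1 (λ x → ⊢ x :≡ x :+ # 1 :- # 1) x)) x∈))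
  new r (inj₂ (there (there (here eq)))) = inj₂ (there (here eq))
  new r (inj₂ (there (there (there (here eq))))) = inj₂ (there (there (here eq)))

-- An efficient box accepts a lattice point beside one of its sides. The right side has one as soon
-- as there are two rows, the top side as soon as there are two columns; a single point is treated
-- apart.
Dead⇒¬Efficient : ∀ {A} → Minimal A → Shape A → Dead A → ¬ Efficient A
Dead⇒¬Efficient {A} minA sh dead eff = cases α β b≡ d≡ refl refl
  where
  open Shape sh
  open Frame standard
  insertion : ∀ {p} → (Σ (p ∉ elems A) λ p∉ → bsize (insert A p∉) ℕ.≤ suc (bsize A)) → ⊥
  insertion (p∉ , le) = Dead⇒no-minimal-insertion p∉ dead (Efficient⇒Minimal-insertion {A} p∉ minA eff le)
  a≤b : ∀ {a b n} → b ≡ a + + n → a ≤ b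
  a≤b {a} {b} {n} eq = lin 3 (λ a b n → # 0 :≤ n ⇒ b :≡ a :+ n ⇒ ⊢ a :≤ b) a b (+ n) (+≤+ z≤n) eq
  a<b : ∀ {a b n} → b ≡ a + + suc n → a + 1ℤ ≤ b
  a<b {a} {b} {n} eq = lin 3 (λ a b n → # 0 :≤ n ⇒ b :≡ a :+ (# 1 :+ n) ⇒ ⊢ a :+ # 1 :≤ b) a b (+ n) (+≤+ z≤n) eq
  top-point : a + 1ℤ ≤ b → ∃[ p ] (V p ≡ d + 1ℤ × a ≤ U p × U p ≤ b)
  top-point lt with lattice-point a (d + 1ℤ)
  ... | p , up , inj₁ vp = p , vp , ℤₚ.≤-reflexive (sym up) ,
      lin 3 (λ a b u → a :+ # 1 :≤ b ⇒ u :≡ a ⇒ ⊢ u :≤ b) a b (U p) lt up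
  -- The point found is one row too high. A step down and into the next column repairs this, for
  -- which two columns leave room.
  ... | p , up , inj₂ vp = q ,
    lin 3 (λ d v w → v :≡ d :+ # 1 :+ # 1 ⇒ w :≡ v :- # 1 ⇒ ⊢ w :≡ d :+ # 1) d (V p) (V q) vp (V-mv true false p) ,
    lin 3 (λ a u w → u :≡ a ⇒ w :≡ u :+ # 1 ⇒ ⊢ a :≤ w) a (U p) (U q) up (U-mv true false p) ,
    lin 4 (λ a b u w → a :+ # 1 :≤ b ⇒ u :≡ a ⇒ w :≡ u :+ # 1 ⇒ ⊢ w :≤ b) a b (U p) (U q) lt up (U-mv true false p)
    where q = mv true false p
  cases : ∀ α′ β′ → b ≡ a + + α′ → d ≡ c + + β′ → α ≡ α′ → β ≡ β′ → ⊥
  cases α′ (suc β′) b≡ d≡ _ _ with lattice-point (b + 1ℤ) c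
  ... | p , up , inj₁ vp = insertion (side-insertion standard {a} {b} {c} {d} A (a≤b {a} {b} {α′} b≡) tight iff {p} up
          (ℤₚ.≤-reflexive (sym vp)) (ℤₚ.≤-trans (ℤₚ.≤-reflexive vp) (a≤b {c} {d} {suc β′} d≡)))
  ... | p , up , inj₂ vp = insertion (side-insertion standard {a} {b} {c} {d} A (a≤b {a} {b} {α′} b≡) tight iff {p} up
          (lin 2 (λ c v → v :≡ c :+ # 1 ⇒ ⊢ c :≤ v) c (V p) vp) (ℤₚ.≤-trans (ℤₚ.≤-reflexive vp)
              (a<b {c} {d} {β′} d≡)))
  cases (suc α′) zero b≡ d≡ _ _ with top-point (a<b {a} {b} {α′} b≡)
  ... | p , vp , a≤p , p≤b = insertion (side-insertion (swap standard) {c} {d} {a} {b} A (a≤b {c} {d} {0} d≡)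
      (swap-Tight tight)
          (λ q → mk⇔ (λ q∈ → let h , h′ = Equivalence.to (iff q) q∈ in h′ , h) (λ (h , h′) →
                  Equivalence.from (iff q) (h′ , h)))
          {p} vp a≤p p≤b)
  cases zero zero b≡ d≡ α≡0 β≡0 =
    let _ , p∉ , min = point⇒minimal-insertion A (proj₂ (proj₁ minA)) size≡1
                         (trans bsize≡ (cong₂ (λ α β → suc α ℕ.+ suc β ℕ.+ 2) α≡0 β≡0))
    in Dead⇒no-minimal-insertion p∉ dead min
    where
    size≡1 : size A ≡ 1
    size≡1 = ℕₚ.≤-antisym (at-most π (trans size≡ (cong₂ (λ α β → count π (suc α) (suc β)) α≡0 β≡0)))
      (subst (1 ℕ.≤_) (sym (proj₂ (∈⇒length≡suc (proj₂ (proj₁ minA))))) (s≤s z≤n))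
      where
      at-most : ∀ π → size A ≡ count π 1 1 → size A ℕ.≤ 1
      at-most true eq = ℕₚ.≤-reflexive eq
      at-most false eq = ℕₚ.≤-trans (ℕₚ.≤-reflexive eq) z≤n

-- Automorphisms and congruence

∣i∣≡1⇒i≡±1 : ∀ i → ∣ i ∣ ≡ 1 → i ≡ 1ℤ ⊎ i ≡ - 1ℤ
∣i∣≡1⇒i≡±1 (+ 1) refl = inj₁ refl
∣i∣≡1⇒i≡±1 -[1+ 0 ] refl = inj₂ refl

∈-neighbours⇒Adj : ∀ {p q} → q ∈ neighbours p → Adj p q
∈-neighbours⇒Adj {x , y} (here refl) = cong₂ (λ i j → ∣ i ∣ ℕ.+ ∣ j ∣)
  (lin 1 (λ x → ⊢ x :- (x :+ # 1) :≡ :- # 1) x) (lin 1 (λ x → ⊢ x :- x :≡ # 0) y)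
∈-neighbours⇒Adj {x , y} (there (here refl)) = cong₂ (λ i j → ∣ i ∣ ℕ.+ ∣ j ∣)
  (lin 1 (λ x → ⊢ x :- (x :- # 1) :≡ # 1) x) (lin 1 (λ x → ⊢ x :- x :≡ # 0) y)
∈-neighbours⇒Adj {x , y} (there (there (here refl))) = cong₂ (λ i j → ∣ i ∣ ℕ.+ ∣ j ∣)
  (lin 1 (λ x → ⊢ x :- x :≡ # 0) x) (lin 1 (λ x → ⊢ x :- (x :+ # 1) :≡ :- # 1) y)
∈-neighbours⇒Adj {x , y} (there (there (there (here refl)))) = cong₂ (λ i j → ∣ i ∣ ℕ.+ ∣ j ∣)
  (lin 1 (λ x → ⊢ x :- x :≡ # 0) x) (lin 1 (λ x → ⊢ x :- (x :- # 1) :≡ # 1) y)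

Adj⇒∈-neighbours : ∀ {p q} → Adj p q → q ∈ neighbours p
Adj⇒∈-neighbours {x , y} {x′ , y′} adj with ∣ x - x′ ∣ in ex | ∣ y - y′ ∣ in ey
... | zero | 1 with ∣i∣≡1⇒i≡±1 (y - y′) ey
...   | inj₁ eq = there (there (there (here (cong₂ _,_
        (lin 2 (λ x x′ → x :- x′ :≡ # 0 ⇒ ⊢ x′ :≡ x) x x′ (ℤₚ.∣i∣≡0⇒i≡0 ex))
        (lin 2 (λ y y′ → y :- y′ :≡ # 1 ⇒ ⊢ y′ :≡ y :- # 1) y y′ eq)))))
...   | inj₂ eq = there (there (here (cong₂ _,_
        (lin 2 (λ x x′ → x :- x′ :≡ # 0 ⇒ ⊢ x′ :≡ x) x x′ (ℤₚ.∣i∣≡0⇒i≡0 ex))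
        (lin 2 (λ y y′ → y :- y′ :≡ :- # 1 ⇒ ⊢ y′ :≡ y :+ # 1) y y′ eq))))
Adj⇒∈-neighbours {x , y} {x′ , y′} adj | 1 | zero with ∣i∣≡1⇒i≡±1 (x - x′) ex
...   | inj₁ eq = there (here (cong₂ _,_
        (lin 2 (λ y y′ → y :- y′ :≡ # 1 ⇒ ⊢ y′ :≡ y :- # 1) x x′ eq)
        (lin 2 (λ x x′ → x :- x′ :≡ # 0 ⇒ ⊢ x′ :≡ x) y y′ (ℤₚ.∣i∣≡0⇒i≡0 ey))))
...   | inj₂ eq = here (cong₂ _,_
        (lin 2 (λ y y′ → y :- y′ :≡ :- # 1 ⇒ ⊢ y′ :≡ y :+ # 1) x x′ eq)
        (lin 2 (λ x x′ → x :- x′ :≡ # 0 ⇒ ⊢ x′ :≡ x) y y′ (ℤₚ.∣i∣≡0⇒i≡0 ey)))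
Adj⇒∈-neighbours adj | 1 | suc _ = case adj of λ ()
Adj⇒∈-neighbours adj | suc (suc _) | _ = case adj of λ ()

module Image (A : FinSet) (f : Automorphism) where
  open Automorphism f

  fun-injective : ∀ {p q} → fun p ≡ fun q → p ≡ q
  fun-injective {p} {q} eq = trans (sym (inv-l p)) (trans (cong inv eq) (inv-l q))

  inv-injective : ∀ {p q} → inv p ≡ inv q → p ≡ q
  inv-injective {p} {q} eq = trans (sym (inv-r p)) (trans (cong fun eq) (inv-r q))

  image : FinSet
  image = map fun (elems A) , Uniqueₚ.map⁺ fun-injective (proj₂ A)

  ∈-image⁻ : ∀ {p} → fun p ∈ₛ image → p ∈ₛ A
  ∈-image⁻ h with ∈-map⁻ fun h
  ... | q , q∈ , eq = subst (_∈ elems A) (sym (fun-injective eq)) q∈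

  size-image : size image ≡ size A
  size-image = Listₚ.length-map fun (elems A)

  bsize-image : bsize image ≡ bsize A
  bsize-image = ℕₚ.≤-antisym
    (injection⇒length≤ inv inv-injective (boundary-unique image) pull)
    (injection⇒length≤ fun fun-injective (boundary-unique A) push)
    where
    push : ∀ {p} → p ∈ boundary A → fun p ∈ boundary image
    push {p} p∈ with ∈-boundary⁻ A p∈
    ... | p∉ , q , q∈ , n = ∈-boundary⁺ image (λ h → p∉ (∈-image⁻ h)) (∈-map⁺ fun q∈)
      (Adj⇒∈-neighbours (Equivalence.to (adj q p) (∈-neighbours⇒Adj n)))
    pull : ∀ {p} → p ∈ boundary image → inv p ∈ boundary A
    pull {p} p∈ with ∈-boundary⁻ image p∈
    ... | p∉ , q′ , q′∈ , n with ∈-map⁻ fun q′∈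
    ...   | q , q∈ , refl = ∈-boundary⁺ A
      (λ h → p∉ (subst (_∈ elems image) (inv-r p) (∈-map⁺ fun h))) q∈
      (Adj⇒∈-neighbours (Equivalence.from (adj q (inv p)) (subst (Adj (fun q)) (sym (inv-r p)) (∈-neighbours⇒Adj n))))

congruent-image : ∀ A {Q : Pt → Set} → Congruent ⟦ A ⟧ Q →
  ∃[ A′ ] (size A′ ≡ size A × bsize A′ ≡ bsize A × ∀ p → p ∈ₛ A′ ⇔ Q p)
congruent-image A (f , iff) = image , size-image , bsize-image , λ p → mk⇔
  (λ p∈ → let q , q∈ , eq = ∈-map⁻ (Automorphism.fun f) p∈ in Equivalence.from (iff p) (q , q∈ , sym eq))
  (λ h → let q , q∈ , eq = Equivalence.to (iff p) h in subst (_∈ elems image) eq (∈-map⁺ (Automorphism.fun f) q∈))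
  where open Image A f

congruent : {P Q : Pt → Set} (f : Automorphism) → (∀ p → P p → Q (Automorphism.fun f p)) →
  (∀ p → Q p → P (Automorphism.inv f p)) → Congruent P Q
congruent {P} {Q} f to from = f , λ p → mk⇔
  (λ h → Automorphism.inv f p , from p h , Automorphism.inv-r f p)
  (λ (q , h , eq) → subst Q eq (to q h))

congruent-trans : {P Q R : Pt → Set} → Congruent P Q → Congruent Q R → Congruent P R
congruent-trans {P} {Q} {R} (f , iff) (g , iff′) = h , λ p → mk⇔ to from
  where
  module f = Automorphism f
  module g = Automorphism g
  h : Automorphism
  h = record
    { fun = g.fun ∘ f.fun
    ; inv = f.inv ∘ g.inv
    ; inv-l = λ p → trans (cong f.inv (g.inv-l (f.fun p))) (f.inv-l p)
    ; inv-r = λ p → trans (cong g.fun (f.inv-r (g.inv p))) (g.inv-r p)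
    ; adj = λ p q → mk⇔ (Equivalence.to (g.adj (f.fun p) (f.fun q)) ∘ Equivalence.to (f.adj p q))
                        (Equivalence.from (f.adj p q) ∘ Equivalence.from (g.adj (f.fun p) (f.fun q)))
    }
  to : ∀ {p} → R p → ∃[ q ] (P q × g.fun (f.fun q) ≡ p)
  to {p} r with Equivalence.to (iff′ p) r
  ... | q , hq , refl with Equivalence.to (iff q) hq
  ...   | q′ , hq′ , refl = q′ , hq′ , refl
  from : ∀ {p} → ∃[ q ] (P q × g.fun (f.fun q) ≡ p) → R p
  from {p} (q , hq , eq) = Equivalence.from (iff′ p) (f.fun q , Equivalence.from (iff (f.fun q)) (q , hq , refl) , eq)

translation : Pt → Automorphism
translation (s , t) = record
  { fun = translate (s , t)
  ; inv = translate (- s , - t)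
  ; inv-l = translate-inverse s t
  ; inv-r = translate-inverse′ s t
  ; adj = λ p q → mk⇔ (subst (_≡ 1) (sym (same p q))) (subst (_≡ 1) (same p q))
  }
  where
  cancel : ∀ x x′ s → (x + s) - (x′ + s) ≡ x - x′
  cancel = lin 3 λ x x′ s → ⊢ x :+ s :- (x′ :+ s) :≡ x :- x′
  same : ∀ p q → ∣ (proj₁ p + s) - (proj₁ q + s) ∣ ℕ.+ ∣ (proj₂ p + t) -
      (proj₂ q + t) ∣ ≡ ∣ proj₁ p - proj₁ q ∣ ℕ.+ ∣ proj₂ p - proj₂ q ∣
  same (x , y) (x′ , y′) = cong₂ (λ i j → ∣ i ∣ ℕ.+ ∣ j ∣) (cancel x x′ s) (cancel y y′ t)

transposition : Automorphism
transposition = record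
  { fun = λ (x , y) → y , x
  ; inv = λ (x , y) → y , x
  ; inv-l = λ _ → refl
  ; inv-r = λ _ → refl
  ; adj = λ p q → mk⇔ (trans (ℕₚ.+-comm ∣ proj₂ p - proj₂ q ∣ ∣ proj₁ p - proj₁ q ∣))
                      (trans (ℕₚ.+-comm ∣ proj₁ p - proj₁ q ∣ ∣ proj₂ p - proj₂ q ∣))
  }

reflection : Automorphism
reflection = record
  { fun = λ (x , y) → - x , y
  ; inv = λ (x , y) → - x , y
  ; inv-l = λ (x , y) → cong (_, y) (ℤₚ.neg-involutive x)
  ; inv-r = λ (x , y) → cong (_, y) (ℤₚ.neg-involutive x)
  ; adj = λ p q → mk⇔ (subst (_≡ 1) (sym (same p q))) (subst (_≡ 1) (same p q))
  }
  where
  same : ∀ p q → ∣ - proj₁ p - - proj₁ q ∣ ℕ.+ ∣ proj₂ p - proj₂ q ∣ ≡ ∣ proj₁ p - proj₁ q ∣ ℕ.+ ∣ proj₂ p - proj₂ q ∣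
  same (x , y) (x′ , y′) = cong (ℕ._+ ∣ y - y′ ∣)
    (trans (cong ∣_∣ (lin 2 (λ x x′ → ⊢ :- x :- :- x′ :≡ :- (x :- x′)) x x′)) (ℤₚ.∣-i∣≡∣i∣ (x - x′)))

Box-congruent-to-origin : ∀ {a b c d α β} → b ≡ a + + α → d ≡ c + + β → Corner true a c →
  Congruent (InBox a b c d) (InB (+ α) (+ β))
Box-congruent-to-origin {a} {b} {c} {d} {α} {β} b≡ d≡ ((s , t) , us , vs) = congruent
    (translation (- s , - t)) to from
  where
  to : ∀ p → InBox a b c d p → InB (+ α) (+ β) (translate (- s , - t) p)
  to (x , y) ((h₁ , h₂) , (h₃ , h₄)) =
    ( lin 5 (λ a s t x y → t :- s :≡ a ⇒ a :≤ y :- x ⇒ ⊢ # 0 :≤ y :+ :- t :- (x :+ :- s)) a s t x y us h₁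
    , lin 7 (λ a b α s t x y → b :≡ a :+ α ⇒ t :- s :≡ a ⇒ y :- x :≤ b ⇒
        ⊢ y :+ :- t :- (x :+ :- s) :≤ α) a b (+ α) s t x y b≡ us h₂) ,
    ( lin 5 (λ c s t x y → t :+ s :≡ c ⇒ c :≤ y :+ x ⇒ ⊢ # 0 :≤ y :+ :- t :+ (x :+ :- s)) c s t x y vs h₃
    , lin 7 (λ c d β s t x y → d :≡ c :+ β ⇒ t :+ s :≡ c ⇒ y :+ x :≤ d ⇒
        ⊢ y :+ :- t :+ (x :+ :- s) :≤ β) c d (+ β) s t x y d≡ vs h₄)
  from : ∀ p → InB (+ α) (+ β) p → InBox a b c d (translate (- - s , - - t) p)
  from (x , y) ((h₁ , h₂) , (h₃ , h₄)) =
    ( lin 5 (λ a s t x y → t :- s :≡ a ⇒ # 0 :≤ y :- x ⇒ ⊢ a :≤ y :+ :- :- t :- (x :+ :- :- s)) a s t x y us h₁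
    , lin 7 (λ a b α s t x y → b :≡ a :+ α ⇒ t :- s :≡ a ⇒ y :- x :≤ α ⇒
        ⊢ y :+ :- :- t :- (x :+ :- :- s) :≤ b) a b (+ α) s t x y b≡ us h₂) ,
    ( lin 5 (λ c s t x y → t :+ s :≡ c ⇒ # 0 :≤ y :+ x ⇒ ⊢ c :≤ y :+ :- :- t :+ (x :+ :- :- s)) c s t x y vs h₃
    , lin 7 (λ c d β s t x y → d :≡ c :+ β ⇒ t :+ s :≡ c ⇒ y :+ x :≤ β ⇒
        ⊢ y :+ :- :- t :+ (x :+ :- :- s) :≤ d) c d (+ β) s t x y d≡ vs h₄)

Box-congruent-swap : ∀ {a b c d} → Congruent (InBox a b c d) (InBox c d a b)
Box-congruent-swap {a} {b} {c} {d} = congruent reflection to from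
  where
  plus : ∀ x y → y + x ≡ y - - x
  plus = lin 2 λ x y → ⊢ y :+ x :≡ y :- :- x
  to : ∀ p → InBox a b c d p → InBox c d a b (- proj₁ p , proj₂ p)
  to (x , y) ((h₁ , h₂) , (h₃ , h₄)) =
    (subst (c ≤_) (plus x y) h₃ , subst (_≤ d) (plus x y) h₄) , (h₁ , h₂)
  from : ∀ p → InBox c d a b p → InBox a b c d (- proj₁ p , proj₂ p)
  from (x , y) ((h₁ , h₂) , (h₃ , h₄)) =
    (subst (a ≤_) (plus x y) h₃ , subst (_≤ b) (plus x y) h₄) , (h₁ , h₂)

Box-congruent-flip : ∀ {a b c d} → Congruent (InBox a b c d) (InBox (- b) (- a) c d)
Box-congruent-flip {a} {b} {c} {d} = congruent transposition to from
  where
  to : ∀ p → InBox a b c d p → InBox (- b) (- a) c d (proj₂ p , proj₁ p)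
  to (x , y) ((h₁ , h₂) , (h₃ , h₄)) =
    ( lin 3 (λ b x y → y :- x :≤ b ⇒ ⊢ :- b :≤ x :- y) b x y h₂
    , lin 3 (λ a x y → a :≤ y :- x ⇒ ⊢ x :- y :≤ :- a) a x y h₁) ,
    ( subst (c ≤_) (ℤₚ.+-comm y x) h₃ , subst (_≤ d) (ℤₚ.+-comm y x) h₄)
  from : ∀ p → InBox (- b) (- a) c d p → InBox a b c d (proj₂ p , proj₁ p)
  from (x , y) ((h₁ , h₂) , (h₃ , h₄)) =
    ( lin 3 (λ a x y → y :- x :≤ :- a ⇒ ⊢ a :≤ x :- y) a x y h₂
    , lin 3 (λ b x y → :- b :≤ y :- x ⇒ ⊢ x :- y :≤ b) b x y h₁) ,
    ( subst (c ≤_) (ℤₚ.+-comm y x) h₃ , subst (_≤ d) (ℤₚ.+-comm y x) h₄)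

-- Efficient boxes

double-≤ : ∀ {m n} → m ℕ.+ m ℕ.≤ suc (n ℕ.+ n) → m ℕ.≤ n
double-≤ {m} {n} le with m ℕ.≤? n
... | yes m≤n = m≤n
... | no m≰n = ⊥-elim (ℕₚ.1+n≰n (ℕₚ.≤-trans (ℕₚ.≤-reflexive (cong suc (sym (ℕₚ.+-suc n n))))
        (ℕₚ.≤-trans (ℕₚ.+-mono-≤ (ℕₚ.≰⇒> m≰n) (ℕₚ.≰⇒> m≰n)) le)))

-- For `s` at most `t` write `r = s + e`. Then `t` is at most `s + 2e`, and `s (s + 2e)` falls short
-- of the square of `s + e` by `e * e`.
product-≤-square : ∀ {s t r} → s ℕ.+ t ℕ.≤ r ℕ.+ r → s ℕ.* t ℕ.≤ r ℕ.* r
product-≤-square {s} {t} {r} le = [ ordered s t le , (λ t≤s → subst (ℕ._≤ r ℕ.* r) (ℕₚ.*-comm t s)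
    (ordered t s (subst (ℕ._≤ r ℕ.+ r) (ℕₚ.+-comm s t) le) t≤s)) ]′ (ℕₚ.≤-total s t)
  where
  ordered : ∀ s t → s ℕ.+ t ℕ.≤ r ℕ.+ r → s ℕ.≤ t → s ℕ.* t ℕ.≤ r ℕ.* r
  ordered s t le s≤t with ℕₚ.m≤n⇒∃[o]m+o≡n (double-≤ {s} {r} (ℕₚ.m≤n⇒m≤1+n (ℕₚ.≤-trans (ℕₚ.+-monoʳ-≤ s s≤t) le)))
  ... | e , refl = begin
    s ℕ.* t                             ≤⟨ ℕₚ.*-monoʳ-≤ s (ℕₚ.+-cancelˡ-≤ s t _ (ℕₚ.≤-trans le (ℕₚ.≤-reflexive
        (split s e)))) ⟩
    s ℕ.* (s ℕ.+ (e ℕ.+ e))             ≤⟨ ℕₚ.m≤m+n _ (e ℕ.* e) ⟩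
    s ℕ.* (s ℕ.+ (e ℕ.+ e)) ℕ.+ e ℕ.* e ≡⟨ expand s e ⟩
    (s ℕ.+ e) ℕ.* (s ℕ.+ e)             ∎
    where
    open ℕₚ.≤-Reasoning
    split : ∀ s e → (s ℕ.+ e) ℕ.+ (s ℕ.+ e) ≡ s ℕ.+ (s ℕ.+ (e ℕ.+ e))
    split = ℕ-Solver.solve-∀
    expand : ∀ s e → s ℕ.* (s ℕ.+ (e ℕ.+ e)) ℕ.+ e ℕ.* e ≡ (s ℕ.+ e) ℕ.* (s ℕ.+ e)
    expand = ℕ-Solver.solve-∀

product-≤-pronic : ∀ {s t r} → s ℕ.+ t ℕ.≤ r ℕ.+ suc r → s ℕ.* t ℕ.≤ r ℕ.* suc r
product-≤-pronic {s} {t} {r} le = [ ordered s t le , (λ t≤s → subst (ℕ._≤ r ℕ.* suc r) (ℕₚ.*-comm t s)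
    (ordered t s (subst (ℕ._≤ r ℕ.+ suc r) (ℕₚ.+-comm s t) le) t≤s)) ]′ (ℕₚ.≤-total s t)
  where
  ordered : ∀ s t → s ℕ.+ t ℕ.≤ r ℕ.+ suc r → s ℕ.≤ t → s ℕ.* t ℕ.≤ r ℕ.* suc r
  ordered s t le s≤t with ℕₚ.m≤n⇒∃[o]m+o≡n (double-≤ {s} {r}
      (subst (s ℕ.+ s ℕ.≤_) (ℕₚ.+-suc r r) (ℕₚ.≤-trans (ℕₚ.+-monoʳ-≤ s s≤t) le)))
  ... | e , refl = begin
    s ℕ.* t                                                ≤⟨ ℕₚ.*-monoʳ-≤ s (ℕₚ.+-cancelˡ-≤ s t _ (ℕₚ.≤-trans le
        (ℕₚ.≤-reflexive (split s e)))) ⟩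
    s ℕ.* suc (s ℕ.+ (e ℕ.+ e))                            ≤⟨ ℕₚ.m≤m+n _ (e ℕ.* e ℕ.+ e) ⟩
    s ℕ.* suc (s ℕ.+ (e ℕ.+ e)) ℕ.+ (e ℕ.* e ℕ.+ e)        ≡⟨ expand s e ⟩
    (s ℕ.+ e) ℕ.* suc (s ℕ.+ e)                            ∎
    where
    open ℕₚ.≤-Reasoning
    split : ∀ s e → (s ℕ.+ e) ℕ.+ suc (s ℕ.+ e) ≡ s ℕ.+ suc (s ℕ.+ (e ℕ.+ e))
    split = ℕ-Solver.solve-∀
    expand : ∀ s e → s ℕ.* suc (s ℕ.+ (e ℕ.+ e)) ℕ.+ (e ℕ.* e ℕ.+ e) ≡ (s ℕ.+ e) ℕ.* suc (s ℕ.+ e)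
    expand = ℕ-Solver.solve-∀

origin-corner : Corner true 0ℤ 0ℤ
origin-corner = (0ℤ , 0ℤ) , refl , refl

-- A box with sides s - 1, t - 1 has at most (s t + 1) / 2 points, so this makes the box α × β at the
-- origin largest for its boundary.
Optimal : ℕ → ℕ → Set
Optimal α β = ∀ s t → s ℕ.+ t ℕ.≤ suc α ℕ.+ suc β → s ℕ.* t ℕ.≤ count true (suc α) (suc β) ℕ.+ count true (suc α)
    (suc β)

-- Twice the size is at most an even number plus one, and halving absorbs the extra one.
Shape-size-≤ : ∀ {D α β} → Optimal α β → Shape D → bsize D ℕ.≤ suc α ℕ.+ suc β ℕ.+ 2 →
    size D ℕ.≤ count true (suc α) (suc β)
Shape-size-≤ {D} {α} {β} opt sh le = double-≤ (ℕₚ.≤-trans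
    (ℕₚ.≤-trans (ℕₚ.≤-reflexive (cong₂ ℕ._+_ size≡ size≡)) (double-count-≤ π (suc sα) (suc sβ)))
    (s≤s (opt (suc sα) (suc sβ) (ℕₚ.+-cancelʳ-≤ 2 _ _ (subst (ℕ._≤ suc α ℕ.+ suc β ℕ.+ 2) bsize≡ le)))))
  where open Shape sh renaming (α to sα; β to sβ)

congruent-optimal⇒Efficient : ∀ A α β → Optimal α β → Congruent ⟦ A ⟧ (InB (+ α) (+ β)) → Efficient A
congruent-optimal⇒Efficient A α β opt cong-A C eq with congruent-image A cong-A
... | A′ , size-A′ , bsize-A′ , iff = subst (size C ℕ.≤_) size-A (C≤ (elems C) refl)
  where
  size-A : count true (suc α) (suc β) ≡ size A
  size-A = trans (sym (box-size A′ true {s = suc α} {suc β} (+1≡ {0ℤ} {+ α} {α} refl)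
      (+1≡ {0ℤ} {+ β} {β} refl) origin-corner iff)) size-A′
  bsize-C : bsize C ℕ.≤ suc α ℕ.+ suc β ℕ.+ 2
  bsize-C = ℕₚ.≤-trans (ℕₚ.≤-reflexive (trans eq (sym bsize-A′)))
    (box-bsize-≤ A′ {s = suc α} {suc β} (+1≡ {0ℤ} {+ α} {α} refl) (+1≡ {0ℤ} {+ β} {β} refl) iff)
  -- The empty set has no point from which a box could be grown and is settled separately.
  C≤ : ∀ L → L ≡ elems C → size C ℕ.≤ count true (suc α) (suc β)
  C≤ [] eq = subst (λ L → length L ℕ.≤ count true (suc α) (suc β)) eq z≤n
  C≤ (x ∷ L) eq with box-bound C (subst (x ∈_) eq (here refl))
  ... | D , box , C≤D , ∂D≤∂C = ℕₚ.≤-trans C≤D (Shape-size-≤ {D} {α} {β} opt (shape D box) (ℕₚ.≤-trans ∂D≤∂C bsize-C))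

square-optimal : ∀ m → Optimal m m
square-optimal m s t le = ℕₚ.≤-trans (product-≤-square {s} {t} {suc m} le) (double-count-true-≥ (suc m) (suc m))

pronic-optimal : ∀ m → Optimal m (suc m)
pronic-optimal m s t le = ℕₚ.≤-trans (product-≤-pronic {s} {t} {suc m} le) (double-count-true-≥ (suc m) (suc (suc m)))

-- The sides differ by two, yet nothing is lost: with lattice corners the count is rounded up, and
-- (2k + 1)(2k + 3) + 1 is the square of 2k + 2.
odd-optimal : ∀ k → Optimal (k ℕ.+ k) (2 ℕ.+ (k ℕ.+ k))
odd-optimal k s t le = ℕₚ.≤-trans (product-≤-square {s} {t} {2 ℕ.+ (k ℕ.+ k)}
    (subst (s ℕ.+ t ℕ.≤_) (perimeter k) le)) (ℕₚ.≤-reflexive area)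
  where
  perimeter : ∀ k → suc (k ℕ.+ k) ℕ.+ suc (2 ℕ.+ (k ℕ.+ k)) ≡ (2 ℕ.+ (k ℕ.+ k)) ℕ.+ (2 ℕ.+ (k ℕ.+ k))
  perimeter = ℕ-Solver.solve-∀
  square : ∀ k → (2 ℕ.+ (k ℕ.+ k)) ℕ.* (2 ℕ.+ (k ℕ.+ k)) ≡
    (suc k ℕ.* suc (suc k) ℕ.+ k ℕ.* suc k) ℕ.+ (suc k ℕ.* suc (suc k) ℕ.+ k ℕ.* suc k)
  square = ℕ-Solver.solve-∀
  area : (2 ℕ.+ (k ℕ.+ k)) ℕ.* (2 ℕ.+ (k ℕ.+ k)) ≡
    count true (suc (k ℕ.+ k)) (3 ℕ.+ (k ℕ.+ k)) ℕ.+ count true (suc (k ℕ.+ k)) (3 ℕ.+ (k ℕ.+ k))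
  area rewrite ⌊k+k/2⌋ k | ⌈k+k/2⌉ k = square k

module _ where
  open Frame standard

  private
    right-corner : ∀ {a b c α} → b ≡ a + + α → Corner false a c → ∀ k → α ≡ suc (k ℕ.+ k) → Corner true (- b) c
    right-corner {a} {b} {c} b≡ (q , uq , vq) k refl with lattice-point b c
    ... | (x , y) , up , inj₁ vp = (y , x) , lin 3 (λ b x y → y :- x :≡ b ⇒
        ⊢ x :- y :≡ :- b) b x y up , trans (ℤₚ.+-comm x y) vp
    -- Otherwise `(b , c + 1)` and `(a , c + 1)` would both be lattice points, at the odd distance
    -- `b - a`.
    ... | p , up , inj₂ vp = ⊥-elim (odd-absurd standard p q (+ k)
      (trans (cong₂ _+_ (cong₂ _-_ up uq) (cong₂ _-_ vp vq))
        (lin 4 (λ a b c k → b :≡ a :+ (# 1 :+ (k :+ k)) ⇒ ⊢ b :- a :+ (c :+ # 1 :- (c :+ # 1)) :≡ k :+ k :+ # 1)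
          a b c (+ k) b≡)))

    top-corner : ∀ {a c d β} → d ≡ c + + β → Corner false a c → ∀ k → β ≡ suc (k ℕ.+ k) → Corner true (- d) a
    top-corner {a} {c} {d} d≡ (q , uq , vq) k refl with lattice-point a d
    ... | (x , y) , up , inj₁ vp = (y , - x) ,
      lin 3 (λ d x y → y :+ x :≡ d ⇒ ⊢ :- x :- y :≡ :- d) d x y vp ,
          lin 3 (λ a x y → y :- x :≡ a ⇒ ⊢ :- x :+ y :≡ a) a x y up
    ... | p , up , inj₂ vp = ⊥-elim (odd-absurd standard p q (+ k)
      (trans (cong₂ _+_ (cong₂ _-_ up uq) (cong₂ _-_ vp vq))
        (lin 4 (λ a c d k → d :≡ c :+ (# 1 :+ (k :+ k)) ⇒ ⊢ a :- a :+ (d :+ # 1 :- (c :+ # 1)) :≡ k :+ k :+ # 1)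
          a c d (+ k) d≡)))

    flipped≡ : ∀ {a b} n → b ≡ a + n → - a ≡ - b + n
    flipped≡ {a} {b} n = lin 3 (λ a b n → b :≡ a :+ n ⇒ ⊢ :- a :≡ :- b :+ n) a b n

  -- A box whose sides are not both of even length α, β has a corner in the lattice, up to a symmetry.
  congruent-to-origin : ∀ {a b c d α β} → b ≡ a + + α → d ≡ c + + β → ∀ π → Corner π a c →
    (π ≡ true ⊎ (∃[ k ] α ≡ suc (k ℕ.+ k)) ⊎ (∃[ k ] β ≡ suc (k ℕ.+ k))) → Congruent (InBox a b c d) (InB (+ α) (+ β))
  congruent-to-origin b≡ d≡ true corner _ = Box-congruent-to-origin b≡ d≡ corner
  congruent-to-origin {a} {b} {c} {d} {α} {β} b≡ d≡ false corner (inj₂ (inj₁ (k , eq))) =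
    congruent-trans Box-congruent-flip (Box-congruent-to-origin { - b} { - a} {c} {d} {α} {β} (flipped≡ {a} {b}
        (+ α) b≡) d≡ (right-corner {a} {b} {c} {α} b≡ corner k eq))
  congruent-to-origin {a} {b} {c} {d} {α} {β} b≡ d≡ false corner (inj₂ (inj₂ (k , eq))) =
    -- The first swap brings the odd side to the coordinate that is flipped; the last one restores
    -- the order of `α` and `β`.
    congruent-trans Box-congruent-swap (congruent-trans Box-congruent-flip (congruent-trans
      (Box-congruent-to-origin { - d} { - c} {a} {b} {β} {α} (flipped≡ {c} {d} (+ β) d≡) b≡
          (top-corner {a} {c} {d} {β} d≡ corner k eq)) Box-congruent-swap))

congruent-elements : ∀ {A P Q} → (∀ p → p ∈ₛ A ⇔ P p) → Congruent P Q → Congruent ⟦ A ⟧ Q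
congruent-elements iff (f , iff′) = f , λ p → mk⇔
  (λ h → let q , hq , eq = Equivalence.to (iff′ p) h in q , Equivalence.from (iff q) hq , eq)
  (λ (q , hq , eq) → Equivalence.from (iff′ p) (q , Equivalence.to (iff q) hq , eq))

Exceptional : FinSet → Set
Exceptional A = (∃[ m ] Congruent ⟦ A ⟧ (InB (+ m) (+ m)))
  ⊎ (∃[ m ] Congruent ⟦ A ⟧ (InB (+ m) ((+ m) + 1ℤ)))
  ⊎ (∃[ m ] (Odd m × Congruent ⟦ A ⟧ (InB ((+ m) - 1ℤ) ((+ m) + 1ℤ))))

-- An efficient set is compared with a box of the same boundary. Its sides `1 + α` and `1 + β` are
-- positive, so it is tight and the boundary formula applies; its corner is a lattice point, so its
-- count is the larger one.
efficient-bound : ∀ A α β → Efficient A → bsize A ≡ (2 ℕ.+ α) ℕ.+ (2 ℕ.+ β) ℕ.+ 2 →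
  count true (2 ℕ.+ α) (2 ℕ.+ β) ℕ.≤ size A
efficient-bound A α β eff bsize≡ = compare (box-points true b+1≡ d+1≡ origin-corner)
  where
  b+1≡ : + suc α + 1ℤ ≡ 0ℤ + + (2 ℕ.+ α)
  b+1≡ = +1≡ {0ℤ} {+ suc α} {suc α} refl
  d+1≡ : + suc β + 1ℤ ≡ 0ℤ + + (2 ℕ.+ β)
  d+1≡ = +1≡ {0ℤ} {+ suc β} {suc β} refl
  compare : ∃[ D ] (size D ≡ count true (2 ℕ.+ α) (2 ℕ.+ β) × ∀ p → p ∈ₛ D ⇔ InBox 0ℤ (+ suc α) 0ℤ (+ suc β) p) →
    count true (2 ℕ.+ α) (2 ℕ.+ β) ℕ.≤ size A
  compare (D , sz , iff) = subst (ℕ._≤ size A) sz (eff D (trans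
    (tight-bsize D {s = 2 ℕ.+ α} {2 ℕ.+ β} b+1≡ d+1≡ iff
      (nondegenerate⇒Tight standard {0ℤ} {+ suc α} {0ℤ} {+ suc β} (+≤+ (s≤s z≤n)) (+≤+ (s≤s z≤n))))
    (sym bsize≡)))

-- For m even and no corner in the lattice, the box of the same shape with lattice corners is larger.
efficient-square : ∀ A {x} → x ∈ₛ A → Efficient A → ∀ m π → size A ≡ count π (suc m) (suc m) →
  bsize A ≡ suc m ℕ.+ suc m ℕ.+ 2 → π ≡ true ⊎ (∃[ k ] m ≡ suc (k ℕ.+ k))
efficient-square A x∈ eff m true _ _ = inj₁ refl
-- A single position off the lattice contains no point.
efficient-square A x∈ eff zero false size≡ _ with trans (sym size≡) (proj₂ (∈⇒length≡suc x∈))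
... | ()
efficient-square A x∈ eff (suc m) false size≡ bsize≡ with even⊎odd (suc m)
... | k , inj₂ eq = inj₂ (k , eq)
... | k , inj₁ eq = ⊥-elim (ℕₚ.1+n≰n (begin
    suc (size A ℕ.+ size A)            ≡⟨ cong (λ n → suc (n ℕ.+ n)) size≡ ⟩
    suc (n ℕ.+ n)                      ≡⟨ subst (λ s → let n = count false (suc s) (suc s) in suc
            (n ℕ.+ n) ≡ suc s ℕ.* suc s)
                                            (sym eq) (double-count-odd k k) ⟩
    (2 ℕ.+ m) ℕ.* (2 ℕ.+ m)            ≤⟨ double-count-true-≥ (2 ℕ.+ m) (2 ℕ.+ m) ⟩
    n′ ℕ.+ n′                          ≤⟨ ℕₚ.+-mono-≤ bound bound ⟩
    size A ℕ.+ size A                  ∎))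
  where
  open ℕₚ.≤-Reasoning
  n = count false (2 ℕ.+ m) (2 ℕ.+ m)
  n′ = count true (2 ℕ.+ m) (2 ℕ.+ m)
  bound : n′ ℕ.≤ size A
  bound = efficient-bound A m m eff bsize≡

-- Compare with the box whose sides are α + 1 and β - 1.
efficient-oblong : ∀ A → Efficient A → ∀ α j π → size A ≡ count π (suc α) (3 ℕ.+ (α ℕ.+ j)) →
  bsize A ≡ suc α ℕ.+ (3 ℕ.+ (α ℕ.+ j)) ℕ.+ 2 → j ≡ 0 × π ≡ true × ∃[ k ] α ≡ k ℕ.+ k
efficient-oblong A eff α j π size≡ bsize≡ = conclude (double-count π s t)
  where
  open ℕₚ.≤-Reasoning
  s t n n′ : ℕ
  s = suc α
  t = 3 ℕ.+ (α ℕ.+ j)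
  n = count π s t
  n′ = count true (2 ℕ.+ α) (2 ℕ.+ (α ℕ.+ j))
  perimeter : ∀ α j → suc α ℕ.+ (3 ℕ.+ (α ℕ.+ j)) ℕ.+ 2 ≡ (2 ℕ.+ α) ℕ.+ (2 ℕ.+ (α ℕ.+ j)) ℕ.+ 2
  perimeter = ℕ-Solver.solve-∀
  -- Moving one unit from the longer to the shorter side raises the area by `suc j`. Rounding gives
  -- `A` back at most one, which leaves only `j = 0`, with a lattice corner and odd `s` and `t`.
  area : ∀ α j → suc α ℕ.* (3 ℕ.+ (α ℕ.+ j)) ℕ.+ suc j ≡ (2 ℕ.+ α) ℕ.* (2 ℕ.+ (α ℕ.+ j))
  area = ℕ-Solver.solve-∀
  n′≤n : n′ ℕ.≤ n
  n′≤n = subst (n′ ℕ.≤_) size≡ (efficient-bound A α (α ℕ.+ j) eff (trans bsize≡ (perimeter α j)))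
  bound : s ℕ.* t ℕ.+ suc j ℕ.≤ n ℕ.+ n
  bound = begin
    s ℕ.* t ℕ.+ suc j                        ≡⟨ area α j ⟩
    (2 ℕ.+ α) ℕ.* (2 ℕ.+ (α ℕ.+ j))          ≤⟨ double-count-true-≥ (2 ℕ.+ α) (2 ℕ.+ (α ℕ.+ j)) ⟩
    n′ ℕ.+ n′                                ≤⟨ ℕₚ.+-mono-≤ n′≤n n′≤n ⟩
    n ℕ.+ n                                  ∎
  too-large : n ℕ.+ n ℕ.≤ s ℕ.* t → ⊥
  too-large le = ℕₚ.m+1+n≰m (s ℕ.* t) (ℕₚ.≤-trans bound le)
  conclude : (n ℕ.+ n ≡ s ℕ.* t ⊎ (∃[ k ] s ≡ suc (k ℕ.+ k)) × (∃[ l ] t ≡ suc (l ℕ.+ l)) ×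
      (π ≡ true × n ℕ.+ n ≡ suc (s ℕ.* t) ⊎ π ≡ false × suc (n ℕ.+ n) ≡ s ℕ.* t)) →
    j ≡ 0 × π ≡ true × ∃[ k ] α ≡ k ℕ.+ k
  conclude (inj₁ eq) = ⊥-elim (too-large (ℕₚ.≤-reflexive eq))
  conclude (inj₂ (_ , _ , inj₂ (_ , eq))) = ⊥-elim (too-large (ℕₚ.≤-trans (ℕₚ.n≤1+n _) (ℕₚ.≤-reflexive eq)))
  conclude (inj₂ ((k , s≡) , _ , inj₁ (π≡ , eq))) =
    ℕₚ.n≤0⇒n≡0 (ℕ.s≤s⁻¹ (ℕₚ.+-cancelˡ-≤ (s ℕ.* t) (suc j) 1
      (ℕₚ.≤-trans bound (ℕₚ.≤-reflexive (trans eq (ℕₚ.+-comm 1 (s ℕ.* t))))))) , π≡ , k , ℕₚ.suc-injective s≡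

module Classify (A : FinSet) {x : Pt} (x∈ : x ∈ₛ A) (eff : Efficient A) where

  -- The difference `e` of the side lengths decides the family: 0, 1, or more, where efficiency
  -- leaves only 2. `via` carries the congruence back to `A`, so that boxes with the longer side
  -- first are covered after a swap.
  ordered : ∀ {a b c d α} e → b ≡ a + + α → d ≡ c + + (α ℕ.+ e) → ∀ π → Corner π a c →
    size A ≡ count π (suc α) (suc (α ℕ.+ e)) → bsize A ≡ suc α ℕ.+ suc (α ℕ.+ e) ℕ.+ 2 →
    (∀ {Q} → Congruent (InBox a b c d) Q → Congruent ⟦ A ⟧ Q) → Exceptional A
  ordered {a} {b} {c} {d} {α} zero b≡ d≡ π corner size≡ bsize≡ via
    rewrite ℕₚ.+-identityʳ α with efficient-square A x∈ eff α π size≡ bsize≡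
  ... | inj₁ π≡ = inj₁ (α , via (congruent-to-origin b≡ d≡ π corner (inj₁ π≡)))
  ... | inj₂ odd = inj₁ (α , via (congruent-to-origin b≡ d≡ π corner (inj₂ (inj₁ odd))))
  -- One of `α` and `α + 1` is odd, so up to symmetry the box has a lattice corner.
  ordered {a} {b} {c} {d} {α} 1 b≡ d≡ π corner size≡ bsize≡ via =
    inj₂ (inj₁ (α , via (congruent-to-origin b≡ d≡ π corner (inj₂ odd-side))))
    where
    odd-side : (∃[ k ] α ≡ suc (k ℕ.+ k)) ⊎ (∃[ k ] α ℕ.+ 1 ≡ suc (k ℕ.+ k))
    odd-side with even⊎odd α
    ... | k , inj₂ eq = inj₁ (k , eq)
    ... | k , inj₁ eq = inj₂ (k , trans (ℕₚ.+-comm α 1) (cong suc eq))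
  ordered {a} {b} {c} {d} {α} (suc (suc j)) b≡ d≡ π corner size≡ bsize≡ via
    with efficient-oblong A eff α j π (trans size≡ (cong (λ t → count π (suc α) (suc t)) shift))
           (trans bsize≡ (cong (λ t → suc α ℕ.+ suc t ℕ.+ 2) shift))
    where
    shift : α ℕ.+ suc (suc j) ≡ 2 ℕ.+ (α ℕ.+ j)
    shift = trans (ℕₚ.+-suc α (suc j)) (cong suc (ℕₚ.+-suc α j))
  ... | refl , refl , k , refl = inj₂ (inj₂ (suc (2 ℕ.* k) , (k , refl) ,
    subst₂ (λ i j → Congruent ⟦ A ⟧ (InB (+ i) (+ j))) (low k) (high k)
      (via (congruent-to-origin b≡ d≡ true corner (inj₁ refl)))))
    where
    low : ∀ k → k ℕ.+ k ≡ 2 ℕ.* k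
    low = ℕ-Solver.solve-∀
    high : ∀ k → (k ℕ.+ k) ℕ.+ 2 ≡ suc (2 ℕ.* k) ℕ.+ 1
    high = ℕ-Solver.solve-∀

  classify : Shape A → Exceptional A
  classify sh = [ wide , tall ]′ (ℕₚ.≤-total α β)
    where
    open Shape sh
    wide : α ℕ.≤ β → Exceptional A
    wide α≤β with ℕₚ.m≤n⇒∃[o]m+o≡n α≤β
    ... | e , eq = ordered e b≡ (trans d≡ (cong (λ β → c + + β) (sym eq))) π corner
      (trans size≡ (cong (λ β → count π (suc α) (suc β)) (sym eq)))
      (trans bsize≡ (cong (λ β → suc α ℕ.+ suc β ℕ.+ 2) (sym eq)))
      (congruent-elements {A} iff)
    swap-count : ∀ π s t → count π s t ≡ count π t s
    swap-count true s t = cong₂ ℕ._+_ (ℕₚ.*-comm ⌈ s /2⌉ ⌈ t /2⌉) (ℕₚ.*-comm ⌊ s /2⌋ ⌊ t /2⌋)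
    swap-count false s t = trans (ℕₚ.+-comm (⌈ s /2⌉ ℕ.* ⌊ t /2⌋) (⌊ s /2⌋ ℕ.* ⌈ t /2⌉))
      (cong₂ ℕ._+_ (ℕₚ.*-comm ⌊ s /2⌋ ⌈ t /2⌉) (ℕₚ.*-comm ⌈ s /2⌉ ⌊ t /2⌋))
    swap-corner : ∀ π → Corner π a c → Corner π c a
    swap-corner true ((x , y) , u , v) = (- x , y) , trans (lin 2 (λ x y → ⊢ y :- :- x :≡ y :+ x) x y) v , u
    -- The reflected point is at `(c + 1 , a)` in diagonal coordinates; one step moves it to
    -- `(c , a + 1)`.
    swap-corner false ((x , y) , u , v) = (- x + 1ℤ , y) ,
      lin 3 (λ c x y → y :+ x :≡ c :+ # 1 ⇒ ⊢ y :- (:- x :+ # 1) :≡ c) c x y v ,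
      lin 3 (λ a x y → y :- x :≡ a ⇒ ⊢ y :+ (:- x :+ # 1) :≡ a :+ # 1) a x y u
    tall : β ℕ.≤ α → Exceptional A
    tall β≤α with ℕₚ.m≤n⇒∃[o]m+o≡n β≤α
    ... | e , eq = ordered e d≡ (trans b≡ (cong (λ α → a + + α) (sym eq))) π (swap-corner π corner)
      (trans size≡ (trans (swap-count π (suc α) (suc β)) (cong (λ α → count π (suc β) (suc α)) (sym eq))))
      (trans bsize≡ (trans (cong (ℕ._+ 2) (ℕₚ.+-comm (suc α) (suc β))) (cong (λ α → suc β ℕ.+ suc α ℕ.+ 2) (sym eq))))
      (λ h → congruent-elements {A} iff (congruent-trans Box-congruent-swap h))

Exceptional⇒Efficient : ∀ {A} → Exceptional A → Efficient A
Exceptional⇒Efficient {A} (inj₁ (m , h)) = congruent-optimal⇒Efficient A m m (square-optimal m) h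
Exceptional⇒Efficient {A} (inj₂ (inj₁ (m , h))) = congruent-optimal⇒Efficient A m (suc m) (pronic-optimal m)
  (subst (λ β → Congruent ⟦ A ⟧ (InB (+ m) (+ β))) (ℕₚ.+-comm m 1) h)
Exceptional⇒Efficient {A} (inj₂ (inj₂ (_ , (k , refl) , h))) =
  congruent-optimal⇒Efficient A (k ℕ.+ k) (2 ℕ.+ (k ℕ.+ k)) (odd-optimal k)
    (subst₂ (λ α β → Congruent ⟦ A ⟧ (InB (+ α) (+ β))) (low k) (high k) h)
  where
  low : ∀ k → 2 ℕ.* k ≡ k ℕ.+ k
  low = ℕ-Solver.solve-∀
  high : ∀ k → suc (2 ℕ.* k) ℕ.+ 1 ≡ 2 ℕ.+ (k ℕ.+ k)
  high = ℕ-Solver.solve-∀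

theorem8p5 : (A : FinSet) → Minimal A →
    ((Dead A ⇔ (IsBox A × ¬ Efficient A))
    × ((IsBox A × ¬ Efficient A) ⇔
       (IsBox A
        × (∀ (m : ℕ) → ¬ Congruent ⟦ A ⟧ (InB (+ m) (+ m)))
        × (∀ (m : ℕ) → ¬ Congruent ⟦ A ⟧ (InB (+ m) ((+ m) + 1ℤ)))
        × (∀ (m : ℕ) → Odd m → ¬ Congruent ⟦ A ⟧ (InB ((+ m) - 1ℤ) ((+ m) + 1ℤ))))))
theorem8p5 A minA@((x , x∈) , _) =
  mk⇔ (λ dead → let box = Dead⇒TightBox {A} minA dead in
         TightBox⇒IsBox A x∈ box , Dead⇒¬Efficient {A} minA (shape A box) dead)
      (λ (box , ¬eff) → ¬Efficient-box⇒Dead {A} minA box ¬eff) ,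
  mk⇔ (λ (box , ¬eff) → box ,
         (λ m h → ¬eff (Exceptional⇒Efficient {A} (inj₁ (m , h)))) ,
         (λ m h → ¬eff (Exceptional⇒Efficient {A} (inj₂ (inj₁ (m , h))))) ,
         (λ m odd h → ¬eff (Exceptional⇒Efficient {A} (inj₂ (inj₂ (m , odd , h))))))
      (λ (box , ¬square , ¬pronic , ¬odd) → box , λ eff →
         [ (λ (m , h) → ¬square m h) , [ (λ (m , h) → ¬pronic m h) , (λ (m , odd , h) → ¬odd m odd h) ]′ ]′
           (Classify.classify A x∈ eff (shape A (IsBox⇒TightBox {A} minA box))))
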